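{- Let $\mathcal{H}=(V,H)$ be a boolean representable simplicial complex of dimension $2$. Then the following conditions are equivalent: (i) $\mathcal{H}$ is shellable; (ii) $\mathcal{H}$ is sequentially Cohen-Macaulay; (iii) the graph of flats $\Gamma\mathrm{Fl}\mathcal{H}_S$ of the simplification $\mathcal{H}_S$ contains at most two connected components or contains exactly one nontrivial connected component.
   Context: A (finite) simplicial complex is a pair $\mathcal{H}=(V,H)$ where $V$ is a finite nonempty set and $H\subseteq 2^V$ contains all singletons and is closed under taking subsets; elements of $H$ are faces, maximal faces are facets, the dimension of a face $I$ is $|I|-1$, $\dim\mathcal{H}$ is the maximum dimension of a face, and $\mathcal{H}$ is pure if all facets have the same dimension. $P_n(V)$ is the set of $n$-subsets of $V$ and $pq$ denotes $\{p,q\}$. A boolean matrix with row set $R$ and column set $V$ is nonsingular if, after independently permuting rows and columns, it is square lower unitriangular; $X\subseteq V$ is $M$-independent if some submatrix $M[Y,X]$ ($Y\subseteq R$) is nonsingular; $\mathcal{H}$ is boolean representable if $H$ is the set of $M$-independent subsets for some boolean matrix $M$. A flat is a set $X\subseteq V$ such that $I\cup\{p\}\in H$ for all $I\in H$ with $I\subseteq X$ and all $p\in V\setminus X$; $\overline{X}$ is the intersection of all flats containing $X$. The graph of flats $\Gamma\mathrm{Fl}\mathcal{H}$ has vertex set $V$ and edges $p - q$ for $p\neq q$ with $\overline{pq}\neq V$; a connected component is nontrivial if it has more than one vertex. The equivalence relation $\eta$ on $V$ is $a\,\eta\, b$ iff $\overline{\{a\}}=\overline{\{b\}}$. For an equivalence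 relation $\tau$ on $V$, $\mathcal{H}/\tau=(V/\tau,H/\tau)$ with $H/\tau=\{\{a_1\tau,\ldots,a_k\tau\}: a_1\ldots a_k\in H\}$; the simplification is $\mathcal{H}_S=\mathcal{H}/\eta$. Shellable: the facets can be ordered $B_1,\ldots,B_t$ so that for $k=2,\ldots,t$, setting $I(B_k)=(\bigcup_{i=1}^{k-1}2^{B_i})\cap 2^{B_k}$, the complex $(B_k,I(B_k))$ is pure of dimension $|B_k|-2$ whenever $|B_k|\geq 2$. For $Q\in H$, $Q\neq V$, the link $\mathrm{lk}(Q)$ is the complex with faces $\{X\subseteq V\setminus Q: X\cup Q\in H\}$ (vertex set the union of these faces; empty vertex sets allowed). For $m\le\dim\mathcal{H}$, $\mathrm{pure}_m(\mathcal{H})$ is the subcomplex generated by all $m$-dimensional faces. If $\dim\mathcal{H}=d$, $\mathcal{H}$ is sequentially Cohen-Macaulay if $\tilde H_k(\mathrm{pure}_m(\mathrm{lk}(X)))=0$ for all $X\in H$ and all $k<m\leq d$, where $\tilde H_k$ is reduced simplicial homology. -}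

module Defs where

open import Level using (0ℓ)
open import Data.Nat as ℕ using (ℕ; zero; suc; _∸_; _≤_)
open import Data.Bool using (Bool; true; false; if_then_else_; _∧_)
open import Data.Fin as Fin using (Fin; toℕ)
open import Data.Fin.Properties using (_<?_)
open import Data.Fin.Subset using (Subset; _∈_; _∉_; _⊆_; ∣_∣; ⁅_⁆; _∪_; _∩_)
open import Data.Vec as Vec using (lookup; tabulate)
open import Data.List as List using (List; allFin; foldr; map)
open import Data.Bool.ListAction using (any)
open import Data.Integer as ℤ using (ℤ; 0ℤ; 1ℤ; -_; _+_; _*_)
open import Data.Product using (Σ; ∃; ∃-syntax; _×_)
open import Data.Sum using (_⊎_)
open import Relation.Nullary using (¬_)
open import Relation.Nullary.Decidable using (⌊_⌋)
open import Relation.Binary.PropositionalEquality using (_≡_; _≢_)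
open import Relation.Binary.Construct.Closure.ReflexiveTransitive using (Star)
open import Function.Bundles using (_⇔_)
open import Function.Definitions using (Injective; Surjective)

FacePred : ℕ → Set₁
FacePred n = Subset n → Set

record Complex (n : ℕ) : Set₁ where
  field
    face      : FacePred n
    nonempty  : 1 ≤ n
    singleton : ∀ v → face ⁅ v ⁆
    down      : ∀ X Y → Y ⊆ X → face X → face Y
open Complex public

HasDim2 : ∀ {n} → Complex n → Set
HasDim2 H = (∃[ X ] (face H X × ∣ X ∣ ≡ 3)) × (∀ X → face H X → ∣ X ∣ ≤ 3)

-- X is M-independent: some submatrix M[Y,X] is nonsingular, i.e. after
-- permuting rows (r) and columns (c) it is square lower unitriangular.
Independent : ∀ {m n} → (Fin m → Fin n → Bool) → Subset n → Set
Independent {m} {n} M X =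
  ∃[ k ] Σ (Fin k → Fin m) λ r → Σ (Fin k → Fin n) λ c →
    Injective _≡_ _≡_ r × Injective _≡_ _≡_ c ×
    (∀ x → (x ∈ X) ⇔ (∃[ j ] c j ≡ x)) ×
    (∀ i → M (r i) (c i) ≡ true) ×
    (∀ i j → i Fin.< j → M (r i) (c j) ≡ false)

BooleanRepresentable : ∀ {n} → Complex n → Set
BooleanRepresentable {n} H =
  ∃[ m ] Σ (Fin m → Fin n → Bool) λ M → ∀ X → face H X ⇔ Independent M X

Flat : ∀ {n} → FacePred n → Subset n → Set
Flat F X = ∀ I → F I → I ⊆ X → ∀ p → p ∉ X → F (I ∪ ⁅ p ⁆)

InClosure : ∀ {n} → FacePred n → Subset n → Fin n → Set
InClosure F X p = ∀ Z → Flat F Z → X ⊆ Z → p ∈ Z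

FlatEdge : ∀ {n} → FacePred n → Fin n → Fin n → Set
FlatEdge F p q = p ≢ q × ¬ (∀ r → InClosure F (⁅ p ⁆ ∪ ⁅ q ⁆) r)

Connected : ∀ {n} → FacePred n → Fin n → Fin n → Set
Connected F = Star (FlatEdge F)

NontrivialAt : ∀ {n} → FacePred n → Fin n → Set
NontrivialAt F v = ∃[ w ] (v ≢ w × Connected F v w)

AtMostTwoComponents : ∀ {n} → FacePred n → Set
AtMostTwoComponents F = ∃[ a ] ∃[ b ] ∀ v → Connected F v a ⊎ Connected F v b

ExactlyOneNontrivial : ∀ {n} → FacePred n → Set
ExactlyOneNontrivial F =
  (∃[ a ] NontrivialAt F a) ×
  (∀ v w → NontrivialAt F v → NontrivialAt F w → Connected F v w)

GraphOfFlatsCondition : ∀ {n} → FacePred n → Set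
GraphOfFlatsCondition F = AtMostTwoComponents F ⊎ ExactlyOneNontrivial F

η : ∀ {n} → Complex n → Fin n → Fin n → Set
η H a b = ∀ r → InClosure (face H) ⁅ a ⁆ r ⇔ InClosure (face H) ⁅ b ⁆ r

image : ∀ {n k} → (Fin n → Fin k) → Subset n → Subset k
image {n} π I = tabulate λ z → any (λ a → lookup I a ∧ ⌊ π a Fin.≟ z ⌋) (allFin n)

QuotientFace : ∀ {n k} → Complex n → (Fin n → Fin k) → FacePred k
QuotientFace H π Z = ∃[ I ] (face H I × Z ≡ image π I)

-- π : Fin n → Fin k is a quotient map for η (Fin k plays the role of V/η)
IsSimplificationMap : ∀ {n k} → Complex n → (Fin n → Fin k) → Set
IsSimplificationMap H π = Surjective _≡_ _≡_ π × (∀ a b → (π a ≡ π b) ⇔ η H a b)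

SimplificationCondition : ∀ {n} → Complex n → Set
SimplificationCondition {n} H =
  ∀ k (π : Fin n → Fin k) → IsSimplificationMap H π →
    GraphOfFlatsCondition (QuotientFace H π)

Facet : ∀ {n} → Complex n → Subset n → Set
Facet H X = face H X × (∀ Y → face H Y → X ⊆ Y → X ≡ Y)

PureOfSize : ∀ {n} → FacePred n → ℕ → Set
PureOfSize P s = ∀ X → P X → (∀ Y → P Y → X ⊆ Y → X ≡ Y) → ∣ X ∣ ≡ s

Shellable : ∀ {n} → Complex n → Set
Shellable {n} H =
  ∃[ t ] Σ (Fin t → Subset n) λ B →
    Injective _≡_ _≡_ B ×
    (∀ i → Facet H (B i)) ×
    (∀ X → Facet H X → ∃[ i ] B i ≡ X) ×
    (∀ k → 1 ≤ toℕ k → 2 ≤ ∣ B k ∣ →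
      -- I(B_k) pure of dimension |B_k| - 2, i.e. facets of size |B_k| - 1
      PureOfSize (λ Y → Y ⊆ B k × ∃[ i ] (i Fin.< k × Y ⊆ B i)) (∣ B k ∣ ∸ 1))

sumℤ : List ℤ → ℤ
sumℤ = foldr _+_ 0ℤ

sgn : ℕ → ℤ
sgn zero = 1ℤ
sgn (suc k) = - sgn k

below : ∀ {n} → Fin n → Subset n
below v = tabulate λ u → ⌊ u <? v ⌋

-- boundary of an (oriented, by the order of Fin n) chain c : Subset n → ℤ.
-- (∂c)(Y) = Σ_{v ∉ Y} (-1)^{#{u ∈ Y : u < v}} c(Y ∪ {v});
-- includes the augmentation (the empty face), giving reduced homology.
boundary : ∀ {n} → (Subset n → ℤ) → Subset n → ℤ
boundary {n} c Y =
  sumℤ (map (λ v → if lookup Y v then 0ℤ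
                   else sgn ∣ Y ∩ below v ∣ * c (Y ∪ ⁅ v ⁆)) (allFin n))

IsChain : ∀ {n} → FacePred n → ℕ → (Subset n → ℤ) → Set
IsChain K s c = ∀ X → c X ≢ 0ℤ → K X × ∣ X ∣ ≡ s

-- H̃_{s-1}(K; ℤ) = 0 : every (s-1)-cycle is a boundary
ReducedHomologyVanishes : ∀ {n} → FacePred n → ℕ → Set
ReducedHomologyVanishes K s =
  ∀ c → IsChain K s c → (∀ Y → boundary c Y ≡ 0ℤ) →
    ∃[ d ] (IsChain K (suc s) d × (∀ X → boundary d X ≡ c X))

link : ∀ {n} → Complex n → Subset n → FacePred n
link H Q X = (∀ {x} → x ∈ X → x ∉ Q) × face H (X ∪ Q)

pureDim : ∀ {n} → ℕ → FacePred n → FacePred n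
pureDim m K X = ∃[ Z ] (K Z × ∣ Z ∣ ≡ suc m × X ⊆ Z)

-- for all X ∈ H, all m ≤ dim H (i.e. H has an m-face), all k < m
-- (k = s - 1 with s ≤ m; k ≥ -1): H̃_k(pure_m(lk X)) = 0.
SequentiallyCM : ∀ {n} → Complex n → Set
SequentiallyCM H =
  ∀ X → face H X → ∀ m → (∃[ Z ] (face H Z × ∣ Z ∣ ≡ suc m)) →
    ∀ s → s ≤ m → ReducedHomologyVanishes (pureDim m (link H X)) s

{-# OPTIONS --safe #-}

-- Two vertices of a boolean representable complex are adjacent iff they are not η-equivalent, and
-- in dimension two a triple is a face iff two of its vertices are separated points of a proper flat
-- missing the third; so every triangle contains an edge of the graph of flats.
--
-- (i) ⇒ (ii).  Along a shelling, every 1-cocycle on the triangles with values in a monoid is a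
-- coboundary.  Applied to the oriented edges [x y] in the chains modulo boundaries this makes
-- every 1-cycle a boundary; connectivity of the links also propagates along the shelling.
--
-- (ii) ⇒ (iii).  Otherwise choose vertices a, b, c in three components, those of a and b
-- nontrivial.  They span a 1-cycle of pure₂, which bounds no 2-chain because no triangle has its
-- vertices in three different components.
--
-- (iii) ⇒ (i).  Start with a triangle v₁ v₂ v₃, where v₁ v₂ lie in a proper flat missing v₃, and
-- add the other vertices one at a time, each time one adjacent in the graph of flats to an earlier
-- vertex as long as there is one.  The link of the new vertex in the complex spanned so far is
-- connected and its edges already lie in triangles, so the new triangles can be attached along
-- paths of the link.  Facets with fewer than three vertices come last.

module Submission where

open import Defs
open import Algebra.Bundles using (Monoid)
open import Data.Bool using (Bool; T; _∧_; false; if_then_else_; not; true)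
import Data.Bool.Properties as Boolₚ
open import Data.Fin as Fin using (Fin; fromℕ<; opposite; suc; toℕ; zero)
open import Data.Fin.Properties
  using (_<?_; any?; opposite-involutive; opposite-prop; suc-injective; toℕ-fromℕ<; toℕ-injective; toℕ<n)
import Data.Fin.Properties as Finₚ
open import Data.Fin.Subset
  using (Empty; Nonempty; Subset; _-_; _∈_; _∉_; _∩_; _∪_; _⊆_; inside; outside; ⁅_⁆; ∁; ∣_∣; ⊥)
open import Data.Fin.Subset.Properties
  using (Empty-unique; _∈?_; _⊂?_; _⊆?_; anySubset?; nonempty?; p∩q⊆p; p∩q⊆q; p⊂q⇒∣p∣<∣q∣; p⊆p∪q;
    p⊆q⇒∣p∣≤∣q∣; p─q⊆p; q⊆p∪q; x∈p⇒∣p-x∣<∣p∣; x∈p∧x≢y⇒x∈p-y; x∈p∩q⁺; x∈p∩q⁻; x∈p∪q⁺; x∈p∪q⁻; x∈⁅x⁆;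
    x∈⁅y⁆⇒x≡y; x∈∁p⇒x∉p; x∉p⇒x∈∁p; ∉⊥; ∣p∣≤n; ∣⁅x⁆∣≡1; ∣⊥∣≡0; ∪-identityʳ; ⊆-antisym; ⊆-refl; ⊥⊆)
open import Data.Integer as ℤ using (-1ℤ; -_; 0ℤ; 1ℤ; _*_; _+_; ℤ)
import Data.Integer.Properties as ℤₚ
open import Data.Integer.Tactic.RingSolver using (solve-∀)
open import Data.List as List using (List; []; _∷_; allFin; length)
import Data.List.Membership.DecPropositional as DecMembership
import Data.List.Membership.Propositional as L
import Data.List.Membership.Propositional.Properties as Lₚ
import Data.List.Properties as Listₚ
open import Data.List.Relation.Unary.Any using (here; there)
import Data.List.Relation.Unary.Any as LAny
import Data.List.Relation.Unary.Any.Properties as Anyₚ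
open import Data.Nat as ℕ using (_<_; _∸_; _≤_; suc; s≤s; zero; z≤n; ℕ)
import Data.Nat.Properties as ℕₚ
open import Data.Product using (_,_; _×_; proj₁; proj₂; Σ; ∃-syntax)
open import Data.Sum using ([_,_]′; _⊎_; inj₁; inj₂)
import Data.Sum as Sum
open import Data.Unit using (tt) renaming (⊤ to Unit)
open import Data.Vec as Vec using ([]; _∷_; lookup; tabulate)
open import Data.Vec.Base using (here; there)
import Data.Vec.Functional as VF
import Data.Vec.Properties as Vecₚ
open import Function using (_∘_; id)
open import Function.Bundles using (Equivalence; _⇔_; mk⇔)
open import Function.Definitions using (Surjective)
open import Level using (0ℓ)
open import Relation.Binary using (IsEquivalence; tri<; tri>; tri≈)
open import Relation.Binary.Construct.Closure.ReflexiveTransitive using (Star; _◅_; _◅◅_; gmap; reverse; ε)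
import Relation.Binary.Construct.On as On
open import Relation.Binary.PropositionalEquality
open import Relation.Nullary using (Dec; _×-dec_; contradiction; no; yes; ¬?; ¬_)
open import Relation.Nullary.Decidable using (decidable-stable; fromWitness; isYes≗does; map′; toWitness; ⌊_⌋)

-- Chains under contraction and exterior multiplication

-- The signs in `boundary` count smaller vertices. Read as the interior product with the constant
-- covector 1 on an exterior algebra, the same operator obeys a Leibniz rule, so boundaries of
-- oriented simplices are computed without comparing vertices. Interior products with other
-- covectors later detect a cycle that bounds nothing. Triangles live on the vertices of the
-- complex, the graph of flats on their classes; the graph is therefore pulled back, at the price
-- that a lifted path may end elsewhere in the class of its target. Two obstacles shape the growth
-- of the shelling. A second nontrivial component cannot be entered along edges of the graph, so the
-- starting triangle must already contain one of its vertices. And an isolated vertex has to wait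
-- until all others are present, because only then is its link known to be connected.

Chain : ℕ → Set
Chain n = Subset n → ℤ

outer inner : ∀ {n} → Chain (suc n) → Chain n
outer c Y = c (outside ∷ Y)
inner c Y = c (inside ∷ Y)

-- Interior product with the covector f, so that the boundary is contraction
-- with the constant covector 1.
contract : ∀ {n} → (Fin n → ℤ) → Chain n → Chain n
contract f c []            = 0ℤ
contract f c (outside ∷ Y) = f zero * inner c Y + contract (f ∘ suc) (outer c) Y
contract f c (inside ∷ Y)  = - contract (f ∘ suc) (inner c) Y

wedge : ∀ {n} → Fin n → Chain n → Chain n
wedge zero    c (outside ∷ Y) = 0ℤ
wedge zero    c (inside ∷ Y)  = outer c Y
wedge (suc v) c (outside ∷ Y) = wedge v (outer c) Y
wedge (suc v) c (inside ∷ Y)  = - wedge v (inner c) Y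

unit : ∀ {n} → Chain n
unit []            = 1ℤ
unit (outside ∷ Y) = unit Y
unit (inside ∷ Y)  = 0ℤ

-- The oriented simplex v₁ ∧ v₂ ∧ .... It is zero when a vertex repeats, so formulas for boundaries
-- hold for degenerate lists as well.
simplex : ∀ {n} → List (Fin n) → Chain n
simplex []      = unit
simplex (v ∷ l) = wedge v (simplex l)

contract-cong : ∀ {n} (f : Fin n → ℤ) {c d : Chain n} → (∀ X → c X ≡ d X) → ∀ Y → contract f c Y ≡ contract f d Y
contract-cong f e []            = refl
contract-cong f e (outside ∷ Y) =
  cong₂ _+_ (cong (f zero *_) (e (inside ∷ Y))) (contract-cong (f ∘ suc) (λ X → e (outside ∷ X)) Y)
contract-cong f e (inside ∷ Y)  = cong -_ (contract-cong (f ∘ suc) (λ X → e (inside ∷ X)) Y)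

contract-linear : ∀ {n} (f : Fin n → ℤ) k (c d : Chain n) Y →
  contract f (λ X → k * c X + d X) Y ≡ k * contract f c Y + contract f d Y
contract-linear f k c d []            = lemma k
  where
  lemma : ∀ k → 0ℤ ≡ k * 0ℤ + 0ℤ
  lemma = solve-∀
contract-linear f k c d (outside ∷ Y)
  rewrite contract-linear (f ∘ suc) k (outer c) (outer d) Y = lemma (f zero) k _ _ _ _
  where
  lemma : ∀ f k c d c′ d′ → f * (k * c + d) + (k * c′ + d′) ≡ k * (f * c + c′) + (f * d + d′)
  lemma = solve-∀
contract-linear f k c d (inside ∷ Y)
  rewrite contract-linear (f ∘ suc) k (inner c) (inner d) Y = lemma k _ _
  where
  lemma : ∀ k c d → - (k * c + d) ≡ k * - c + - d
  lemma = solve-∀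

contract-neg : ∀ {n} (f : Fin n → ℤ) (c : Chain n) Y → contract f (λ X → - c X) Y ≡ - contract f c Y
contract-neg f c []            = refl
contract-neg f c (outside ∷ Y) rewrite contract-neg (f ∘ suc) (outer c) Y = lemma (f zero) _ _
  where
  lemma : ∀ f c d → f * - c + - d ≡ - (f * c + d)
  lemma = solve-∀
contract-neg f c (inside ∷ Y)  = cong -_ (contract-neg (f ∘ suc) (inner c) Y)

-- With equal covectors this gives `contract-square`, hence ∂∂ = 0; with different ones it brings
-- two equal factors together in `Φ-∂`.
contract-anticomm : ∀ {n} (f g : Fin n → ℤ) (c : Chain n) Y →
  contract f (contract g c) Y ≡ - contract g (contract f c) Y
contract-anticomm f g c []            = refl
contract-anticomm f g c (outside ∷ Y)
  rewrite contract-linear (f ∘ suc) (g zero) (inner c) (contract (g ∘ suc) (outer c)) Y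
        | contract-linear (g ∘ suc) (f zero) (inner c) (contract (f ∘ suc) (outer c)) Y
        | contract-anticomm (f ∘ suc) (g ∘ suc) (outer c) Y = lemma (f zero) (g zero) _ _ _
  where
  lemma : ∀ f g x y z → f * - x + (g * y + - z) ≡ - (g * - y + (f * x + z))
  lemma = solve-∀
contract-anticomm f g c (inside ∷ Y)
  rewrite contract-neg (f ∘ suc) (contract (g ∘ suc) (inner c)) Y
        | contract-neg (g ∘ suc) (contract (f ∘ suc) (inner c)) Y
        = cong (-_ ∘ -_) (contract-anticomm (f ∘ suc) (g ∘ suc) (inner c) Y)

contract-zero : ∀ {n} (f : Fin n → ℤ) Y → contract f (λ _ → 0ℤ) Y ≡ 0ℤ
contract-zero f []            = refl
contract-zero f (outside ∷ Y) = cong₂ _+_ (ℤₚ.*-zeroʳ (f zero)) (contract-zero (f ∘ suc) Y)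
contract-zero f (inside ∷ Y)  = cong -_ (contract-zero (f ∘ suc) Y)

wedge-linear : ∀ {n} (v : Fin n) k (c d : Chain n) Y →
  wedge v (λ X → k * c X + d X) Y ≡ k * wedge v c Y + wedge v d Y
wedge-linear zero    k c d (outside ∷ Y) = lemma k
  where
  lemma : ∀ k → 0ℤ ≡ k * 0ℤ + 0ℤ
  lemma = solve-∀
wedge-linear zero    k c d (inside ∷ Y)  = refl
wedge-linear (suc v) k c d (outside ∷ Y) = wedge-linear v k (outer c) (outer d) Y
wedge-linear (suc v) k c d (inside ∷ Y)
  rewrite wedge-linear v k (inner c) (inner d) Y = lemma k _ _
  where
  lemma : ∀ k c d → - (k * c + d) ≡ k * - c + - d
  lemma = solve-∀

wedge-neg : ∀ {n} (v : Fin n) (c : Chain n) Y → wedge v (λ X → - c X) Y ≡ - wedge v c Y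
wedge-neg zero    c (outside ∷ Y) = refl
wedge-neg zero    c (inside ∷ Y)  = refl
wedge-neg (suc v) c (outside ∷ Y) = wedge-neg v (outer c) Y
wedge-neg (suc v) c (inside ∷ Y)  = cong -_ (wedge-neg v (inner c) Y)

wedge-cong : ∀ {n} (v : Fin n) {c d : Chain n} → (∀ X → c X ≡ d X) → ∀ Y → wedge v c Y ≡ wedge v d Y
wedge-cong zero    e (outside ∷ Y) = refl
wedge-cong zero    e (inside ∷ Y)  = e (outside ∷ Y)
wedge-cong (suc v) e (outside ∷ Y) = wedge-cong v (λ X → e (outside ∷ X)) Y
wedge-cong (suc v) e (inside ∷ Y)  = cong -_ (wedge-cong v (λ X → e (inside ∷ X)) Y)

-- The Leibniz rule: an interior product is an antiderivation of degree -1.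
contract-wedge : ∀ {n} (f : Fin n → ℤ) v (c : Chain n) Y →
  contract f (wedge v c) Y ≡ f v * c Y + - wedge v (contract f c) Y
contract-wedge f zero c (outside ∷ Y) rewrite contract-zero (f ∘ suc) Y = refl
contract-wedge f zero c (inside ∷ Y) = lemma (f zero) _ _
  where
  lemma : ∀ f x y → - y ≡ f * x + - (f * x + y)
  lemma = solve-∀
contract-wedge f (suc v) c (outside ∷ Y)
  rewrite contract-wedge (f ∘ suc) v (outer c) Y
        | wedge-linear v (f zero) (inner c) (contract (f ∘ suc) (outer c)) Y
        = lemma (f zero) (wedge v (inner c) Y) (f (suc v) * outer c Y) _
  where
  lemma : ∀ f x y z → f * - x + (y + - z) ≡ y + - (f * x + z)
  lemma = solve-∀
contract-wedge f (suc v) c (inside ∷ Y)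
  rewrite contract-neg (f ∘ suc) (wedge v (inner c)) Y
        | contract-wedge (f ∘ suc) v (inner c) Y
        | wedge-neg v (contract (f ∘ suc) (inner c)) Y
        = lemma (f (suc v) * inner c Y) (wedge v (contract (f ∘ suc) (inner c)) Y)
  where
  lemma : ∀ x y → - - (x + - y) ≡ x + - - - y
  lemma = solve-∀

contract-unit : ∀ {n} (f : Fin n → ℤ) Y → contract f unit Y ≡ 0ℤ
contract-unit f []            = refl
contract-unit f (outside ∷ Y) = cong₂ _+_ (ℤₚ.*-zeroʳ (f zero)) (contract-unit (f ∘ suc) Y)
contract-unit f (inside ∷ Y)  = cong -_ (contract-zero (f ∘ suc) Y)

-- The signed boundary formula as a contraction

private
  Σ-suc : ∀ {n} (g : Fin (suc n) → ℤ) →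
    sumℤ (List.map g (allFin (suc n))) ≡ g zero + sumℤ (List.map (g ∘ suc) (allFin n))
  Σ-suc g = cong (λ l → g zero + sumℤ l)
    (trans (Listₚ.map-tabulate suc g) (sym (Listₚ.map-tabulate id (g ∘ suc))))

  Σ-cong : ∀ {n} {g h : Fin n → ℤ} → (∀ v → g v ≡ h v) →
    sumℤ (List.map g (allFin n)) ≡ sumℤ (List.map h (allFin n))
  Σ-cong {n} e = cong sumℤ (Listₚ.map-cong e (allFin n))

  Σ-neg : ∀ {A : Set} (g : A → ℤ) l → sumℤ (List.map (λ v → - g v) l) ≡ - sumℤ (List.map g l)
  Σ-neg g []      = refl
  Σ-neg g (v ∷ l) = trans (cong (- g v +_) (Σ-neg g l)) (sym (ℤₚ.neg-distrib-+ (g v) _))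

  ∩-below-zero : ∀ {n} (Y : Subset n) → ∣ Y ∩ tabulate (λ u → ⌊ suc u <? zero {n} ⌋) ∣ ≡ 0
  ∩-below-zero []            = refl
  ∩-below-zero (outside ∷ Y) = ∩-below-zero Y
  ∩-below-zero (inside ∷ Y)  = ∩-below-zero Y

  facet-term : ∀ {n} → Chain n → Subset n → Fin n → ℤ
  facet-term c Y v = if lookup Y v then 0ℤ else sgn ∣ Y ∩ below v ∣ * c (Y ∪ ⁅ v ⁆)

  below-suc : ∀ {n} (v : Fin n) → tabulate (λ u → ⌊ suc u <? suc v ⌋) ≡ below v
  below-suc v = Vecₚ.tabulate-cong λ u →
    trans (isYes≗does (suc u <? suc v)) (sym (isYes≗does (u <? v)))

-- A vertex zero in `Y` lies below every other vertex and flips the sign of each remaining term,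
-- which is the minus in the inside clause of `contract`.
boundary≡contract : ∀ {n} (c : Chain n) Y → boundary c Y ≡ contract (λ _ → 1ℤ) c Y
boundary≡contract c []            = refl
boundary≡contract {suc n} c (outside ∷ Y) =
  trans (Σ-suc (facet-term c (outside ∷ Y))) (cong₂ _+_
    (cong₂ _*_ (cong sgn (∩-below-zero Y)) (cong (λ Z → c (inside ∷ Z)) (∪-identityʳ Y)))
    (trans (Σ-cong step) (boundary≡contract (outer c) Y)))
  where
  step : ∀ v → facet-term c (outside ∷ Y) (suc v) ≡ facet-term (outer c) Y v
  step v rewrite below-suc v = refl
boundary≡contract {suc n} c (inside ∷ Y)  =
  trans (Σ-suc (facet-term c (inside ∷ Y))) (trans (ℤₚ.+-identityˡ _) (trans (Σ-cong step)
    (trans (Σ-neg (facet-term (inner c) Y) (allFin n)) (cong -_ (boundary≡contract (inner c) Y)))))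
  where
  step : ∀ v → facet-term c (inside ∷ Y) (suc v) ≡ - facet-term (inner c) Y v
  step v rewrite below-suc v with lookup Y v
  ... | true  = refl
  ... | false = sym (ℤₚ.neg-distribˡ-* (sgn ∣ Y ∩ below v ∣) _)

-- Applied repeatedly, it unwinds a nonzero iterated contraction to a face in the support of the
-- chain, with the removed vertices named.
contract-support : ∀ {n} (f : Fin n → ℤ) (c : Chain n) Y → contract f c Y ≢ 0ℤ →
  ∃[ v ] (v ∉ Y × f v ≢ 0ℤ × c (Y ∪ ⁅ v ⁆) ≢ 0ℤ)
contract-support f c []            ≢0 = contradiction refl ≢0
contract-support f c (outside ∷ Y) ≢0 with f zero ℤ.≟ 0ℤ | inner c Y ℤ.≟ 0ℤ | contract (f ∘ suc) (outer c) Y ℤ.≟ 0ℤ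
... | no f≢0 | no c≢0 | _ = zero , (λ ()) , f≢0 , subst (λ Z → inner c Z ≢ 0ℤ) (sym (∪-identityʳ Y)) c≢0
... | yes f≡0 | _ | yes e = contradiction (cong₂ _+_ (cong (_* inner c Y) f≡0) e) ≢0
... | no _ | yes c≡0 | yes e =
  contradiction (cong₂ _+_ (trans (cong (f zero *_) c≡0) (ℤₚ.*-zeroʳ (f zero))) e) ≢0
... | yes _ | _ | no e with v , v∉ , f≢0 , c≢0 ← contract-support (f ∘ suc) (outer c) Y e =
  suc v , (λ { (there v∈) → v∉ v∈ }) , f≢0 , c≢0
... | no _ | yes _ | no e with v , v∉ , f≢0 , c≢0 ← contract-support (f ∘ suc) (outer c) Y e =
  suc v , (λ { (there v∈) → v∉ v∈ }) , f≢0 , c≢0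
contract-support f c (inside ∷ Y)  ≢0
  with v , v∉ , f≢0 , c≢0 ← contract-support (f ∘ suc) (inner c) Y (λ e → ≢0 (cong -_ e)) =
  suc v , (λ { (there v∈) → v∉ v∈ }) , f≢0 , c≢0

unit-support : ∀ {n} (X : Subset n) → unit X ≢ 0ℤ → X ≡ ⊥
unit-support []            _  = refl
unit-support (outside ∷ X) ≢0 = cong (outside ∷_) (unit-support X ≢0)
unit-support (inside ∷ X)  ≢0 = contradiction refl ≢0

wedge-support : ∀ {n} (v : Fin n) (c : Chain n) X → wedge v c X ≢ 0ℤ →
  ∃[ Y ] (v ∉ Y × X ≡ Y ∪ ⁅ v ⁆ × c Y ≢ 0ℤ)
wedge-support zero    c (outside ∷ X) ≢0 = contradiction refl ≢0
wedge-support zero    c (inside ∷ X)  ≢0 =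
  outside ∷ X , (λ ()) , cong (inside ∷_) (sym (∪-identityʳ X)) , ≢0
wedge-support (suc v) c (outside ∷ X) ≢0 with Y , v∉ , refl , c≢0 ← wedge-support v (outer c) X ≢0 =
  outside ∷ Y , (λ { (there v∈) → v∉ v∈ }) , refl , c≢0
wedge-support (suc v) c (inside ∷ X)  ≢0
  with Y , v∉ , refl , c≢0 ← wedge-support v (inner c) X (λ e → ≢0 (cong -_ e)) =
  inside ∷ Y , (λ { (there v∈) → v∉ v∈ }) , refl , c≢0

∣∪⁅⁆∣ : ∀ {n} (Y : Subset n) v → v ∉ Y → ∣ Y ∪ ⁅ v ⁆ ∣ ≡ suc ∣ Y ∣
∣∪⁅⁆∣ (outside ∷ Y) zero    v∉ = cong (suc ∘ ∣_∣) (∪-identityʳ Y)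
∣∪⁅⁆∣ (inside ∷ Y)  zero    v∉ = contradiction here v∉
∣∪⁅⁆∣ (outside ∷ Y) (suc v) v∉ = ∣∪⁅⁆∣ Y v (v∉ ∘ there)
∣∪⁅⁆∣ (inside ∷ Y)  (suc v) v∉ = cong suc (∣∪⁅⁆∣ Y v (v∉ ∘ there))

simplex-support : ∀ {n} (l : List (Fin n)) X → simplex l X ≢ 0ℤ →
  ∣ X ∣ ≡ length l × (∀ {x} → x ∈ X → x L.∈ l)
simplex-support {n} [] X ≢0 with refl ← unit-support X ≢0 = ∣⊥∣≡0 n , λ x∈ → contradiction x∈ ∉⊥
simplex-support (v ∷ l) X ≢0 with Y , v∉ , refl , c≢0 ← wedge-support v (simplex l) X ≢0
  with ∣Y∣ , Y⊆ ← simplex-support l Y c≢0 = trans (∣∪⁅⁆∣ Y v v∉) (cong suc ∣Y∣) , X⊆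
  where
  X⊆ : ∀ {x} → x ∈ Y ∪ ⁅ v ⁆ → x L.∈ v ∷ l
  X⊆ x∈ with x∈p∪q⁻ Y ⁅ v ⁆ x∈
  ... | inj₁ x∈Y = there (Y⊆ x∈Y)
  ... | inj₂ x∈v = here (x∈⁅y⁆⇒x≡y v x∈v)

-- Decomposition of chains into simplices

elements : ∀ {n} → Subset n → List (Fin n)
elements []            = []
elements (outside ∷ X) = List.map suc (elements X)
elements (inside ∷ X)  = zero ∷ List.map suc (elements X)

length-elements : ∀ {n} (X : Subset n) → length (elements X) ≡ ∣ X ∣
length-elements []            = refl
length-elements (outside ∷ X) = trans (Listₚ.length-map suc (elements X)) (length-elements X)
length-elements (inside ∷ X)  = cong suc (trans (Listₚ.length-map suc (elements X)) (length-elements X))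

∈-elements⁻ : ∀ {n} (X : Subset n) {x} → x L.∈ elements X → x ∈ X
∈-elements⁻ (outside ∷ X) x∈ with _ , y∈ , refl ← Lₚ.∈-map⁻ suc x∈ = there (∈-elements⁻ X y∈)
∈-elements⁻ (inside ∷ X) (here refl) = here
∈-elements⁻ (inside ∷ X) (there x∈) with _ , y∈ , refl ← Lₚ.∈-map⁻ suc x∈ = there (∈-elements⁻ X y∈)

_⊞_ : ∀ {n} → Chain n → Chain n → Chain (suc n)
(c ⊞ d) (outside ∷ X) = c X
(c ⊞ d) (inside ∷ X)  = d X

wedge-zero : ∀ {n} (v : Fin n) X → wedge v (λ _ → 0ℤ) X ≡ 0ℤ
wedge-zero zero    (outside ∷ X) = refl
wedge-zero zero    (inside ∷ X)  = refl
wedge-zero (suc v) (outside ∷ X) = wedge-zero v X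
wedge-zero (suc v) (inside ∷ X)  = cong -_ (wedge-zero v X)

simplex-map-suc : ∀ {n} (l : List (Fin n)) X → simplex (List.map suc l) X ≡ (simplex l ⊞ (λ _ → 0ℤ)) X
simplex-map-suc []      (outside ∷ X) = refl
simplex-map-suc []      (inside ∷ X)  = refl
simplex-map-suc (v ∷ l) (outside ∷ X) = wedge-cong v (λ Y → simplex-map-suc l (outside ∷ Y)) X
simplex-map-suc (v ∷ l) (inside ∷ X)  =
  cong -_ (trans (wedge-cong v (λ Y → simplex-map-suc l (inside ∷ Y)) X) (wedge-zero v X))

-- Splitting by the first vertex writes a chain as the sum of its `outer` and `inner` halves, so no
-- sum over all subsets is formed. The coefficient `c X` stays in the hypothesis because only faces
-- with a nonzero coefficient are known to lie in the complex.
chain-ind : ∀ {n} (Φ : Chain n → Set) →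
  (∀ {c d} → (∀ X → c X ≡ d X) → Φ c → Φ d) →
  (∀ {c d} → Φ c → Φ d → Φ (λ X → c X + d X)) →
  ∀ c → (∀ X → Φ (λ Y → c X * simplex (elements X) Y)) → Φ c
chain-ind {zero} Φ resp add c basis =
  resp (λ { [] → ℤₚ.*-identityʳ (c []) }) (basis [])
chain-ind {suc n} Φ resp add c basis = resp split (add
  (chain-ind (λ a → Φ (a ⊞ (λ _ → 0ℤ)))
    (λ e → resp λ { (outside ∷ X) → e X ; (inside ∷ X) → refl })
    (λ p q → resp (λ { (outside ∷ X) → refl ; (inside ∷ X) → refl }) (add p q))
    (outer c)
    (λ X → resp (λ { (outside ∷ Y) → cong (outer c X *_) (simplex-map-suc (elements X) (outside ∷ Y))
                   ; (inside ∷ Y) → trans (cong (outer c X *_) (simplex-map-suc (elements X) (inside ∷ Y)))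
                                          (ℤₚ.*-zeroʳ (outer c X)) })
           (basis (outside ∷ X))))
  (chain-ind (λ a → Φ ((λ _ → 0ℤ) ⊞ a))
    (λ e → resp λ { (outside ∷ X) → refl ; (inside ∷ X) → e X })
    (λ p q → resp (λ { (outside ∷ X) → refl ; (inside ∷ X) → refl }) (add p q))
    (inner c)
    (λ X → resp (λ { (outside ∷ Y) → ℤₚ.*-zeroʳ (inner c X)
                   ; (inside ∷ Y) → cong (inner c X *_) (simplex-map-suc (elements X) (outside ∷ Y)) })
           (basis (inside ∷ X)))))
  where
  split : ∀ X → (outer c ⊞ (λ _ → 0ℤ)) X + ((λ _ → 0ℤ) ⊞ inner c) X ≡ c X
  split (outside ∷ X) = ℤₚ.+-identityʳ _
  split (inside ∷ X)  = ℤₚ.+-identityˡ _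

-- Boundaries and vanishing of homology

∂ : ∀ {n} → Chain n → Chain n
∂ = contract (λ _ → 1ℤ)

Bounds : ∀ {n} → FacePred n → ℕ → Chain n → Set
Bounds K s c = ∃[ d ] (IsChain K (suc s) d × (∀ X → ∂ d X ≡ c X))

isChain-linear : ∀ {n} {K : FacePred n} {s c d} k → IsChain K s c → IsChain K s d →
  IsChain K s (λ X → k * c X + d X)
isChain-linear {c = c} {d} k chain-c chain-d X ≢0 with c X ℤ.≟ 0ℤ | d X ℤ.≟ 0ℤ
... | no c≢0 | _       = chain-c X c≢0
... | _      | no d≢0  = chain-d X d≢0
... | yes c≡0 | yes d≡0 = contradiction (cong₂ _+_ (trans (cong (k *_) c≡0) (ℤₚ.*-zeroʳ k)) d≡0) ≢0

simplex-isChain : ∀ {n} {K : FacePred n} {s} → (∀ {X Y} → Y ⊆ X → K X → K Y) →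
  ∀ l {X} → length l ≡ s → K X → (∀ {x} → x L.∈ l → x ∈ X) → IsChain K s (simplex l)
simplex-isChain K-down l ∣l∣ KX l⊆X Y ≢0 with ∣Y∣ , Y⊆l ← simplex-support l Y ≢0 =
  K-down (λ y∈ → l⊆X (Y⊆l y∈)) KX , trans ∣Y∣ ∣l∣

module _ {n} {K : FacePred n} {s : ℕ} where

  bounds-resp : ∀ {c d : Chain n} → (∀ X → c X ≡ d X) → Bounds K s c → Bounds K s d
  bounds-resp e (b , chain , ∂b) = b , chain , λ X → trans (∂b X) (e X)

  bounds-linear : ∀ {c d : Chain n} k → Bounds K s c → Bounds K s d → Bounds K s (λ X → k * c X + d X)
  bounds-linear k (a , chain-a , ∂a) (b , chain-b , ∂b) =
    (λ X → k * a X + b X) , isChain-linear k chain-a chain-b , λ X →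
      trans (contract-linear _ k a b X) (cong₂ (λ x y → k * x + y) (∂a X) (∂b X))

  bounds-zero : Bounds K s (λ _ → 0ℤ)
  bounds-zero = (λ _ → 0ℤ) , (λ X ≢0 → contradiction refl ≢0) , contract-zero _

  bounds-add : ∀ {c d : Chain n} → Bounds K s c → Bounds K s d → Bounds K s (λ X → c X + d X)
  bounds-add {c} {d} p q = bounds-resp (λ X → cong (_+ d X) (ℤₚ.*-identityˡ (c X))) (bounds-linear 1ℤ p q)

  bounds-scale : ∀ {c : Chain n} k → Bounds K s c → Bounds K s (λ X → k * c X)
  bounds-scale k p = bounds-resp (λ X → ℤₚ.+-identityʳ _) (bounds-linear k p bounds-zero)

  bounds-neg : ∀ {c : Chain n} → Bounds K s c → Bounds K s (λ X → - c X)
  bounds-neg p = bounds-resp (λ X → ℤₚ.-1*i≡-i _) (bounds-scale -1ℤ p)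

  simplex-bounds : (∀ {X Y} → Y ⊆ X → K X → K Y) →
    ∀ l {X} → length l ≡ suc s → K X → (∀ {x} → x L.∈ l → x ∈ X) → Bounds K s (∂ (simplex l))
  simplex-bounds K-down l ∣l∣ KX l⊆X = simplex l , simplex-isChain K-down l ∣l∣ KX l⊆X , λ _ → refl

  -- c ↦ λ X → Ψ X (∂ c) is a linear projection killing cycles; if it moves each
  -- simplex by a boundary, then every cycle c is c - 0, a boundary.
  homology-vanishes : (Ψ : Subset n → Chain n → ℤ) →
    (∀ X {c d} → (∀ Y → c Y ≡ d Y) → Ψ X c ≡ Ψ X d) →
    (∀ X k c d → Ψ X (λ Y → k * c Y + d Y) ≡ k * Ψ X c + Ψ X d) →
    (∀ l {X} → length l ≡ s → K X → (∀ {x} → x L.∈ l → x ∈ X) →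
      Bounds K s (λ Y → simplex l Y + - Ψ Y (∂ (simplex l)))) →
    ReducedHomologyVanishes K s
  homology-vanishes Ψ Ψ-cong Ψ-linear basis c chain cycle =
    let d , d-chain , ∂d = bounds-resp (λ X → trans (cong (λ z → c X + - z) (Ψ∂c≡0 X)) (ℤₚ.+-identityʳ (c X)))
                             (chain-ind Φ Φ-resp (λ {a} {b} → add {a} {b}) c step)
    in d , d-chain , λ X → trans (boundary≡contract d X) (∂d X)
    where
    Φ : Chain n → Set
    Φ a = Bounds K s (λ Y → a Y + - Ψ Y (∂ a))

    Ψ-zero : ∀ X → Ψ X (λ _ → 0ℤ) ≡ 0ℤ
    Ψ-zero X = trans (Ψ-linear X -1ℤ (λ _ → 0ℤ) (λ _ → 0ℤ)) (lemma (Ψ X (λ _ → 0ℤ)))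
      where
      lemma : ∀ x → -1ℤ * x + x ≡ 0ℤ
      lemma x = trans (cong (_+ x) (ℤₚ.-1*i≡-i x)) (ℤₚ.+-inverseˡ x)

    Ψ∂c≡0 : ∀ X → Ψ X (∂ c) ≡ 0ℤ
    Ψ∂c≡0 X = trans (Ψ-cong X (λ Y → trans (sym (boundary≡contract c Y)) (cycle Y))) (Ψ-zero X)

    Φ-resp : ∀ {a b} → (∀ X → a X ≡ b X) → Φ a → Φ b
    Φ-resp e = bounds-resp λ X → cong₂ (λ x y → x + - y) (e X) (Ψ-cong X (contract-cong _ e))

    linear : ∀ {a b} k → Φ a → Φ b → Φ (λ X → k * a X + b X)
    linear {a} {b} k p q = bounds-resp (λ X → trans (lemma k (a X) (Ψ X (∂ a)) (b X) (Ψ X (∂ b)))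
        (cong (λ z → k * a X + b X + - z) (sym (trans (Ψ-cong X (contract-linear _ k a b)) 
          (Ψ-linear X k (∂ a) (∂ b))))))
      (bounds-linear k p q)
      where
      lemma : ∀ k x x′ y y′ → k * (x + - x′) + (y + - y′) ≡ k * x + y + - (k * x′ + y′)
      lemma = solve-∀

    add : ∀ {a b} → Φ a → Φ b → Φ (λ X → a X + b X)
    add {a} {b} p q = Φ-resp {λ X → 1ℤ * a X + b X} (λ X → cong (_+ b X) (ℤₚ.*-identityˡ (a X)))
      (linear {a} {b} 1ℤ p q)

    zero-Φ : Φ (λ _ → 0ℤ)
    zero-Φ = bounds-resp (λ X → sym (cong (0ℤ +_) (cong -_ (trans (Ψ-cong X (contract-zero _)) (Ψ-zero X)))))
      bounds-zero

    step : ∀ X → Φ (λ Y → c X * simplex (elements X) Y)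
    step X with c X ℤ.≟ 0ℤ
    ... | yes c≡0 = Φ-resp (λ Y → sym (cong (_* simplex (elements X) Y) c≡0)) zero-Φ
    ... | no c≢0 with KX , ∣X∣ ← chain X c≢0 =
      Φ-resp {λ Y → c X * simplex (elements X) Y + 0ℤ} {λ Y → c X * simplex (elements X) Y}
        (λ Y → ℤₚ.+-identityʳ _) (linear {simplex (elements X)} {λ _ → 0ℤ} (c X)
        (basis (elements X) (trans (length-elements X) ∣X∣) KX (∈-elements⁻ X)) zero-Φ)

-- Faces of a boolean representable complex

x∉p-x : ∀ {n} (X : Subset n) x → x ∉ X - x
x∉p-x (_ ∷ X) zero ()
x∉p-x (_ ∷ X) (suc x) (there x∈) = x∉p-x X x x∈

x∈p-y⇒x∈p : ∀ {n} {X : Subset n} {x y} → x ∈ X - y → x ∈ X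
x∈p-y⇒x∈p {X = X} {y = y} = p─q⊆p X ⁅ y ⁆

x∈p-y⇒x≢y : ∀ {n} {X : Subset n} {x y} → x ∈ X - y → x ≢ y
x∈p-y⇒x≢y {X = X} x∈ refl = x∉p-x X _ x∈

p-x∪⁅x⁆≡p : ∀ {n} {X : Subset n} {x} → x ∈ X → (X - x) ∪ ⁅ x ⁆ ≡ X
p-x∪⁅x⁆≡p {X = X} {x} x∈ = ⊆-antisym to from
  where
  to : (X - x) ∪ ⁅ x ⁆ ⊆ X
  to y∈ with x∈p∪q⁻ (X - x) ⁅ x ⁆ y∈
  ... | inj₁ y∈X = x∈p-y⇒x∈p y∈X
  ... | inj₂ y∈x with refl ← x∈⁅y⁆⇒x≡y x y∈x = x∈
  from : X ⊆ (X - x) ∪ ⁅ x ⁆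
  from {y} y∈ with y Fin.≟ x
  ... | yes refl = x∈p∪q⁺ (inj₂ (x∈⁅x⁆ x))
  ... | no y≢x = x∈p∪q⁺ (inj₁ (x∈p∧x≢y⇒x∈p-y y∈ y≢x))

module _ {m n} (M : Fin m → Fin n → Bool) where

  -- Zero sets of rows are the flats that the matrix supplies to the geometry.
  zeros : Fin m → Subset n
  zeros r = tabulate (not ∘ M r)

  ∈-zeros⁺ : ∀ {r x} → M r x ≡ false → x ∈ zeros r
  ∈-zeros⁺ {r} {x} e = Vecₚ.lookup⇒[]= x _ (trans (Vecₚ.lookup∘tabulate _ x) (cong not e))

  ∈-zeros⁻ : ∀ {r x} → x ∈ zeros r → M r x ≡ false
  ∈-zeros⁻ {r} {x} x∈ = Boolₚ.not-injective (trans (sym (Vecₚ.lookup∘tabulate _ x)) (Vecₚ.[]=⇒lookup x∈))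

  ∉-zeros⁻ : ∀ {r x} → x ∉ zeros r → M r x ≡ true
  ∉-zeros⁻ x∉ = Boolₚ.¬-not λ e → x∉ (∈-zeros⁺ e)

  independent-⊥ : Independent M ⊥
  independent-⊥ = 0 , (λ ()) , (λ ()) , (λ { {()} }) , (λ { {()} }) ,
    (λ x → mk⇔ (λ x∈ → contradiction x∈ ∉⊥) λ { (() , _) }) , (λ ()) , λ ()

  -- The row `r` vanishes on `I` and is 1 at `p`; placed first together with the column `p`, it
  -- keeps all entries above the diagonal zero.
  independent-extend : ∀ {I} r p → Independent M I → I ⊆ zeros r → p ∉ zeros r → Independent M (I ∪ ⁅ p ⁆)
  independent-extend {I} r p (k , rs , cs , rs-inj , cs-inj , cs-I , diag , upper) I⊆ p∉ =
    suc k , r VF.∷ rs , p VF.∷ cs , rs′-inj , cs′-inj , (λ x → mk⇔ (to x) (from x)) , diag′ , upper′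
    where
    cs∈I : ∀ j → cs j ∈ I
    cs∈I j = Equivalence.from (cs-I (cs j)) (j , refl)
    cs∈zeros : ∀ j → M r (cs j) ≡ false
    cs∈zeros j = ∈-zeros⁻ (I⊆ (cs∈I j))
    r≢rs : ∀ j → r ≢ rs j
    r≢rs j refl with () ← trans (sym (cs∈zeros j)) (diag j)
    p≢cs : ∀ j → p ≢ cs j
    p≢cs j refl = p∉ (I⊆ (cs∈I j))
    rs′-inj : ∀ {i j} → (r VF.∷ rs) i ≡ (r VF.∷ rs) j → i ≡ j
    rs′-inj {zero}  {zero}  _ = refl
    rs′-inj {zero}  {suc j} e = contradiction e (r≢rs j)
    rs′-inj {suc i} {zero}  e = contradiction (sym e) (r≢rs i)
    rs′-inj {suc i} {suc j} e = cong suc (rs-inj e)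
    cs′-inj : ∀ {i j} → (p VF.∷ cs) i ≡ (p VF.∷ cs) j → i ≡ j
    cs′-inj {zero}  {zero}  _ = refl
    cs′-inj {zero}  {suc j} e = contradiction e (p≢cs j)
    cs′-inj {suc i} {zero}  e = contradiction (sym e) (p≢cs i)
    cs′-inj {suc i} {suc j} e = cong suc (cs-inj e)
    to : ∀ x → x ∈ I ∪ ⁅ p ⁆ → ∃[ j ] (p VF.∷ cs) j ≡ x
    to x x∈ with x∈p∪q⁻ I ⁅ p ⁆ x∈
    ... | inj₁ x∈I with j , e ← Equivalence.to (cs-I x) x∈I = suc j , e
    ... | inj₂ x∈p = zero , sym (x∈⁅y⁆⇒x≡y p x∈p)
    from : ∀ x → ∃[ j ] (p VF.∷ cs) j ≡ x → x ∈ I ∪ ⁅ p ⁆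
    from x (zero , refl)  = x∈p∪q⁺ (inj₂ (x∈⁅x⁆ p))
    from x (suc j , refl) = x∈p∪q⁺ (inj₁ (cs∈I j))
    diag′ : ∀ i → M ((r VF.∷ rs) i) ((p VF.∷ cs) i) ≡ true
    diag′ zero    = ∉-zeros⁻ p∉
    diag′ (suc i) = diag i
    upper′ : ∀ i j → i Fin.< j → M ((r VF.∷ rs) i) ((p VF.∷ cs) j) ≡ false
    upper′ zero    (suc j) _         = cs∈zeros j
    upper′ (suc i) (suc j) (s≤s i<j) = upper i j i<j

  independent-peel : ∀ {X} → Independent M X → Nonempty X →
    ∃[ p ] ∃[ r ] (p ∈ X × p ∉ zeros r × (∀ {x} → x ∈ X → x ≢ p → x ∈ zeros r))
  independent-peel (zero , _ , _ , _ , _ , cs-X , _) (x , x∈) with () , _ ← Equivalence.to (cs-X x) x∈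
  independent-peel {X} (suc k , rs , cs , _ , _ , cs-X , diag , upper) _ =
    cs zero , rs zero , Equivalence.from (cs-X (cs zero)) (zero , refl) ,
    (λ p∈ → contradiction (trans (sym (diag zero)) (∈-zeros⁻ p∈)) λ ()) , rest
    where
    rest : ∀ {x} → x ∈ X → x ≢ cs zero → x ∈ zeros (rs zero)
    rest {x} x∈ x≢ with Equivalence.to (cs-X x) x∈
    ... | zero  , refl = contradiction refl x≢
    ... | suc j , refl = ∈-zeros⁺ (upper zero (suc j) (s≤s z≤n))

module _ {n} (H : Complex n) (br : BooleanRepresentable H) where

  private
    M : Fin (proj₁ br) → Fin n → Bool
    M = proj₁ (proj₂ br)

    face⇔ : ∀ X → face H X ⇔ Independent M X
    face⇔ = proj₂ (proj₂ br)

    extend : ∀ {I} r p → face H I → I ⊆ zeros M r → p ∉ zeros M r → face H (I ∪ ⁅ p ⁆)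
    extend r p fI I⊆ p∉ =
      Equivalence.from (face⇔ _) (independent-extend M r p (Equivalence.to (face⇔ _) fI) I⊆ p∉)

    row-peel : ∀ {X} → face H X → Nonempty X →
      ∃[ p ] ∃[ r ] (p ∈ X × p ∉ zeros M r × (∀ {x} → x ∈ X → x ≢ p → x ∈ zeros M r))
    row-peel fX = independent-peel M (Equivalence.to (face⇔ _) fX)

  -- The first row of a unitriangular submatrix has its only 1 in the first column. Together with
  -- decidability, this is the form in which the later arguments use the matrix.
  face-peel : ∀ {X} → face H X → Nonempty X →
    ∃[ p ] ∃[ Z ] (p ∈ X × Flat (face H) Z × p ∉ Z × (∀ {x} → x ∈ X → x ≢ p → x ∈ Z))
  face-peel fX ne with p , r , p∈ , p∉ , rest ← row-peel fX ne =
    p , zeros M r , p∈ , (λ I fI I⊆ q q∉ → extend r q fI I⊆ q∉) , p∉ , rest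

  -- Independence quantifies over submatrices of any size, so it is not searched directly. A
  -- nonempty set is a face iff removing some vertex leaves a face inside the zero set of a row that
  -- is 1 at this vertex; `k` bounds the depth of the recursion.
  face? : ∀ X → Dec (face H X)
  face? X = dec ∣ X ∣ X ℕₚ.≤-refl
    where
    dec : ∀ k X → ∣ X ∣ ≤ k → Dec (face H X)
    peel? : ∀ k X → ∣ X ∣ ≤ suc k → ∀ p →
      Dec (p ∈ X × (∃[ r ] (p ∉ zeros M r × (X - p) ⊆ zeros M r)) × face H (X - p))
    dec k X ∣X∣≤ with nonempty? X
    ... | no empty =
      yes (subst (face H) (sym (Empty-unique empty)) (Equivalence.from (face⇔ _) (independent-⊥ M)))
    dec zero X ∣X∣≤ | yes (x , x∈) = contradiction
      (subst (_≤ 0) (∣⁅x⁆∣≡1 x) (ℕₚ.≤-trans (p⊆q⇒∣p∣≤∣q∣ ⁅x⁆⊆X) ∣X∣≤)) λ ()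
      where
      ⁅x⁆⊆X : ⁅ x ⁆ ⊆ X
      ⁅x⁆⊆X y∈ with refl ← x∈⁅y⁆⇒x≡y x y∈ = x∈
    dec (suc k) X ∣X∣≤ | yes ne = map′
      (λ { (p , p∈ , (r , p∉ , X-p⊆) , f) → subst (face H) (p-x∪⁅x⁆≡p p∈) (extend r p f X-p⊆ p∉) })
      (λ fX → let p , r , p∈ , p∉ , rest = row-peel fX ne in
        p , p∈ , (r , p∉ , λ {x} x∈ → rest (x∈p-y⇒x∈p x∈) (x∈p-y⇒x≢y x∈)) , down H X (X - p) x∈p-y⇒x∈p fX)
      (any? (peel? k X ∣X∣≤))
    peel? k X ∣X∣≤ p with p ∈? X
    ... | no p∉  = no (p∉ ∘ proj₁)
    ... | yes p∈ = map′ (p∈ ,_) proj₂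
      (any? (λ r → ¬? (p ∈? zeros M r) ×-dec ((X - p) ⊆? zeros M r))
        ×-dec dec k (X - p) (ℕₚ.≤-pred (ℕₚ.≤-trans (x∈p⇒∣p-x∣<∣p∣ p∈) ∣X∣≤)))

-- Small subsets and their cardinalities

∣p∣≡1+∣p-x∣ : ∀ {n} {X : Subset n} {x} → x ∈ X → ∣ X ∣ ≡ suc ∣ X - x ∣
∣p∣≡1+∣p-x∣ {X = X} {x} x∈ = trans (cong ∣_∣ (sym (p-x∪⁅x⁆≡p x∈))) (∣∪⁅⁆∣ (X - x) x (x∉p-x X x))

⊆∧∣∣≥⇒≡ : ∀ {n} {X Y : Subset n} → X ⊆ Y → ∣ Y ∣ ≤ ∣ X ∣ → X ≡ Y
⊆∧∣∣≥⇒≡ {X = X} X⊆Y ∣Y∣≤ = ⊆-antisym X⊆Y λ {y} y∈ → decidable-stable (y ∈? X) λ y∉ →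
  ℕₚ.<⇒≱ (p⊂q⇒∣p∣<∣q∣ (X⊆Y , y , y∈ , y∉)) ∣Y∣≤

choose : ∀ {n} (X : Subset n) → 1 ≤ ∣ X ∣ → Nonempty X
choose {n} X 1≤ with nonempty? X
... | yes ne = ne
... | no empty with refl ← Empty-unique empty = contradiction (subst (1 ≤_) (∣⊥∣≡0 n) 1≤) λ ()

choose-other : ∀ {n} (X : Subset n) w → 2 ≤ ∣ X ∣ → ∃[ x ] (x ∈ X × x ≢ w)
choose-other X w 2≤ with w ∈? X
... | no w∉ with x , x∈ ← choose X (ℕₚ.≤-trans (ℕₚ.n≤1+n 1) 2≤) = x , x∈ , λ { refl → w∉ x∈ }
... | yes w∈ with x , x∈ ← choose (X - w) (ℕₚ.≤-pred (subst (2 ≤_) (∣p∣≡1+∣p-x∣ w∈) 2≤)) =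
  x , x∈p-y⇒x∈p x∈ , x∈p-y⇒x≢y x∈

tri : ∀ {n} → Fin n → Fin n → Fin n → Subset n
tri a b c = (⁅ a ⁆ ∪ ⁅ b ⁆) ∪ ⁅ c ⁆

module _ {n : ℕ} where

  ∈-pair⁻ : ∀ {a b x : Fin n} → x ∈ ⁅ a ⁆ ∪ ⁅ b ⁆ → x ≡ a ⊎ x ≡ b
  ∈-pair⁻ {a} {b} x∈ with x∈p∪q⁻ ⁅ a ⁆ ⁅ b ⁆ x∈
  ... | inj₁ x∈a = inj₁ (x∈⁅y⁆⇒x≡y a x∈a)
  ... | inj₂ x∈b = inj₂ (x∈⁅y⁆⇒x≡y b x∈b)

  pair-⊆ : ∀ {a b} {X : Subset n} → a ∈ X → b ∈ X → ⁅ a ⁆ ∪ ⁅ b ⁆ ⊆ X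
  pair-⊆ a∈ b∈ x∈ with ∈-pair⁻ x∈
  ... | inj₁ refl = a∈
  ... | inj₂ refl = b∈

  a∈pair : ∀ {a b : Fin n} → a ∈ ⁅ a ⁆ ∪ ⁅ b ⁆
  a∈pair {a} = x∈p∪q⁺ (inj₁ (x∈⁅x⁆ a))

  b∈pair : ∀ {a b : Fin n} → b ∈ ⁅ a ⁆ ∪ ⁅ b ⁆
  b∈pair {b = b} = x∈p∪q⁺ (inj₂ (x∈⁅x⁆ b))

  a∈tri : ∀ {a b c : Fin n} → a ∈ tri a b c
  a∈tri = x∈p∪q⁺ (inj₁ a∈pair)

  b∈tri : ∀ {a b c : Fin n} → b ∈ tri a b c
  b∈tri = x∈p∪q⁺ (inj₁ b∈pair)

  c∈tri : ∀ {a b c : Fin n} → c ∈ tri a b c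
  c∈tri {c = c} = x∈p∪q⁺ (inj₂ (x∈⁅x⁆ c))

  ∈-tri⁻ : ∀ {a b c x : Fin n} → x ∈ tri a b c → x ≡ a ⊎ x ≡ b ⊎ x ≡ c
  ∈-tri⁻ {a} {b} {c} x∈ with x∈p∪q⁻ (⁅ a ⁆ ∪ ⁅ b ⁆) ⁅ c ⁆ x∈
  ... | inj₂ x∈c = inj₂ (inj₂ (x∈⁅y⁆⇒x≡y c x∈c))
  ... | inj₁ x∈ab with ∈-pair⁻ x∈ab
  ...   | inj₁ x≡a = inj₁ x≡a
  ...   | inj₂ x≡b = inj₂ (inj₁ x≡b)

  tri-⊆ : ∀ {a b c} {X : Subset n} → a ∈ X → b ∈ X → c ∈ X → tri a b c ⊆ X
  tri-⊆ a∈ b∈ c∈ x∈ with ∈-tri⁻ x∈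
  ... | inj₁ refl        = a∈
  ... | inj₂ (inj₁ refl) = b∈
  ... | inj₂ (inj₂ refl) = c∈

  ∣pair∣ : ∀ {a b : Fin n} → a ≢ b → ∣ ⁅ a ⁆ ∪ ⁅ b ⁆ ∣ ≡ 2
  ∣pair∣ {a} {b} a≢b =
    trans (∣∪⁅⁆∣ ⁅ a ⁆ b (λ b∈ → a≢b (sym (x∈⁅y⁆⇒x≡y a b∈)))) (cong suc (∣⁅x⁆∣≡1 a))

  ∣tri∣ : ∀ {a b c : Fin n} → a ≢ b → a ≢ c → b ≢ c → ∣ tri a b c ∣ ≡ 3
  ∣tri∣ {a} {b} {c} a≢b a≢c b≢c = trans (∣∪⁅⁆∣ (⁅ a ⁆ ∪ ⁅ b ⁆) c c∉) (cong suc (∣pair∣ a≢b))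
    where
    c∉ : c ∉ ⁅ a ⁆ ∪ ⁅ b ⁆
    c∉ c∈ with ∈-pair⁻ c∈
    ... | inj₁ refl = a≢c refl
    ... | inj₂ refl = b≢c refl

  ∣X∣≡3⇒tri : ∀ (X : Subset n) → ∣ X ∣ ≡ 3 → ∃[ a ] ∃[ b ] ∃[ c ] (a ≢ b × a ≢ c × b ≢ c × X ≡ tri a b c)
  ∣X∣≡3⇒tri X ∣X∣
    with a , a∈ ← choose X (subst (1 ≤_) (sym ∣X∣) (s≤s z≤n))
    with b , b∈X , b≢a ← choose-other X a (subst (2 ≤_) (sym ∣X∣) (s≤s (s≤s z≤n)))
    with c , c∈X-a , c≢b ← choose-other (X - a) b
           (ℕₚ.≤-reflexive (sym (ℕₚ.suc-injective (trans (sym (∣p∣≡1+∣p-x∣ a∈)) ∣X∣)))) =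
    a , b , c , b≢a ∘ sym , a≢c , c≢b ∘ sym ,
    sym (⊆∧∣∣≥⇒≡ (tri-⊆ a∈ b∈X (x∈p-y⇒x∈p c∈X-a))
      (ℕₚ.≤-reflexive (trans ∣X∣ (sym (∣tri∣ (b≢a ∘ sym) a≢c (c≢b ∘ sym))))))
    where
    a≢c : a ≢ c
    a≢c a≡c = x∈p-y⇒x≢y c∈X-a (sym a≡c)

flat? : ∀ {n} {F : FacePred n} → (∀ X → Dec (F X)) → ∀ Z → Dec (Flat F Z)
flat? {F = F} F? Z = map′ to from
  (¬? (anySubset? λ I → F? I ×-dec (I ⊆? Z) ×-dec any? λ p → ¬? (p ∈? Z) ×-dec ¬? (F? (I ∪ ⁅ p ⁆))))
  where
  Violation : Set
  Violation = ∃[ I ] (F I × I ⊆ Z × ∃[ p ] (p ∉ Z × ¬ F (I ∪ ⁅ p ⁆)))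
  to : ¬ Violation → Flat F Z
  to ¬bad I FI I⊆ p p∉ = decidable-stable (F? _) λ ¬F → ¬bad (I , FI , I⊆ , p , p∉ , ¬F)
  from : Flat F Z → ¬ Violation
  from flat (I , FI , I⊆ , p , p∉ , ¬F) = ¬F (flat I FI I⊆ p p∉)

-- Flats and triangles in dimension two

module Geometry {n} (H : Complex n) (br : BooleanRepresentable H) (dim : HasDim2 H) where

  -- The negation of η (see η⇔¬sep).
  Sep : Fin n → Fin n → Set
  Sep a b = a ≢ b × face H (⁅ a ⁆ ∪ ⁅ b ⁆)

  sep? : ∀ a b → Dec (Sep a b)
  sep? a b = ¬? (a Fin.≟ b) ×-dec face? H br (⁅ a ⁆ ∪ ⁅ b ⁆)

  sep-sym : ∀ {a b} → Sep a b → Sep b a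
  sep-sym (a≢b , f) = a≢b ∘ sym , down H _ _ (pair-⊆ b∈pair a∈pair) f

  sep-intro : ∀ {a b Z} → Flat (face H) Z → a ∈ Z → b ∉ Z → Sep a b
  sep-intro {a} {b} flat a∈ b∉ = (λ { refl → b∉ a∈ }) ,
    flat ⁅ a ⁆ (singleton H a) (λ x∈ → subst (_∈ _) (sym (x∈⁅y⁆⇒x≡y a x∈)) a∈) b b∉

  sep-elim : ∀ {a b} → Sep a b → ∃[ Z ] (Flat (face H) Z × ((a ∈ Z × b ∉ Z) ⊎ (b ∈ Z × a ∉ Z)))
  sep-elim {a} {b} (a≢b , f) with face-peel H br f (a , a∈pair)
  ... | p , Z , p∈ , flat , p∉ , rest with ∈-pair⁻ p∈
  ...   | inj₁ refl = Z , flat , inj₂ (rest b∈pair (a≢b ∘ sym) , p∉)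
  ...   | inj₂ refl = Z , flat , inj₁ (rest a∈pair a≢b , p∉)

  ¬sep⇒∈ : ∀ {a b Z} → ¬ Sep a b → Flat (face H) Z → a ∈ Z → b ∈ Z
  ¬sep⇒∈ {b = b} {Z} ¬sep flat a∈ = decidable-stable (b ∈? Z) (¬sep ∘ sep-intro flat a∈)

  -- Transitivity of not being separated, read backwards: a flat that tells `a` from `b` tells `v`
  -- from one of them.
  sep-split : ∀ {a b} v → Sep a b → Sep v a ⊎ Sep v b
  sep-split {a} {b} v ab with sep? v a | sep? v b
  ... | yes va | _      = inj₁ va
  ... | no _   | yes vb = inj₂ vb
  ... | no ¬va | no ¬vb with sep-elim ab
  ...   | Z , flat , inj₁ (a∈ , b∉) = contradiction (¬sep⇒∈ ¬vb flat (¬sep⇒∈ (¬va ∘ sep-sym) flat a∈)) b∉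
  ...   | Z , flat , inj₂ (b∈ , a∉) = contradiction (¬sep⇒∈ ¬va flat (¬sep⇒∈ (¬vb ∘ sep-sym) flat b∈)) a∉

  -- The closure of a point depends only on the flats through it, and two points are separated
  -- exactly when some flat contains just one of them.
  η⇔¬sep : ∀ a b → η H a b ⇔ (¬ Sep a b)
  η⇔¬sep a b = mk⇔ to from
    where
    to : η H a b → ¬ Sep a b
    to ηab ab with sep-elim ab
    ... | Z , flat , inj₁ (a∈ , b∉) =
      b∉ (Equivalence.from (ηab b) (λ W _ b⊆ → b⊆ (x∈⁅x⁆ b)) Z flat
        λ x∈ → subst (_∈ Z) (sym (x∈⁅y⁆⇒x≡y a x∈)) a∈)
    ... | Z , flat , inj₂ (b∈ , a∉) =
      a∉ (Equivalence.to (ηab a) (λ W _ a⊆ → a⊆ (x∈⁅x⁆ a)) Z flat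
        λ x∈ → subst (_∈ Z) (sym (x∈⁅y⁆⇒x≡y b x∈)) b∈)
    closure-⊆ : ∀ {a b} → ¬ Sep a b → ∀ {r} → InClosure (face H) ⁅ b ⁆ r → InClosure (face H) ⁅ a ⁆ r
    closure-⊆ {a} {b} ¬ab cl Z flat a⊆ = cl Z flat λ x∈ →
      subst (_∈ Z) (sym (x∈⁅y⁆⇒x≡y b x∈)) (¬sep⇒∈ ¬ab flat (a⊆ (x∈⁅x⁆ a)))
    from : ¬ Sep a b → η H a b
    from ¬ab r = mk⇔ (closure-⊆ (¬ab ∘ sep-sym)) (closure-⊆ ¬ab)

  ProperFlat : Subset n → Set
  ProperFlat Z = Flat (face H) Z × ∃[ r ] r ∉ Z

  -- The graph of flats of the simplification, pulled back to the vertices of H.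
  E : Fin n → Fin n → Set
  E a b = Sep a b × ∃[ Z ] (ProperFlat Z × a ∈ Z × b ∈ Z)

  E? : ∀ a b → Dec (E a b)
  E? a b = sep? a b ×-dec
    anySubset? λ Z → (flat? (face? H br) Z ×-dec any? λ r → ¬? (r ∈? Z)) ×-dec (a ∈? Z) ×-dec (b ∈? Z)

  E-sym : ∀ {a b} → E a b → E b a
  E-sym (ab , Z , proper , a∈ , b∈) = sep-sym ab , Z , proper , b∈ , a∈

  E-cong : ∀ {a b c} → ¬ Sep b c → E a b → E a c
  E-cong {a} {b} {c} ¬bc (ab , Z , proper , a∈ , b∈) with sep-split c ab
  ... | inj₁ ca = sep-sym ca , Z , proper , a∈ , ¬sep⇒∈ ¬bc (proj₁ proper) b∈
  ... | inj₂ cb = contradiction (sep-sym cb) ¬bc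

  Tri : Fin n → Fin n → Fin n → Set
  Tri a b c = (a ≢ b × a ≢ c × b ≢ c) × face H (tri a b c)

  tri-rotate : ∀ {a b c} → Tri a b c → Tri b c a
  tri-rotate ((a≢b , a≢c , b≢c) , f) =
    (b≢c , a≢b ∘ sym , a≢c ∘ sym) , down H _ _ (tri-⊆ b∈tri c∈tri a∈tri) f

  tri-swap : ∀ {a b c} → Tri a b c → Tri b a c
  tri-swap ((a≢b , a≢c , b≢c) , f) =
    (a≢b ∘ sym , b≢c , a≢c) , down H _ _ (tri-⊆ b∈tri a∈tri c∈tri) f

  tri⇒sep : ∀ {a b c} → Tri a b c → Sep a b
  tri⇒sep ((a≢b , _) , f) = a≢b , down H _ _ (pair-⊆ a∈tri b∈tri) f

  tri-intro : ∀ {a b c Z} → Sep a b → Flat (face H) Z → a ∈ Z → b ∈ Z → c ∉ Z → Tri a b c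
  tri-intro {c = c} (a≢b , f) flat a∈ b∈ c∉ =
    (a≢b , (λ { refl → c∉ a∈ }) , (λ { refl → c∉ b∈ })) , flat _ f (pair-⊆ a∈ b∈) c c∉

  tri-peel : ∀ {a b c} → Tri a b c →
    ∃[ Z ] (Flat (face H) Z × ((a ∈ Z × b ∈ Z × c ∉ Z) ⊎ (b ∈ Z × c ∈ Z × a ∉ Z) ⊎ (a ∈ Z × c ∈ Z × b ∉ Z)))
  tri-peel {a} ((a≢b , a≢c , b≢c) , f) with face-peel H br f (a , a∈tri)
  ... | p , Z , p∈ , flat , p∉ , rest with ∈-tri⁻ p∈
  ...   | inj₁ refl = Z , flat , inj₂ (inj₁ (rest b∈tri (a≢b ∘ sym) , rest c∈tri (a≢c ∘ sym) , p∉))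
  ...   | inj₂ (inj₁ refl) = Z , flat , inj₂ (inj₂ (rest a∈tri a≢b , rest c∈tri (b≢c ∘ sym) , p∉))
  ...   | inj₂ (inj₂ refl) = Z , flat , inj₁ (rest a∈tri a≢c , rest b∈tri b≢c , p∉)

  -- A proper flat through a triangle would extend it by an outside point to a face of four
  -- vertices, beyond dimension two.
  tri⊈proper : ∀ {a b c Z} → ProperFlat Z → Tri a b c → a ∉ Z ⊎ b ∉ Z ⊎ c ∉ Z
  tri⊈proper {a} {b} {c} {Z} (flat , r , r∉) ((a≢b , a≢c , b≢c) , f) with a ∈? Z | b ∈? Z | c ∈? Z
  ... | no a∉ | _     | _     = inj₁ a∉
  ... | yes _ | no b∉ | _     = inj₂ (inj₁ b∉)
  ... | yes _ | yes _ | no c∉ = inj₂ (inj₂ c∉)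
  ... | yes a∈ | yes b∈ | yes c∈ =
    contradiction (proj₂ dim _ (flat _ f (tri-⊆ a∈ b∈ c∈) r r∉)) (ℕₚ.<⇒≱ (ℕₚ.≤-reflexive (sym size)))
    where
    size : ∣ tri a b c ∪ ⁅ r ⁆ ∣ ≡ 4
    size = trans (∣∪⁅⁆∣ (tri a b c) r (λ r∈ → r∉ (tri-⊆ a∈ b∈ c∈ r∈))) (cong suc (∣tri∣ a≢b a≢c b≢c))

  tri-facet : ∀ {a b c} → Tri a b c → Facet H (tri a b c)
  tri-facet ((a≢b , a≢c , b≢c) , f) = f , λ Y fY ⊆Y →
    ⊆∧∣∣≥⇒≡ ⊆Y (subst (∣ Y ∣ ≤_) (sym (∣tri∣ a≢b a≢c b≢c)) (proj₂ dim Y fY))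

  face⇒tri : ∀ X → face H X → ∣ X ∣ ≡ 3 → ∃[ a ] ∃[ b ] ∃[ c ] (Tri a b c × X ≡ tri a b c)
  face⇒tri X fX ∣X∣ with a , b , c , a≢b , a≢c , b≢c , refl ← ∣X∣≡3⇒tri X ∣X∣ =
    a , b , c , ((a≢b , a≢c , b≢c) , fX) , refl

  -- A triangle with the flat that certifies it. Keeping the flat allows `c` to be exchanged for any
  -- other vertex outside `plane`, as `two⇒shellable` does.
  record Frame (a b c : Fin n) : Set where
    field
      plane : Subset n
      flat  : Flat (face H) plane
      sep   : Sep a b
      a∈    : a ∈ plane
      b∈    : b ∈ plane
      c∉    : c ∉ plane

    triangle : Tri a b c
    triangle = tri-intro sep flat a∈ b∈ c∉

    edge : E a b
    edge = sep , plane , (flat , c , c∉) , a∈ , b∈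

  frame : ∃[ a ] ∃[ b ] ∃[ c ] Frame a b c
  frame with X , fX , ∣X∣ ← proj₁ dim
        with a , b , c , t , refl ← face⇒tri X fX ∣X∣
        with tri-peel t
  ... | Z , flat , inj₁ (a∈ , b∈ , c∉) =
    a , b , c , record { flat = flat ; sep = tri⇒sep t ; a∈ = a∈ ; b∈ = b∈ ; c∉ = c∉ }
  ... | Z , flat , inj₂ (inj₁ (b∈ , c∈ , a∉)) =
    b , c , a , record { flat = flat ; sep = tri⇒sep (tri-rotate t) ; a∈ = b∈ ; b∈ = c∈ ; c∉ = a∉ }
  ... | Z , flat , inj₂ (inj₂ (a∈ , c∈ , b∉)) =
    c , a , b , record { flat = flat ; sep = tri⇒sep (tri-rotate (tri-rotate t)) ; a∈ = c∈ ; b∈ = a∈ ; c∉ = b∉ }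

  tri⇒edge : ∀ {a b c} → Tri a b c → E a b ⊎ E b c ⊎ E a c
  tri⇒edge t with tri-peel t
  ... | Z , flat , inj₁ (a∈ , b∈ , c∉)        = inj₁ (tri⇒sep t , Z , (flat , _ , c∉) , a∈ , b∈)
  ... | Z , flat , inj₂ (inj₁ (b∈ , c∈ , a∉)) = inj₂ (inj₁ (tri⇒sep (tri-rotate t) , Z , (flat , _ , a∉) , b∈ , c∈))
  ... | Z , flat , inj₂ (inj₂ (a∈ , c∈ , b∉)) =
    inj₂ (inj₂ (sep-sym (tri⇒sep (tri-rotate (tri-rotate t))) , Z , (flat , _ , b∉) , a∈ , c∈))

  -- The flat witnessing the edge `a b` must miss `c`, or it would witness the edge `a c` too.
  tri-off : ∀ {a b c} → E a b → Sep a c → ¬ E a c → Tri a b c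
  tri-off {c = c} (ab , Z , proper , a∈ , b∈) ac ¬Eac =
    tri-intro ab (proj₁ proper) a∈ b∈ λ c∈ → ¬Eac (ac , Z , proper , a∈ , c∈)

  -- A vertex off the plane completes `a b` to a triangle. A vertex on the plane is separated from
  -- `a` or `b`, and that pair is completed by `c`.
  tri-through : ∀ {a b c} → Frame a b c → ∀ u → ∃[ x ] ∃[ y ] Tri u x y
  tri-through {a} {b} {c} fr u with u ∈? Frame.plane fr
  ... | no u∉ = a , b , tri-rotate (tri-rotate
    (tri-intro (Frame.sep fr) (Frame.flat fr) (Frame.a∈ fr) (Frame.b∈ fr) u∉))
  ... | yes u∈ with sep-split u (Frame.sep fr)
  ...   | inj₁ ua = a , c , tri-intro ua (Frame.flat fr) u∈ (Frame.a∈ fr) (Frame.c∉ fr)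
  ...   | inj₂ ub = b , c , tri-intro ub (Frame.flat fr) u∈ (Frame.b∈ fr) (Frame.c∉ fr)

-- The simplification

-- The condition on the simplification ranges over all quotient maps, so one must be built before it
-- can be applied. Vertex zero either joins the class of a later vertex or forms a new class.
quotient-map : ∀ {n} {R : Fin n → Fin n → Set} → (∀ a b → Dec (R a b)) → IsEquivalence R →
  ∃[ k ] Σ (Fin n → Fin k) λ π → Surjective _≡_ _≡_ π × (∀ a b → (π a ≡ π b) ⇔ R a b)
quotient-map {zero} R? equiv = 0 , (λ ()) , (λ ()) , λ ()
quotient-map {suc n} {R} R? equiv
  with k , π , surj , π⇔ ← quotient-map (λ a b → R? (suc a) (suc b)) (On.isEquivalence suc equiv)
  with any? (λ j → R? zero (suc j))
... | yes (j , 0Rj) = k , π′ , (λ y → suc (proj₁ (surj y)) , λ { refl → proj₂ (surj y) refl }) , π′⇔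
  where
  module E = IsEquivalence equiv
  π′ : Fin (suc n) → Fin k
  π′ zero    = π j
  π′ (suc i) = π i
  π′⇔ : ∀ a b → (π′ a ≡ π′ b) ⇔ R a b
  π′⇔ zero    zero    = mk⇔ (λ _ → E.refl) (λ _ → refl)
  π′⇔ zero    (suc b) = mk⇔ (λ e → E.trans 0Rj (Equivalence.to (π⇔ j b) e))
                            (λ r → Equivalence.from (π⇔ j b) (E.trans (E.sym 0Rj) r))
  π′⇔ (suc a) zero    = mk⇔ (λ e → E.trans (Equivalence.to (π⇔ a j) e) (E.sym 0Rj))
                            (λ r → Equivalence.from (π⇔ a j) (E.trans r 0Rj))
  π′⇔ (suc a) (suc b) = π⇔ a b
... | no ¬0R = suc k , π′ , surj′ , π′⇔
  where
  module E = IsEquivalence equiv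
  π′ : Fin (suc n) → Fin (suc k)
  π′ zero    = zero
  π′ (suc i) = suc (π i)
  surj′ : Surjective _≡_ _≡_ π′
  surj′ zero    = zero , λ { refl → refl }
  surj′ (suc y) = suc (proj₁ (surj y)) , λ { refl → cong suc (proj₂ (surj y) refl) }
  π′⇔ : ∀ a b → (π′ a ≡ π′ b) ⇔ R a b
  π′⇔ zero    zero    = mk⇔ (λ _ → E.refl) (λ _ → refl)
  π′⇔ zero    (suc b) = mk⇔ (λ ()) (λ r → contradiction (b , r) ¬0R)
  π′⇔ (suc a) zero    = mk⇔ (λ ()) (λ r → contradiction (a , E.sym r) ¬0R)
  π′⇔ (suc a) (suc b) = mk⇔ (Equivalence.to (π⇔ a b) ∘ suc-injective) (cong suc ∘ Equivalence.from (π⇔ a b))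

∈-tabulate⇔ : ∀ {n} (f : Fin n → Bool) x → (x ∈ tabulate f) ⇔ T (f x)
∈-tabulate⇔ f x = mk⇔
  (λ x∈ → Equivalence.from Boolₚ.T-≡ (trans (sym (Vecₚ.lookup∘tabulate f x)) (Vecₚ.[]=⇒lookup x∈)))
  (λ t → Vecₚ.lookup⇒[]= x _ (trans (Vecₚ.lookup∘tabulate f x) (Equivalence.to Boolₚ.T-≡ t)))

module _ {n k} (π : Fin n → Fin k) where

  ∈-image⁺ : ∀ {I a} → a ∈ I → π a ∈ image π I
  ∈-image⁺ {I} {a} a∈ = Equivalence.from (∈-tabulate⇔ _ (π a))
    (Anyₚ.any⁺ (λ b → lookup I b ∧ ⌊ π b Fin.≟ π a ⌋) (LAny.map witness (Lₚ.∈-allFin a)))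
    where
    witness : ∀ {b} → a ≡ b → T (lookup I b ∧ ⌊ π b Fin.≟ π a ⌋)
    witness refl = Equivalence.from Boolₚ.T-∧
      (Equivalence.from Boolₚ.T-≡ (Vecₚ.[]=⇒lookup a∈) , fromWitness {a? = π a Fin.≟ π a} refl)

  ∈-image⁻ : ∀ {I z} → z ∈ image π I → ∃[ a ] (a ∈ I × π a ≡ z)
  ∈-image⁻ {I} {z} z∈
    with a , t ← LAny.satisfied (Anyₚ.any⁻ (λ b → lookup I b ∧ ⌊ π b Fin.≟ z ⌋) (allFin n)
                   (Equivalence.to (∈-tabulate⇔ _ z) z∈))
    with ta , te ← Equivalence.to Boolₚ.T-∧ t =
    a , Vecₚ.lookup⇒[]= a I (Equivalence.to Boolₚ.T-≡ ta) , toWitness {a? = π a Fin.≟ z} te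

  preimage : Subset k → Subset n
  preimage W = tabulate (lookup W ∘ π)

  ∈-preimage⁺ : ∀ {W x} → π x ∈ W → x ∈ preimage W
  ∈-preimage⁺ {W} {x} πx∈ =
    Equivalence.from (∈-tabulate⇔ _ x) (Equivalence.from Boolₚ.T-≡ (Vecₚ.[]=⇒lookup πx∈))

  ∈-preimage⁻ : ∀ {W x} → x ∈ preimage W → π x ∈ W
  ∈-preimage⁻ {W} {x} x∈ =
    Vecₚ.lookup⇒[]= (π x) W (Equivalence.to Boolₚ.T-≡ (Equivalence.to (∈-tabulate⇔ _ x) x∈))

module Simplification {n} (H : Complex n) (br : BooleanRepresentable H) (dim : HasDim2 H)
  {k} (π : Fin n → Fin k) (simplifies : IsSimplificationMap H π) where

  open Geometry H br dim

  section : ∀ y → ∃[ x ] π x ≡ y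
  section y with x , e ← proj₁ simplifies y = x , e refl

  π≡⇒¬sep : ∀ {a b} → π a ≡ π b → ¬ Sep a b
  π≡⇒¬sep {a} {b} e = Equivalence.to (η⇔¬sep a b) (Equivalence.to (proj₂ simplifies a b) e)

  π≢⇒sep : ∀ {a b} → π a ≢ π b → Sep a b
  π≢⇒sep {a} {b} ne = decidable-stable (sep? a b) λ ¬ab →
    ne (Equivalence.from (proj₂ simplifies a b) (Equivalence.from (η⇔¬sep a b) ¬ab))

  face⇒π-injective : ∀ {I} → face H I → ∀ {x y} → x ∈ I → y ∈ I → π x ≡ π y → x ≡ y
  face⇒π-injective fI {x} {y} x∈ y∈ e = decidable-stable (x Fin.≟ y) λ x≢y →
    π≡⇒¬sep e (x≢y , down H _ _ (pair-⊆ x∈ y∈) fI)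

  -- Flats are unions of η-classes. A flat cutting `p` off `I` therefore cuts the vertex of `X` in
  -- the class of `p` off the rest of `X`; if `X` has no such vertex, `p` is dropped from `I`.
  face-transfer : ∀ {X} I → face H I → (∀ {x y} → x ∈ X → y ∈ X → π x ≡ π y → x ≡ y) →
    (∀ {x} → x ∈ X → ∃[ i ] (i ∈ I × π x ≡ π i)) → face H X
  face-transfer {X} I = go ∣ I ∣ I ℕₚ.≤-refl
    where
    go : ∀ m {X} I → ∣ I ∣ ≤ m → face H I → (∀ {x y} → x ∈ X → y ∈ X → π x ≡ π y → x ≡ y) →
      (∀ {x} → x ∈ X → ∃[ i ] (i ∈ I × π x ≡ π i)) → face H X
    go m {X} I ∣I∣≤ fI inj cover with nonempty? X
    ... | no empty = subst (face H) (sym (Empty-unique empty)) (down H I ⊥ ⊥⊆ fI)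
    go zero {X} I ∣I∣≤ fI inj cover | yes (x , x∈) with i , i∈ , _ ← cover x∈ =
      contradiction (ℕₚ.≤-trans (ℕₚ.≤-reflexive (sym (∣p∣≡1+∣p-x∣ i∈))) ∣I∣≤) λ ()
    go (suc m) {X} I ∣I∣≤ fI inj cover | yes (x , x∈)
      with i , i∈ , _ ← cover x∈
      with p , Z , p∈ , flat , p∉ , rest ← face-peel H br fI (i , i∈)
      with any? (λ q → (q ∈? X) ×-dec (π q Fin.≟ π p))
    ... | yes (q , q∈ , πq≡πp) =
      subst (face H) (p-x∪⁅x⁆≡p q∈) (flat (X - q) X-q-face X-q⊆Z q q∉Z)
      where
      cover′ : ∀ {x} → x ∈ X - q → ∃[ i ] (i ∈ I - p × π x ≡ π i)
      cover′ x∈ with i , i∈ , e ← cover (x∈p-y⇒x∈p x∈) =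
        i , x∈p∧x≢y⇒x∈p-y i∈ (λ { refl → x∈p-y⇒x≢y x∈ (inj (x∈p-y⇒x∈p x∈) q∈ (trans e (sym πq≡πp))) }) , e
      X-q-face : face H (X - q)
      X-q-face = go m (I - p) (ℕₚ.≤-pred (ℕₚ.≤-trans (x∈p⇒∣p-x∣<∣p∣ p∈) ∣I∣≤))
        (down H I (I - p) x∈p-y⇒x∈p fI)
        (λ x∈ y∈ → inj (x∈p-y⇒x∈p x∈) (x∈p-y⇒x∈p y∈)) cover′
      X-q⊆Z : X - q ⊆ Z
      X-q⊆Z x∈ with i , i∈ , e ← cover′ x∈ =
        ¬sep⇒∈ (π≡⇒¬sep (sym e)) flat (rest (x∈p-y⇒x∈p i∈) (x∈p-y⇒x≢y i∈))
      q∉Z : q ∉ Z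
      q∉Z q∈Z = p∉ (¬sep⇒∈ (π≡⇒¬sep πq≡πp) flat q∈Z)
    ... | no ¬q = go m (I - p) (ℕₚ.≤-pred (ℕₚ.≤-trans (x∈p⇒∣p-x∣<∣p∣ p∈) ∣I∣≤))
        (down H I (I - p) x∈p-y⇒x∈p fI) inj cover′
      where
      cover′ : ∀ {x} → x ∈ X → ∃[ i ] (i ∈ I - p × π x ≡ π i)
      cover′ {x} x∈ with i , i∈ , e ← cover x∈ =
        i , x∈p∧x≢y⇒x∈p-y i∈ (λ { refl → ¬q (x , x∈ , e) }) , e

  quotientFace? : ∀ W → Dec (QuotientFace H π W)
  quotientFace? W = anySubset? λ I → face? H br I ×-dec Vecₚ.≡-dec Boolₚ._≟_ W (image π I)

  -- The face `J` supplied by the quotient only has the same classes as `I ∪ ⁅ p ⁆`; since `π` is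
  -- injective on the latter set, `face-transfer` makes it a face too.
  preimage-flat : ∀ {W} → Flat (QuotientFace H π) W → Flat (face H) (preimage π W)
  preimage-flat {W} flat I fI I⊆ p p∉ =
    let J , fJ , imI∪p≡imJ = flat (image π I) (I , fI , refl) imI⊆W (π p) (p∉ ∘ ∈-preimage⁺ π)
    in face-transfer J fJ inj (cover imI∪p≡imJ)
    where
    imI⊆W : image π I ⊆ W
    imI⊆W z∈ with a , a∈ , refl ← ∈-image⁻ π z∈ = ∈-preimage⁻ π (I⊆ a∈)
    p-apart : ∀ {x} → x ∈ I → π x ≢ π p
    p-apart x∈ e = p∉ (∈-preimage⁺ π (subst (_∈ W) e (∈-preimage⁻ π (I⊆ x∈))))
    inj : ∀ {x y} → x ∈ I ∪ ⁅ p ⁆ → y ∈ I ∪ ⁅ p ⁆ → π x ≡ π y → x ≡ y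
    inj {x} {y} x∈ y∈ e with x∈p∪q⁻ I ⁅ p ⁆ x∈ | x∈p∪q⁻ I ⁅ p ⁆ y∈
    ... | inj₁ x∈I | inj₁ y∈I = face⇒π-injective fI x∈I y∈I e
    ... | inj₁ x∈I | inj₂ y∈p with refl ← x∈⁅y⁆⇒x≡y p y∈p = contradiction e (p-apart x∈I)
    ... | inj₂ x∈p | inj₁ y∈I with refl ← x∈⁅y⁆⇒x≡y p x∈p = contradiction (sym e) (p-apart y∈I)
    ... | inj₂ x∈p | inj₂ y∈p = trans (x∈⁅y⁆⇒x≡y p x∈p) (sym (x∈⁅y⁆⇒x≡y p y∈p))
    cover : ∀ {J} → image π I ∪ ⁅ π p ⁆ ≡ image π J →
      ∀ {x} → x ∈ I ∪ ⁅ p ⁆ → ∃[ j ] (j ∈ J × π x ≡ π j)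
    cover imI∪p≡imJ {x} x∈ = let j , j∈ , e = ∈-image⁻ π (subst (π x ∈_) imI∪p≡imJ πx∈) in j , j∈ , sym e
      where
      πx∈ : π x ∈ image π I ∪ ⁅ π p ⁆
      πx∈ with x∈p∪q⁻ I ⁅ p ⁆ x∈
      ... | inj₁ x∈I = x∈p∪q⁺ (inj₁ (∈-image⁺ π x∈I))
      ... | inj₂ x∈p with refl ← x∈⁅y⁆⇒x≡y p x∈p = x∈p∪q⁺ (inj₂ (x∈⁅x⁆ (π p)))

  ∈-image-flat : ∀ {Z x} → Flat (face H) Z → π x ∈ image π Z → x ∈ Z
  ∈-image-flat flat πx∈ with a , a∈ , e ← ∈-image⁻ π πx∈ = ¬sep⇒∈ (π≡⇒¬sep e) flat a∈

  image-∪ : ∀ I p → image π I ∪ ⁅ π p ⁆ ≡ image π (I ∪ ⁅ p ⁆)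
  image-∪ I p = ⊆-antisym to from
    where
    to : image π I ∪ ⁅ π p ⁆ ⊆ image π (I ∪ ⁅ p ⁆)
    to z∈ with x∈p∪q⁻ (image π I) ⁅ π p ⁆ z∈
    ... | inj₁ z∈I with a , a∈ , refl ← ∈-image⁻ π z∈I = ∈-image⁺ π {I ∪ ⁅ p ⁆} (x∈p∪q⁺ (inj₁ a∈))
    ... | inj₂ z∈p with refl ← x∈⁅y⁆⇒x≡y (π p) z∈p = ∈-image⁺ π {I ∪ ⁅ p ⁆} (x∈p∪q⁺ (inj₂ (x∈⁅x⁆ p)))
    from : image π (I ∪ ⁅ p ⁆) ⊆ image π I ∪ ⁅ π p ⁆
    from z∈ with a , a∈ , refl ← ∈-image⁻ π z∈ with x∈p∪q⁻ I ⁅ p ⁆ a∈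
    ... | inj₁ a∈I = x∈p∪q⁺ (inj₁ (∈-image⁺ π a∈I))
    ... | inj₂ a∈p with refl ← x∈⁅y⁆⇒x≡y p a∈p = x∈p∪q⁺ (inj₂ (x∈⁅x⁆ (π p)))

  image-flat : ∀ {Z} → Flat (face H) Z → Flat (QuotientFace H π) (image π Z)
  image-flat {Z} flat _ (I , fI , refl) imI⊆ p p∉ with q , refl ← section p =
    I ∪ ⁅ q ⁆ , flat I fI (λ x∈ → ∈-image-flat flat (imI⊆ (∈-image⁺ π x∈))) q (p∉ ∘ ∈-image⁺ π) , image-∪ I q

  E⇒flatEdge : ∀ {a b} → E a b → FlatEdge (QuotientFace H π) (π a) (π b)
  E⇒flatEdge {a} {b} (ab , Z , (flat , r , r∉) , a∈ , b∈) = (λ e → π≡⇒¬sep e ab) , λ closure →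
    r∉ (∈-image-flat flat (closure (π r) (image π Z) (image-flat flat)
      (pair-⊆ (∈-image⁺ π a∈) (∈-image⁺ π b∈))))

  flatEdge⇒E : ∀ {a b} → FlatEdge (QuotientFace H π) (π a) (π b) → E a b
  flatEdge⇒E {a} {b} (πa≢πb , ¬closure)
    -- An edge only denies that the closure contains every point; a search over all subsets turns
    -- this into an actual proper flat.
    with anySubset? (λ W → flat? quotientFace? W ×-dec (π a ∈? W) ×-dec (π b ∈? W) ×-dec any? λ r → ¬? (r ∈? W))
  ... | no ¬W = contradiction (λ r W flat ab⊆ → decidable-stable (r ∈? W) λ r∉ →
    ¬W (W , flat , ab⊆ a∈pair , ab⊆ b∈pair , r , r∉)) ¬closure
  ... | yes (W , flat , πa∈ , πb∈ , r , r∉) with s , refl ← section r =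
    π≢⇒sep πa≢πb , preimage π W , (preimage-flat flat , s , r∉ ∘ ∈-preimage⁻ π) ,
    ∈-preimage⁺ π πa∈ , ∈-preimage⁺ π πb∈

  flatEdge-sym : ∀ {u v} → FlatEdge (QuotientFace H π) u v → FlatEdge (QuotientFace H π) v u
  flatEdge-sym {u} {v} uv with a , refl ← section u with b , refl ← section v = E⇒flatEdge (E-sym (flatEdge⇒E uv))

  -- Only the start of the lift can be prescribed. Each later vertex is chosen by `section`, so the
  -- end is known only up to its class.
  lift-path : ∀ {u v} → Connected (QuotientFace H π) u v → ∀ {a} → π a ≡ u → ∃[ b ] (π b ≡ v × Star E a b)
  lift-path ε {a} e = a , e , ε
  lift-path (_◅_ {j = w} uw wv) refl with b , refl ← section w
    with c , πc , path ← lift-path wv {b} refl = c , πc , flatEdge⇒E uw ◅ path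

-- Contractions of vertices, edges and triangles

module _ {n} (f : Fin n → ℤ) where

  contract-vertex : ∀ x Y → contract f (simplex (x ∷ [])) Y ≡ f x * unit Y
  contract-vertex x Y = trans (contract-wedge f x unit Y) (trans
    (cong (λ z → f x * unit Y + - z) (trans (wedge-cong x (contract-unit f) Y) (wedge-zero x Y)))
    (ℤₚ.+-identityʳ _))

  contract-edge : ∀ x y Y →
    contract f (simplex (x ∷ y ∷ [])) Y ≡ f x * simplex (y ∷ []) Y + - (f y * simplex (x ∷ []) Y)
  contract-edge x y Y = trans (contract-wedge f x (simplex (y ∷ [])) Y)
    (cong (λ z → f x * simplex (y ∷ []) Y + - z)
      (trans (wedge-cong x (λ Z → trans (contract-vertex y Z) (sym (ℤₚ.+-identityʳ _))) Y)
        (trans (wedge-linear x (f y) unit (λ _ → 0ℤ) Y)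
          (trans (cong (f y * simplex (x ∷ []) Y +_) (wedge-zero x Y)) (ℤₚ.+-identityʳ _)))))

-- The grouping is that of a cocycle condition: modulo boundaries, the edges `x y` and `y z` add up
-- to `x z`.
∂-triangle : ∀ {n} (x y z : Fin n) Y → ∂ (simplex (x ∷ y ∷ z ∷ [])) Y ≡
  simplex (x ∷ y ∷ []) Y + simplex (y ∷ z ∷ []) Y + - simplex (x ∷ z ∷ []) Y
∂-triangle x y z Y = trans (contract-wedge _ x (simplex (y ∷ z ∷ [])) Y)
  (trans (cong (λ w → 1ℤ * simplex (y ∷ z ∷ []) Y + - w) (trans (wedge-cong x ∂yz Y)
      (wedge-linear x -1ℤ (simplex (y ∷ [])) (simplex (z ∷ [])) Y)))
    (lemma (simplex (y ∷ z ∷ []) Y) (simplex (x ∷ y ∷ []) Y) (simplex (x ∷ z ∷ []) Y)))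
  where
  ∂yz : ∀ Z → ∂ (simplex (y ∷ z ∷ [])) Z ≡ -1ℤ * simplex (y ∷ []) Z + simplex (z ∷ []) Z
  ∂yz Z = trans (contract-edge _ y z Z) (swap (simplex (z ∷ []) Z) (simplex (y ∷ []) Z))
    where
    swap : ∀ a b → 1ℤ * a + - (1ℤ * b) ≡ -1ℤ * b + a
    swap = solve-∀
  lemma : ∀ a b c → 1ℤ * a + - (-1ℤ * b + c) ≡ b + a + - c
  lemma = solve-∀

unit-⊥ : ∀ n → unit (⊥ {n}) ≡ 1ℤ
unit-⊥ zero    = refl
unit-⊥ (suc n) = unit-⊥ n

-- Enlarging and counting subsets

extend-maximal : ∀ {n} {P : FacePred n} → (∀ X → Dec (P X)) → ∀ X → P X →
  ∃[ Y ] (X ⊆ Y × P Y × (∀ Z → P Z → Y ⊆ Z → Y ≡ Z))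
extend-maximal {n} {P} P? X PX = go n X PX (ℕₚ.m≤n+m n ∣ X ∣)
  where
  go : ∀ m X → P X → n ≤ ∣ X ∣ ℕ.+ m → ∃[ Y ] (X ⊆ Y × P Y × (∀ Z → P Z → Y ⊆ Z → Y ≡ Z))
  go m X PX n≤ with anySubset? (λ Z → P? Z ×-dec X ⊂? Z)
  ... | no ¬Z = X , ⊆-refl , PX , λ Z PZ X⊆Z → ⊆-antisym X⊆Z λ {z} z∈ →
    decidable-stable (z ∈? X) λ z∉ → ¬Z (Z , PZ , X⊆Z , z , z∈ , z∉)
  go zero X PX n≤ | yes (Z , PZ , X⊂Z) = contradiction (subst (n ≤_) (ℕₚ.+-identityʳ ∣ X ∣) n≤)
    (ℕₚ.<⇒≱ (ℕₚ.≤-trans (p⊂q⇒∣p∣<∣q∣ X⊂Z) (∣p∣≤n Z)))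
  go (suc m) X PX n≤ | yes (Z , PZ , X⊂Z)
    with Y , Z⊆Y , max ← go m Z PZ (ℕₚ.≤-trans n≤ (ℕₚ.≤-trans (ℕₚ.≤-reflexive (ℕₚ.+-suc _ m))
           (ℕₚ.+-monoˡ-≤ m (p⊂q⇒∣p∣<∣q∣ X⊂Z)))) =
    Y , (λ x∈ → Z⊆Y (proj₁ X⊂Z x∈)) , max

∣p∪q∣≡∣p∣+∣q∣ : ∀ {n} (X Y : Subset n) → (∀ {x} → x ∈ X → x ∉ Y) → ∣ X ∪ Y ∣ ≡ ∣ X ∣ ℕ.+ ∣ Y ∣
∣p∪q∣≡∣p∣+∣q∣ []            []            _    = refl
∣p∪q∣≡∣p∣+∣q∣ (outside ∷ X) (outside ∷ Y) disj = ∣p∪q∣≡∣p∣+∣q∣ X Y λ x∈ y∈ → disj (there x∈) (there y∈)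
∣p∪q∣≡∣p∣+∣q∣ (outside ∷ X) (inside ∷ Y)  disj =
  trans (cong suc (∣p∪q∣≡∣p∣+∣q∣ X Y λ x∈ y∈ → disj (there x∈) (there y∈))) (sym (ℕₚ.+-suc ∣ X ∣ ∣ Y ∣))
∣p∪q∣≡∣p∣+∣q∣ (inside ∷ X)  (outside ∷ Y) disj = cong suc (∣p∪q∣≡∣p∣+∣q∣ X Y λ x∈ y∈ → disj (there x∈) (there y∈))
∣p∪q∣≡∣p∣+∣q∣ (inside ∷ X)  (inside ∷ Y)  disj = contradiction here (disj here)

∣p∣<∣q∣⇒∃∉ : ∀ {n} (Q X : Subset n) → ∣ Q ∣ < ∣ X ∣ → ∃[ x ] (x ∈ X × x ∉ Q)
∣p∣<∣q∣⇒∃∉ Q X Q<X with any? (λ x → (x ∈? X) ×-dec ¬? (x ∈? Q))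
... | yes found = found
... | no none = contradiction
  (p⊆q⇒∣p∣≤∣q∣ λ {x} x∈ → decidable-stable (x ∈? Q) λ x∉ → none (x , x∈ , x∉)) (ℕₚ.<⇒≱ Q<X)

interpolate : ∀ {n} {X : Subset n} k Y → X ⊆ Y → ∣ X ∣ ≤ k → k ≤ ∣ Y ∣ → ∃[ Z ] (X ⊆ Z × Z ⊆ Y × ∣ Z ∣ ≡ k)
interpolate {X = X} k Y X⊆Y ∣X∣≤k k≤ = go (∣ Y ∣ ∸ k) Y X⊆Y (ℕₚ.m∸n+n≡m k≤)
  where
  go : ∀ d Y → X ⊆ Y → d ℕ.+ k ≡ ∣ Y ∣ → ∃[ Z ] (X ⊆ Z × Z ⊆ Y × ∣ Z ∣ ≡ k)
  go zero    Y X⊆Y e = Y , X⊆Y , ⊆-refl , sym e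
  go (suc d) Y X⊆Y e
    with y , y∈ , y∉ ← ∣p∣<∣q∣⇒∃∉ X Y
           (ℕₚ.≤-trans (s≤s ∣X∣≤k) (ℕₚ.≤-trans (s≤s (ℕₚ.m≤n+m k d)) (ℕₚ.≤-reflexive e)))
    with Z , X⊆Z , Z⊆ , ∣Z∣ ← go d (Y - y) (λ x∈ → x∈p∧x≢y⇒x∈p-y (X⊆Y x∈) λ { refl → y∉ x∈ })
           (ℕₚ.suc-injective (trans e (∣p∣≡1+∣p-x∣ y∈))) =
    Z , X⊆Z , (λ z∈ → x∈p-y⇒x∈p (Z⊆ z∈)) , ∣Z∣

-- A chain without support is the boundary of zero; otherwise its support supplies a face of `K`,
-- from which a base vertex can be chosen.
inhabited-suffices : ∀ {n} {K : FacePred n} {s} →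
  (∀ {X} → K X → ReducedHomologyVanishes K s) → ReducedHomologyVanishes K s
inhabited-suffices vanishes c chain cycle with anySubset? (λ X → ¬? (c X ℤ.≟ 0ℤ))
... | yes (X , c≢0) = vanishes (proj₁ (chain X c≢0)) c chain cycle
... | no c≡0 = (λ _ → 0ℤ) , (λ X ≢0 → contradiction refl ≢0) , λ X →
  trans (trans (boundary≡contract (λ _ → 0ℤ) X) (contract-zero _ X))
        (sym (decidable-stable (c X ℤ.≟ 0ℤ) λ c≢0 → c≡0 (X , c≢0)))

pureDim-down : ∀ {n m} {K : FacePred n} {X Y} → Y ⊆ X → pureDim m K X → pureDim m K Y
pureDim-down Y⊆X (Z , KZ , ∣Z∣ , X⊆Z) = Z , KZ , ∣Z∣ , λ y∈ → X⊆Z (Y⊆X y∈)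

-- Any vertex has the empty simplex as its boundary, so the projection in `homology-vanishes` can be
-- taken to be zero.
H̃₋₁-vanishes : ∀ {n} (K : FacePred n) m → ReducedHomologyVanishes (pureDim m K) 0
H̃₋₁-vanishes K m = inhabited-suffices λ { (Z , KZ , ∣Z∣ , _) →
  let v , v∈ = choose Z (subst (1 ≤_) (sym ∣Z∣) (s≤s z≤n)) in
  homology-vanishes (λ _ _ → 0ℤ) (λ _ _ → refl) (λ _ k _ _ → sym (trans (ℤₚ.+-identityʳ _) (ℤₚ.*-zeroʳ k)))
    λ { [] _ _ _ → bounds-resp
          (λ Y → trans (contract-vertex _ v Y) (trans (ℤₚ.*-identityˡ _) (sym (ℤₚ.+-identityʳ _))))
          (simplex-bounds pureDim-down (v ∷ []) refl (Z , KZ , ∣Z∣ , ⊆-refl) λ { (here refl) → v∈ }) } }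

-- Shellable complexes are sequentially Cohen-Macaulay

module ShellableComplex {n} (H : Complex n) (face? : ∀ X → Dec (face H X))
  {t} (B : Fin t → Subset n) (facets : ∀ i → Facet H (B i)) (complete : ∀ X → Facet H X → ∃[ i ] B i ≡ X)
  (B-injective : ∀ {i j} → B i ≡ B j → i ≡ j)
  (pure : ∀ k → 1 ≤ toℕ k → 2 ≤ ∣ B k ∣ →
    PureOfSize (λ Y → Y ⊆ B k × ∃[ i ] (i Fin.< k × Y ⊆ B i)) (∣ B k ∣ ∸ 1)) where

  face⊆facet : ∀ {X} → face H X → ∃[ i ] X ⊆ B i
  face⊆facet {X} fX with Y , X⊆Y , fY , max ← extend-maximal face? X fX
    with i , refl ← complete Y (fY , max) = i , X⊆Y

  -- Purity in exchange form: a facet of `I(B k)` containing `B i ∩ B k` has one vertex less than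
  -- `B k`, and the vertex `w` that it omits cannot lie in `B i`.
  shelling-step : ∀ {i k} → i Fin.< k → 2 ≤ ∣ B k ∣ →
    ∃[ w ] (w ∈ B k × w ∉ B i × ∃[ j ] (j Fin.< k × (∀ {x} → x ∈ B k → x ≢ w → x ∈ B j)))
  shelling-step {i} {k} i<k 2≤
    with Y , ∩⊆Y , (Y⊆Bk , j , j<k , Y⊆Bj) , max ← extend-maximal
           (λ Y → (Y ⊆? B k) ×-dec any? λ i → (i Finₚ.<? k) ×-dec (Y ⊆? B i))
           (B i ∩ B k) (p∩q⊆q (B i) (B k) , i , i<k , p∩q⊆p (B i) (B k))
    with ∣Y∣ ← pure k (ℕₚ.≤-trans (s≤s z≤n) i<k) 2≤ Y (Y⊆Bk , j , j<k , Y⊆Bj) max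
    with w , w∈ , w∉ ← ∣p∣<∣q∣⇒∃∉ Y (B k) (subst (_< ∣ B k ∣) (sym ∣Y∣)
           (ℕₚ.≤-reflexive (ℕₚ.m+[n∸m]≡n (ℕₚ.≤-trans (s≤s z≤n) 2≤)))) =
    w , w∈ , (λ w∈Bi → w∉ (∩⊆Y (x∈p∩q⁺ (w∈Bi , w∈)))) , j , j<k , λ x∈ x≢w →
      Y⊆Bj (subst (_ ∈_) (sym Y≡Bk-w) (x∈p∧x≢y⇒x∈p-y x∈ x≢w))
    where
    Y≡Bk-w : Y ≡ B k - w
    Y≡Bk-w = ⊆∧∣∣≥⇒≡ (λ y∈ → x∈p∧x≢y⇒x∈p-y (Y⊆Bk y∈) λ { refl → w∉ y∈ })
      (ℕₚ.≤-reflexive (sym (trans ∣Y∣ (cong (_∸ 1) (∣p∣≡1+∣p-x∣ w∈)))))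

  -- A smaller `B j` would equal `B k - w` and so not be maximal. Hence going back along the
  -- shelling keeps facets large, although the complex need not be pure.
  step-size : ∀ {j k w} → j Fin.< k → w ∈ B k → (∀ {x} → x ∈ B k → x ≢ w → x ∈ B j) → ∣ B k ∣ ≤ ∣ B j ∣
  step-size {j} {k} {w} j<k w∈ ⊆Bj = ℕₚ.≮⇒≥ λ Bj<Bk → Finₚ.<-irrefl (j≡k Bj<Bk) j<k
    where
    j≡k : ∣ B j ∣ < ∣ B k ∣ → j ≡ k
    j≡k Bj<Bk = B-injective (proj₂ (facets j) (B k) (proj₁ (facets k)) λ x∈ →
      x∈p-y⇒x∈p (subst (_ ∈_) (sym Bk-w≡Bj) x∈))
      where
      Bk-w≡Bj : B k - w ≡ B j
      Bk-w≡Bj = ⊆∧∣∣≥⇒≡ (λ x∈ → ⊆Bj (x∈p-y⇒x∈p x∈) (x∈p-y⇒x≢y x∈))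
        (ℕₚ.≤-pred (subst (∣ B j ∣ <_) (∣p∣≡1+∣p-x∣ w∈) Bj<Bk))

  module _ {Q : Subset n} {m} (1≤m : 1 ≤ m) {R : Fin n → Fin n → Set} (R-equiv : IsEquivalence R) where

    private module R = IsEquivalence R-equiv

    Good : Fin t → Set
    Good i = Q ⊆ B i × ∣ Q ∣ ℕ.+ suc m ≤ ∣ B i ∣

    -- Induction on the larger of the two indices. The shelling step replaces the later facet `B k`
    -- by an earlier `B j`, which still contains `Q` because `w` lies outside `B i`. Both contain a
    -- vertex `z` outside `Q`, because `B k` has at least two vertices outside `Q`.
    link-connected : (∀ {i} → Good i → ∀ {x y} → x ∈ B i → x ∉ Q → y ∈ B i → y ∉ Q → R x y) →
      ∀ {i j} → Good i → Good j → ∀ {x y} → x ∈ B i → x ∉ Q → y ∈ B j → y ∉ Q → R x y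
    link-connected local {i} {j} = go (suc (toℕ i ℕ.⊔ toℕ j)) (s≤s (ℕₚ.m≤m⊔n _ _)) (s≤s (ℕₚ.m≤n⊔m _ _))
      where
      Joined : Fin t → Fin t → Set
      Joined i k = Good i → Good k → ∀ {x y} → x ∈ B i → x ∉ Q → y ∈ B k → y ∉ Q → R x y
      go : ∀ d {i k} → toℕ i < d → toℕ k < d → Joined i k
      later : ∀ d {i k} → toℕ k < suc d → i Fin.< k → Joined i k
      go (suc d) {i} {k} i<d k<d gi gk x∈ x∉ y∈ y∉ with Finₚ.<-cmp i k
      ... | tri< i<k _ _  = later d k<d i<k gi gk x∈ x∉ y∈ y∉
      ... | tri≈ _ refl _ = local gi x∈ x∉ y∈ y∉
      ... | tri> _ _ k<i  = R.sym (later d i<d k<i gk gi y∈ y∉ x∈ x∉)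
      later d {i} {k} k<d i<k gi gk x∈ x∉ y∈ y∉
        with w , w∈ , w∉ , j , j<k , ⊆Bj ← shelling-step i<k
               (ℕₚ.≤-trans (s≤s 1≤m) (ℕₚ.≤-trans (ℕₚ.m≤n+m _ ∣ Q ∣) (proj₂ gk)))
        with z , z∈ , z∉ ← ∣p∣<∣q∣⇒∃∉ Q (B k - w) (ℕₚ.≤-pred (ℕₚ.≤-trans
               (ℕₚ.≤-trans (ℕₚ.≤-reflexive (trans (cong suc (sym (ℕₚ.+-comm ∣ Q ∣ 1))) (sym (ℕₚ.+-suc ∣ Q ∣ 1))))
                 (ℕₚ.+-monoʳ-≤ ∣ Q ∣ (s≤s 1≤m)))
               (ℕₚ.≤-trans (proj₂ gk) (ℕₚ.≤-reflexive (∣p∣≡1+∣p-x∣ w∈))))) =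
        R.trans
          (go d (ℕₚ.<-≤-trans i<k (ℕₚ.≤-pred k<d)) (ℕₚ.<-≤-trans j<k (ℕₚ.≤-pred k<d)) gi
            ((λ q∈ → ⊆Bj (proj₁ gk q∈) λ { refl → w∉ (proj₁ gi q∈) }) ,
              ℕₚ.≤-trans (proj₂ gk) (step-size j<k w∈ ⊆Bj))
            x∈ x∉ (⊆Bj (x∈p-y⇒x∈p z∈) (x∈p-y⇒x≢y z∈)) z∉)
          (local gk (x∈p-y⇒x∈p z∈) z∉ y∈ y∉)

  -- A 1-cocycle f is a coboundary. On a new facet the potential is forced by a codimension-one
  -- face shared with an earlier facet; if the remaining vertex w is not new, a second shared
  -- face containing w gives the compatibility.
  module _ {c ℓ} (M : Monoid c ℓ) (f : Fin n → Fin n → Monoid.Carrier M) where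

    private module M = Monoid M
    open M using (Carrier; _≈_; _∙_)

    Large : Fin t → Set
    Large i = 3 ≤ ∣ B i ∣

    Potential : (Fin n → Carrier) → Fin t → Set ℓ
    Potential g i = ∀ {x y} → x ∈ B i → y ∈ B i → (g x ∙ f x y) ≈ g y

    potential : (∀ {i} → Large i → ∀ {x y z} → x ∈ B i → y ∈ B i → z ∈ B i → (f x y ∙ f y z) ≈ f x z) →
      ∃[ g ] (∀ {i} → Large i → Potential g i)
    potential cocycle = let g , pot = upTo t in g , λ {i} → pot (toℕ<n i)
      where
      anchor : ∀ {i} → Large i → ∀ {g} g₀ {x₀} → x₀ ∈ B i → (∀ {x} → x ∈ B i → g x ≈ (g₀ ∙ f x₀ x)) → Potential g i
      anchor li g₀ x₀∈ gx x∈ y∈ = M.trans (M.∙-congʳ (gx x∈)) (M.trans (M.assoc _ _ _)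
        (M.trans (M.∙-congˡ (cocycle li x₀∈ x∈ y∈)) (M.sym (gx y∈))))

      extend : ∀ k → Large k → ∀ g → (∀ {i} → i Fin.< k → Large i → Potential g i) →
        ∃[ g′ ] ((∀ {i} → i Fin.< k → Large i → Potential g′ i) × Potential g′ k)
      extend k lk g old with any? (λ i → i Finₚ.<? k)
      ... | no first with x₀ , x₀∈ ← choose (B k) (ℕₚ.≤-trans (s≤s z≤n) lk) =
        (λ x → M.ε ∙ f x₀ x) , (λ i<k → contradiction (_ , i<k) first) , anchor lk M.ε x₀∈ λ _ → M.refl
      ... | yes (i , i<k)
        with w , w∈ , w∉ , j , j<k , ⊆Bj ← shelling-step i<k (ℕₚ.≤-trans (ℕₚ.n≤1+n 2) lk)
        with lj ← ℕₚ.≤-trans lk (step-size j<k w∈ ⊆Bj)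
        with any? (λ i → (i Finₚ.<? k) ×-dec (w ∈? B i))
      -- `w` occurs in no earlier facet, so its value is free and is set along the edge from `x₀`.
      ... | no new with x₀ , x₀∈ , x₀≢w ← choose-other (B k) w (ℕₚ.≤-trans (ℕₚ.n≤1+n 2) lk) =
        g′ , (λ i<k li x∈ y∈ → M.trans (M.∙-congʳ (M.reflexive (g′≡g i<k x∈)))
                 (M.trans (old i<k li x∈ y∈) (M.reflexive (sym (g′≡g i<k y∈))))) ,
        anchor lk (g x₀) x₀∈ gx
        where
        g′ : Fin n → Carrier
        g′ x with x Fin.≟ w
        ... | yes _ = g x₀ ∙ f x₀ w
        ... | no _  = g x
        g′≡g : ∀ {i} → i Fin.< k → ∀ {x} → x ∈ B i → g′ x ≡ g x
        g′≡g i<k {x} x∈ with x Fin.≟ w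
        ... | yes refl = contradiction (_ , i<k , x∈) new
        ... | no _     = refl
        gx : ∀ {x} → x ∈ B k → g′ x ≈ (g x₀ ∙ f x₀ x)
        gx {x} x∈ with x Fin.≟ w
        ... | yes refl = M.refl
        ... | no x≢w   = M.sym (old j<k lj (⊆Bj x₀∈ x₀≢w) (⊆Bj x∈ x≢w))
      ... | yes (i′ , i′<k , w∈i′)
        with w′ , w′∈ , w′∉ , j′ , j′<k , ⊆Bj′ ← shelling-step i′<k (ℕₚ.≤-trans (ℕₚ.n≤1+n 2) lk)
        -- A third vertex `u`, different from `w` and `w′`, lies in both shared faces. Anchored
        -- there, `B j` gives all values but that at `w`, and `B j′` gives the one at `w`.
        with u , u∈ , u≢w′ ← choose-other (B k - w) w′ (ℕₚ.≤-pred (subst (3 ≤_) (∣p∣≡1+∣p-x∣ w∈) lk)) =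
        g , old , anchor lk (g u) (x∈p-y⇒x∈p u∈) gx
        where
        lj′ : Large j′
        lj′ = ℕₚ.≤-trans lk (step-size j′<k w′∈ ⊆Bj′)
        gx : ∀ {x} → x ∈ B k → g x ≈ (g u ∙ f u x)
        gx {x} x∈ with x Fin.≟ w
        ... | no x≢w   = M.sym (old j<k lj (⊆Bj (x∈p-y⇒x∈p u∈) (x∈p-y⇒x≢y u∈)) (⊆Bj x∈ x≢w))
        ... | yes refl = M.sym (old j′<k lj′ (⊆Bj′ (x∈p-y⇒x∈p u∈) u≢w′) (⊆Bj′ x∈ λ { refl → w′∉ w∈i′ }))

      extend≤ : ∀ k g → (∀ {i} → i Fin.< k → Large i → Potential g i) →
        ∃[ g′ ] (∀ {i} → i Fin.≤ k → Large i → Potential g′ i)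
      extend≤ k g old with 3 ℕₚ.≤? ∣ B k ∣
      ... | no small = g , both
        where
        both : ∀ {i} → i Fin.≤ k → Large i → Potential g i
        both {i} i≤k li with ℕₚ.m≤n⇒m<n∨m≡n i≤k
        ... | inj₁ i<k = old i<k li
        ... | inj₂ i≡k = contradiction (subst Large (toℕ-injective i≡k) li) small
      ... | yes lk with g′ , old′ , new ← extend k lk g old = g′ , both
        where
        both : ∀ {i} → i Fin.≤ k → Large i → Potential g′ i
        both {i} i≤k li with ℕₚ.m≤n⇒m<n∨m≡n i≤k
        ... | inj₁ i<k = old′ i<k li
        ... | inj₂ i≡k = subst (Potential g′) (sym (toℕ-injective i≡k)) new

      upTo : ∀ m → ∃[ g ] (∀ {i} → toℕ i < m → Large i → Potential g i)
      upTo zero = (λ _ → M.ε) , λ ()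
      upTo (suc m) with g , old ← upTo m with m ℕₚ.<? t
      ... | no m≮t  = g , λ {i} _ → old (ℕₚ.<-≤-trans (toℕ<n i) (ℕₚ.≮⇒≥ m≮t))
      ... | yes m<t with g′ , pot ← extend≤ (fromℕ< m<t) g (λ {i} i<k → old (subst (toℕ i <_) (toℕ-fromℕ< m<t) i<k)) =
        g′ , λ {i} i<m → pot (subst (toℕ i ≤_) (sym (toℕ-fromℕ< m<t)) (ℕₚ.≤-pred i<m))

∣pair∣≤2 : ∀ {n} (a b : Fin n) → ∣ ⁅ a ⁆ ∪ ⁅ b ⁆ ∣ ≤ 2
∣pair∣≤2 a b with a Fin.≟ b
... | no a≢b   = ℕₚ.≤-reflexive (∣pair∣ a≢b)
... | yes refl = ℕₚ.≤-trans (p⊆q⇒∣p∣≤∣q∣ (pair-⊆ (x∈⁅x⁆ a) (x∈⁅x⁆ a)))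
  (ℕₚ.≤-trans (ℕₚ.≤-reflexive (∣⁅x⁆∣≡1 a)) (s≤s z≤n))

module _ {n} (K : FacePred n) (s : ℕ) where

  Homologous : Chain n → Chain n → Set
  Homologous c d = Bounds K s (λ X → c X + - d X)

  homologous-isEquivalence : IsEquivalence Homologous
  homologous-isEquivalence = record
    { refl  = λ {c} → bounds-resp (λ X → sym (ℤₚ.+-inverseʳ (c X))) bounds-zero
    ; sym   = λ {c} {d} p → bounds-resp (λ X → negate (c X) (d X)) (bounds-neg p)
    ; trans = λ {c} {d} {e} p q → bounds-resp (λ X → telescope (c X) (d X) (e X)) (bounds-add p q)
    }
    where
    negate : ∀ c d → - (c + - d) ≡ d + - c
    negate = solve-∀
    telescope : ∀ c d e → (c + - d) + (d + - e) ≡ c + - e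
    telescope = solve-∀

  -- The quotient is taken by using homology as the equality, so a function into it is simply a
  -- choice of chains.
  chainsModBoundaries : Monoid 0ℓ 0ℓ
  chainsModBoundaries = record
    { Carrier = Chain n
    ; _≈_ = Homologous
    ; _∙_ = λ c d X → c X + d X
    ; ε = λ _ → 0ℤ
    ; isMonoid = record
      { isSemigroup = record
        { isMagma = record
          { isEquivalence = homologous-isEquivalence
          ; ∙-cong = λ {a} {b} {c} {d} p q →
              bounds-resp (λ X → interchange (a X) (b X) (c X) (d X)) (bounds-add p q)
          }
        ; assoc = λ a b c → bounds-resp (λ X → associate (a X) (b X) (c X)) bounds-zero
        }
      ; identity = (λ a → bounds-resp (λ X → identityˡ (a X)) bounds-zero)
                 , (λ a → bounds-resp (λ X → identityʳ (a X)) bounds-zero)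
      }
    }
    where
    interchange : ∀ a b c d → (a + - b) + (c + - d) ≡ (a + c) + - (b + d)
    interchange = solve-∀
    associate : ∀ a b c → 0ℤ ≡ ((a + b) + c) + - (a + (b + c))
    associate = solve-∀
    identityˡ : ∀ a → 0ℤ ≡ (0ℤ + a) + - a
    identityˡ = solve-∀
    identityʳ : ∀ a → 0ℤ ≡ (a + 0ℤ) + - a
    identityʳ = solve-∀

module ShellableHomology {n} (H : Complex n) (face? : ∀ X → Dec (face H X)) (dim : ∀ X → face H X → ∣ X ∣ ≤ 3)
  {t} (B : Fin t → Subset n) (facets : ∀ i → Facet H (B i)) (complete : ∀ X → Facet H X → ∃[ i ] B i ≡ X)
  (B-injective : ∀ {i j} → B i ≡ B j → i ≡ j)
  (pure : ∀ k → 1 ≤ toℕ k → 2 ≤ ∣ B k ∣ →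
    PureOfSize (λ Y → Y ⊆ B k × ∃[ i ] (i Fin.< k × Y ⊆ B i)) (∣ B k ∣ ∸ 1)) where

  open ShellableComplex H face? B facets complete B-injective pure

  H̃₀-vanishes : ∀ Q {m} → 1 ≤ m → ReducedHomologyVanishes (pureDim m (link H Q)) 1
  H̃₀-vanishes Q {m} 1≤m = inhabited-suffices λ { (Z , KZ , ∣Z∣ , _) →
    let v , v∈ = choose Z (subst (1 ≤_) (sym ∣Z∣) (s≤s z≤n))
        iv , giv , v∈iv , v∉Q = vertex KZ ∣Z∣ v∈
    -- For the boundary `b` of a 0-chain, `b ⊥` is the augmentation of that chain; the projection
    -- moves its whole mass to the base vertex `v`.
    in homology-vanishes (λ X b → b ⊥ * simplex (v ∷ []) X)
      (λ X e → cong (_* simplex (v ∷ []) X) (e ⊥))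
      (λ X k c d → distribute k (c ⊥) (d ⊥) (simplex (v ∷ []) X))
      λ { (x ∷ []) {X} _ (W , KW , ∣W∣ , X⊆W) x∈X →
        let ix , gix , x∈ix , x∉Q = vertex KW ∣W∣ (X⊆W (x∈X (here refl))) in
        bounds-resp (λ Y → cong (λ z → simplex (x ∷ []) Y + - z) (sym (trans
            (cong (_* simplex (v ∷ []) Y) (trans (contract-vertex _ x ⊥) (trans (ℤₚ.*-identityˡ _) (unit-⊥ n))))
            (ℤₚ.*-identityˡ (simplex (v ∷ []) Y)))))
          (link-connected 1≤m equiv local gix giv x∈ix x∉Q v∈iv v∉Q) } }
    where
    K : FacePred n
    K = pureDim m (link H Q)

    _≈_ : Fin n → Fin n → Set
    x ≈ y = Homologous K 1 (simplex (x ∷ [])) (simplex (y ∷ []))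

    equiv : IsEquivalence _≈_
    equiv = On.isEquivalence (λ x → simplex (x ∷ [])) (homologous-isEquivalence K 1)

    IsGood : Fin t → Set
    IsGood = Good {Q} 1≤m equiv

    distribute : ∀ k a b x → (k * a + b) * x ≡ k * (a * x) + b * x
    distribute = solve-∀

    vertex : ∀ {Z} → link H Q Z → ∣ Z ∣ ≡ suc m → ∀ {x} → x ∈ Z → ∃[ i ] (IsGood i × x ∈ B i × x ∉ Q)
    vertex {Z} (disjoint , fZ∪Q) ∣Z∣ x∈ with i , Z∪Q⊆ ← face⊆facet fZ∪Q =
      i , ((λ q∈ → Z∪Q⊆ (x∈p∪q⁺ (inj₂ q∈))) ,
        ℕₚ.≤-trans (ℕₚ.≤-reflexive (trans (cong (∣ Q ∣ ℕ.+_) (sym ∣Z∣))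
          (trans (ℕₚ.+-comm ∣ Q ∣ ∣ Z ∣) (sym (∣p∪q∣≡∣p∣+∣q∣ Z Q disjoint))))) (p⊆q⇒∣p∣≤∣q∣ Z∪Q⊆)) ,
      Z∪Q⊆ (x∈p∪q⁺ (inj₁ x∈)) , disjoint x∈

    -- Two vertices of one facet outside `Q` span an edge inside an m-dimensional face of the link;
    -- when they coincide, the edge is the zero chain.
    local : ∀ {i} → IsGood i → ∀ {x y} → x ∈ B i → x ∉ Q → y ∈ B i → y ∉ Q → x ≈ y
    local {i} (Q⊆ , size) {x} {y} x∈ x∉ y∈ y∉ =
      let Z , ⊆Z , Z⊆ , ∣Z∣ = interpolate (suc m) (B i ∩ ∁ Q)
            (pair-⊆ (x∈p∩q⁺ (x∈ , x∉p⇒x∈∁p x∉)) (x∈p∩q⁺ (y∈ , x∉p⇒x∈∁p y∉)))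
            (ℕₚ.≤-trans (∣pair∣≤2 x y) (s≤s 1≤m)) size′
      in bounds-resp (λ Y → trans (contract-edge _ y x Y)
          (cong₂ (λ a b → a + - b) (ℤₚ.*-identityˡ (simplex (x ∷ []) Y)) (ℤₚ.*-identityˡ (simplex (y ∷ []) Y))))
        (simplex-bounds pureDim-down (y ∷ x ∷ []) refl (Z , in-link Z⊆ , ∣Z∣ , ⊆-refl)
          λ { (here refl) → ⊆Z b∈pair ; (there (here refl)) → ⊆Z a∈pair })
      where
      in-link : ∀ {Z} → Z ⊆ B i ∩ ∁ Q → link H Q Z
      in-link {Z} Z⊆ = (λ z∈ → x∈∁p⇒x∉p (proj₂ (x∈p∩q⁻ (B i) (∁ Q) (Z⊆ z∈)))) ,
        down H (B i) (Z ∪ Q) Z∪Q⊆ (proj₁ (facets i))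
        where
        Z∪Q⊆ : Z ∪ Q ⊆ B i
        Z∪Q⊆ z∈ with x∈p∪q⁻ Z Q z∈
        ... | inj₁ z∈Z = proj₁ (x∈p∩q⁻ (B i) (∁ Q) (Z⊆ z∈Z))
        ... | inj₂ z∈Q = Q⊆ z∈Q
      size′ : suc m ≤ ∣ B i ∩ ∁ Q ∣
      size′ = ℕₚ.+-cancelʳ-≤ ∣ Q ∣ (suc m) _ (ℕₚ.≤-trans (ℕₚ.≤-reflexive (ℕₚ.+-comm (suc m) ∣ Q ∣))
        (ℕₚ.≤-trans size (ℕₚ.≤-trans (p⊆q⇒∣p∣≤∣q∣ Bi⊆)
          (ℕₚ.≤-reflexive (∣p∪q∣≡∣p∣+∣q∣ (B i ∩ ∁ Q) Q λ z∈ → x∈∁p⇒x∉p (proj₂ (x∈p∩q⁻ (B i) (∁ Q) z∈)))))))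
        where
        Bi⊆ : B i ⊆ (B i ∩ ∁ Q) ∪ Q
        Bi⊆ {z} z∈ with z ∈? Q
        ... | yes z∈Q = x∈p∪q⁺ (inj₂ z∈Q)
        ... | no z∉Q  = x∈p∪q⁺ (inj₁ (x∈p∩q⁺ (z∈ , x∉p⇒x∈∁p z∉Q)))

  -- A 2-dimensional face of the link already has three vertices, so `Q` must be empty and the link
  -- is the whole complex.
  H̃₁-vanishes : ∀ Q → ReducedHomologyVanishes (pureDim 2 (link H Q)) 2
  H̃₁-vanishes Q = inhabited-suffices λ { (Z , (disjoint , fZ∪Q) , ∣Z∣ , _) →
    vanishes (empty Z disjoint fZ∪Q ∣Z∣) }
    where
    empty : ∀ Z → (∀ {x} → x ∈ Z → x ∉ Q) → face H (Z ∪ Q) → ∣ Z ∣ ≡ 3 → Empty Q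
    empty Z disjoint fZ∪Q ∣Z∣ (q , q∈) = ℕₚ.<⇒≱
      (ℕₚ.≤-trans (ℕₚ.+-mono-≤ (ℕₚ.≤-reflexive (sym ∣Z∣))
          (ℕₚ.≤-trans (s≤s z≤n) (ℕₚ.≤-reflexive (sym (∣p∣≡1+∣p-x∣ q∈)))))
        (ℕₚ.≤-reflexive (sym (∣p∪q∣≡∣p∣+∣q∣ Z Q disjoint))))
      (dim _ fZ∪Q)

    K : FacePred n
    K = pureDim 2 (link H Q)

    vanishes : Empty Q → ReducedHomologyVanishes K 2
    -- Contraction with v ↦ `P v X`, evaluated at `⊥`, extends `P` linearly to 0-chains. As `P`
    -- integrates the edges modulo boundaries, the edge `x y` differs from `P y` - `P x` by a
    -- boundary.
    vanishes Q-empty = homology-vanishes (λ X b → contract (λ v → P v X) b ⊥)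
      (λ X e → contract-cong _ e ⊥) (λ X k c d → contract-linear _ k c d ⊥)
      λ { (x ∷ y ∷ []) {X} _ (Z , (_ , fZ∪Q) , ∣Z∣ , X⊆Z) l⊆X →
          basis x y fZ∪Q ∣Z∣ (X⊆Z (l⊆X (here refl))) (X⊆Z (l⊆X (there (here refl)))) }
      where
      f : Fin n → Fin n → Chain n
      f x y = simplex (x ∷ y ∷ [])

      facet∈K : ∀ {i} → 3 ≤ ∣ B i ∣ → K (B i)
      facet∈K {i} 3≤ = B i , ((λ x∈ x∈Q → Q-empty (_ , x∈Q)) , down H (B i) (B i ∪ Q) Bi∪Q⊆ (proj₁ (facets i))) ,
        ℕₚ.≤-antisym (dim (B i) (proj₁ (facets i))) 3≤ , ⊆-refl
        where
        Bi∪Q⊆ : B i ∪ Q ⊆ B i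
        Bi∪Q⊆ x∈ with x∈p∪q⁻ (B i) Q x∈
        ... | inj₁ x∈B = x∈B
        ... | inj₂ x∈Q = contradiction (_ , x∈Q) Q-empty

      cocycle : ∀ {i} → 3 ≤ ∣ B i ∣ → ∀ {x y z} → x ∈ B i → y ∈ B i → z ∈ B i →
        Homologous K 2 (λ X → f x y X + f y z X) (f x z)
      cocycle 3≤ {x} {y} {z} x∈ y∈ z∈ = bounds-resp (∂-triangle x y z)
        (simplex-bounds pureDim-down (x ∷ y ∷ z ∷ []) refl (facet∈K 3≤)
          λ { (here refl) → x∈ ; (there (here refl)) → y∈ ; (there (there (here refl))) → z∈ })

      antiderivative : ∃[ g ] (∀ {i} → 3 ≤ ∣ B i ∣ → ∀ {x y} → x ∈ B i → y ∈ B i →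
        Homologous K 2 (λ X → g x X + f x y X) (g y))
      antiderivative = potential (chainsModBoundaries K 2) f cocycle

      P : Fin n → Chain n
      P = proj₁ antiderivative

      basis : ∀ x y {Z} → face H (Z ∪ Q) → ∣ Z ∣ ≡ 3 → x ∈ Z → y ∈ Z →
        Bounds K 2 (λ Y → f x y Y + - contract (λ v → P v Y) (∂ (f x y)) ⊥)
      basis x y {Z} fZ∪Q ∣Z∣ x∈ y∈ with i , Z∪Q⊆ ← face⊆facet fZ∪Q =
        bounds-resp (λ Y → trans (rearrange (P x Y) (f x y Y) (P y Y)) (cong (λ z → f x y Y + - z) (sym (P∂ Y))))
          (proj₂ antiderivative (ℕₚ.≤-trans (ℕₚ.≤-reflexive (sym ∣Z∣)) (p⊆q⇒∣p∣≤∣q∣ Z⊆)) (Z⊆ x∈) (Z⊆ y∈))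
        where
        Z⊆ : Z ⊆ B i
        Z⊆ z∈ = Z∪Q⊆ (x∈p∪q⁺ (inj₁ z∈))
        rearrange : ∀ a b c → (a + b) + - c ≡ b + - (c + - a)
        rearrange = solve-∀
        P∂ : ∀ Y → contract (λ v → P v Y) (∂ (f x y)) ⊥ ≡ P y Y + - P x Y
        P∂ Y = trans (contract-cong p (λ X → trans (contract-edge _ x y X)
              (swap (simplex (y ∷ []) X) (simplex (x ∷ []) X))) ⊥)
          (trans (contract-linear p -1ℤ (simplex (x ∷ [])) (simplex (y ∷ [])) ⊥)
            (trans (cong₂ (λ a b → -1ℤ * a + b) (at x) (at y)) (swap′ (P x Y) (P y Y))))
          where
          p : Fin n → ℤ
          p v = P v Y
          at : ∀ v → contract p (simplex (v ∷ [])) ⊥ ≡ p v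
          at v = trans (contract-vertex p v ⊥) (trans (cong (p v *_) (unit-⊥ n)) (ℤₚ.*-identityʳ (p v)))
          swap : ∀ a b → 1ℤ * a + - (1ℤ * b) ≡ -1ℤ * b + a
          swap = solve-∀
          swap′ : ∀ a b → -1ℤ * a + b ≡ b + - a
          swap′ = solve-∀

  sequentiallyCM : SequentiallyCM H
  sequentiallyCM Q fQ m _ 0 _ = H̃₋₁-vanishes (link H Q) m
  sequentiallyCM Q fQ m _ 1 1≤m = H̃₀-vanishes Q 1≤m
  sequentiallyCM Q fQ 2 _ 2 _ = H̃₁-vanishes Q
  sequentiallyCM Q fQ 1 _ 2 (s≤s ())
  sequentiallyCM Q fQ 1 _ (suc (suc (suc _))) (s≤s ())
  sequentiallyCM Q fQ 2 _ (suc (suc (suc _))) (s≤s (s≤s ()))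
  sequentiallyCM Q fQ (suc (suc (suc m))) (Z , fZ , ∣Z∣) (suc (suc s)) _ =
    contradiction (subst (_≤ 3) ∣Z∣ (dim Z fZ)) λ { (s≤s (s≤s (s≤s ()))) }

shellable⇒sequentiallyCM : ∀ {n} (H : Complex n) → (∀ X → Dec (face H X)) → (∀ X → face H X → ∣ X ∣ ≤ 3) →
  Shellable H → SequentiallyCM H
shellable⇒sequentiallyCM H face? dim (t , B , injective , facets , complete , pure) =
  ShellableHomology.sequentiallyCM H face? dim B facets complete injective pure

-- Sequentially Cohen-Macaulay complexes and the graph of flats

module _ {k} {R : Fin k → Fin k → Set} (R? : ∀ x y → Dec (R x y)) (R-sym : ∀ {x y} → R x y → R y x) where

  private
    Labelling : (Fin k → Fin k) → Set
    Labelling label = ∀ {x y} → label x ≡ label y → Star R x y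

    union-find : ∀ (ps : List (Fin k × Fin k)) →
      ∃[ label ] (Labelling label × (∀ {x y} → (x , y) L.∈ ps → R x y → label x ≡ label y))
    union-find [] = id , (λ { refl → ε }) , λ ()
    union-find ((u , v) ∷ ps) with label , sound , complete ← union-find ps with R? u v
    ... | no ¬r = label , sound , λ { (here refl) r → contradiction r ¬r ; (there p) r → complete p r }
    ... | yes r = merge ∘ label , sound′ , λ { (here refl) _ → merged ; (there p) r′ → cong merge (complete p r′) }
      where
      merge : Fin k → Fin k
      merge z with z Fin.≟ label u
      ... | yes _ = label v
      ... | no _  = z
      merged : merge (label u) ≡ merge (label v)
      merged with label u Fin.≟ label u | label v Fin.≟ label u
      ... | yes _ | yes _ = refl
      ... | yes _ | no _  = refl
      ... | no ≢  | _     = contradiction refl ≢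
      sound′ : Labelling (merge ∘ label)
      sound′ {x} {y} e with label x Fin.≟ label u | label y Fin.≟ label u
      ... | yes x~u | yes y~u = sound (trans x~u (sym y~u))
      ... | yes x~u | no _    = sound x~u ◅◅ r ◅ sound e
      ... | no _    | yes y~u = sound e ◅◅ R-sym r ◅ sound (sym y~u)
      ... | no _    | no _    = sound e

  -- Merging the labels of the ends of one edge after another makes lying in the same component
  -- decidable.
  component-labelling : ∃[ label ]
    ((∀ {x y} → label x ≡ label y → Star R x y) × (∀ {x y} → R x y → label x ≡ label y))
  component-labelling with label , sound , complete ← union-find (List.cartesianProduct (allFin k) (allFin k)) =
    label , sound , complete (Lₚ.∈-cartesianProduct⁺ (Lₚ.∈-allFin _) (Lₚ.∈-allFin _))

contract-+ : ∀ {n} (f g : Fin n → ℤ) (c : Chain n) Y →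
  contract (λ v → f v + g v) c Y ≡ contract f c Y + contract g c Y
contract-+ f g c []            = refl
contract-+ f g c (outside ∷ Y)
  rewrite contract-+ (f ∘ suc) (g ∘ suc) (outer c) Y = lemma (f zero) (g zero) (inner c Y) _ _
  where
  lemma : ∀ f g c x y → (f + g) * c + (x + y) ≡ f * c + x + (g * c + y)
  lemma = solve-∀
contract-+ f g c (inside ∷ Y)
  rewrite contract-+ (f ∘ suc) (g ∘ suc) (inner c) Y = ℤₚ.neg-distrib-+ (contract (f ∘ suc) (inner c) Y) _

contract-covector : ∀ {n} {f g : Fin n → ℤ} → (∀ v → f v ≡ g v) → ∀ (c : Chain n) Y → contract f c Y ≡ contract g c Y
contract-covector e c []            = refl
contract-covector e c (outside ∷ Y) =
  cong₂ (λ a b → a * inner c Y + b) (e zero) (contract-covector (e ∘ suc) (outer c) Y)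
contract-covector e c (inside ∷ Y)  = cong -_ (contract-covector (e ∘ suc) (inner c) Y)

-- The value equals its own negative, and ℤ has no 2-torsion.
contract-square : ∀ {n} (f : Fin n → ℤ) (c : Chain n) Y → contract f (contract f c) Y ≡ 0ℤ
contract-square f c Y = self-negative _ (contract-anticomm f f c Y)
  where
  self-negative : ∀ i → i ≡ - i → i ≡ 0ℤ
  self-negative (ℤ.+ zero) _ = refl

module Rainbow {n} (H : Complex n) (br : BooleanRepresentable H) (dim : HasDim2 H) {A : Set}
  (_≟_ : ∀ (x y : A) → Dec (x ≡ y)) (label : Fin n → A) where

  open Geometry H br dim

  private
    K : FacePred n
    K = pureDim 2 (link H ⊥)

    tri∈K : ∀ {x y z} → Tri x y z → K (tri x y z)
    tri∈K {x} {y} {z} ((x≢y , x≢z , y≢z) , fxyz) =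
      tri x y z , ((λ _ → ∉⊥) , subst (face H) (sym (∪-identityʳ _)) fxyz) , ∣tri∣ x≢y x≢z y≢z , ⊆-refl

    indicator : A → Fin n → ℤ
    indicator l v with label v ≟ l
    ... | yes _ = 1ℤ
    ... | no _  = 0ℤ

    indicator-≡ : ∀ {l v} → label v ≡ l → indicator l v ≡ 1ℤ
    indicator-≡ {l} {v} e with label v ≟ l
    ... | yes _ = refl
    ... | no ≢  = contradiction e ≢

    indicator-≢ : ∀ {l v} → label v ≢ l → indicator l v ≡ 0ℤ
    indicator-≢ {l} {v} ≢ with label v ≟ l
    ... | yes e = contradiction e ≢
    ... | no _  = refl

    indicator-support : ∀ {l v} → indicator l v ≢ 0ℤ → label v ≡ l
    indicator-support {l} {v} ≢0 with label v ≟ l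
    ... | yes e = e
    ... | no _  = contradiction refl ≢0

  -- Split ∂ = ι_f + ι_g + ι_h by labels. No face is rainbow, so ι_g ι_f ∂ = 0 on 2-chains,
  -- whereas ι_g ι_f takes the value 1 on the boundary of the simplex a b c.
  no-rainbow-cycle : (∀ {x y} → E x y → label x ≡ label y) →
    ∀ {a b c} → label a ≢ label b → label a ≢ label c → label b ≢ label c →
    (∃[ x ] Tri a b x) → (∃[ x ] Tri a c x) → (∃[ x ] Tri b c x) →
    ¬ ReducedHomologyVanishes K 2
  no-rainbow-cycle E⇒≡ {a} {b} {c} a≢b a≢c b≢c (_ , abx) (_ , acx) (_ , bcx) vanishes =
    let d , chain-d , ∂d = vanishes cycle cycle-isChain
          (λ Y → trans (boundary≡contract cycle Y) (contract-square _ _ Y))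
    in contradiction (trans (sym Φ-cycle) (trans (contract-cong g (contract-cong f (λ X →
         trans (sym (∂d X)) (boundary≡contract d X))) ⊥) (Φ-∂ d chain-d))) λ ()
    where
    -- The simplex `a b c` is not a face, as no triangle carries three labels; only its sides lie in
    -- triangles. Being written as a boundary, the chain is closed by `contract-square`.
    cycle : Chain n
    cycle = ∂ (simplex (a ∷ b ∷ c ∷ []))

    edge-isChain : ∀ {x y z} → Tri x y z → IsChain K 2 (simplex (x ∷ y ∷ []))
    edge-isChain {x} {y} t = simplex-isChain pureDim-down (x ∷ y ∷ []) refl (tri∈K t)
      λ { (here refl) → a∈tri ; (there (here refl)) → b∈tri }

    cycle-isChain : IsChain K 2 cycle
    cycle-isChain X ≢0 =
      isChain-linear -1ℤ (edge-isChain acx) (isChain-linear 1ℤ (edge-isChain abx) (edge-isChain bcx)) X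
        λ e → ≢0 (trans (∂-triangle a b c X)
          (trans (rearrange (simplex (a ∷ b ∷ []) X) (simplex (b ∷ c ∷ []) X) (simplex (a ∷ c ∷ []) X)) e))
      where
      rearrange : ∀ x y z → x + y + - z ≡ -1ℤ * z + (1ℤ * x + y)
      rearrange = solve-∀

    f g h : Fin n → ℤ
    f = indicator (label a)
    g = indicator (label b)
    -- All labels other than those of `a` and `b` are gathered here, so the three covectors add up
    -- to the constant 1.
    h v = 1ℤ + - (f v + g v)

    Φ : Chain n → ℤ
    Φ e = contract g (contract f e) ⊥

    Φ-edge : ∀ x y → Φ (simplex (x ∷ y ∷ [])) ≡ f x * g y + - (f y * g x)
    Φ-edge x y = trans (contract-cong g (λ X → trans (contract-edge f x y X)
        (swap (f x) (f y) (simplex (y ∷ []) X) (simplex (x ∷ []) X))) ⊥)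
      (trans (contract-linear g (f x) (simplex (y ∷ [])) (λ X → - f y * simplex (x ∷ []) X) ⊥)
        (cong₂ _+_ (cong (f x *_) (at y)) (trans (contract-cong g (λ X → sym (ℤₚ.+-identityʳ _)) ⊥)
          (trans (contract-linear g (- f y) (simplex (x ∷ [])) (λ _ → 0ℤ) ⊥)
            (trans (cong₂ (λ u w → - f y * u + w) (at x) (contract-zero g ⊥)) (tidy (f y) (g x)))))))
      where
      at : ∀ v → contract g (simplex (v ∷ [])) ⊥ ≡ g v
      at v = trans (contract-vertex g v ⊥) (trans (cong (g v *_) (unit-⊥ n)) (ℤₚ.*-identityʳ (g v)))
      swap : ∀ p q u w → p * u + - (q * w) ≡ p * u + - q * w
      swap = solve-∀
      tidy : ∀ p q → - p * q + 0ℤ ≡ - (p * q)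
      tidy = solve-∀

    Φ-linear : ∀ k x y → Φ (λ X → k * x X + y X) ≡ k * Φ x + Φ y
    Φ-linear k x y = trans (contract-cong g (contract-linear f k x y) ⊥)
      (contract-linear g k (contract f x) (contract f y) ⊥)

    Φ-cycle : Φ cycle ≡ 1ℤ
    Φ-cycle = trans (contract-cong g (contract-cong f (λ X → trans (∂-triangle a b c X)
          (rearrange (simplex (a ∷ b ∷ []) X) (simplex (b ∷ c ∷ []) X) (simplex (a ∷ c ∷ []) X)))) ⊥)
      (trans (Φ-linear 1ℤ (simplex (a ∷ b ∷ [])) _)
        (trans (cong (1ℤ * Φ (simplex (a ∷ b ∷ [])) +_) (Φ-linear -1ℤ (simplex (a ∷ c ∷ [])) (simplex (b ∷ c ∷ []))))
          evaluate))
      where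
      rearrange : ∀ x y z → x + y + - z ≡ 1ℤ * x + (-1ℤ * z + y)
      rearrange = solve-∀
      evaluate : 1ℤ * Φ (simplex (a ∷ b ∷ [])) + (-1ℤ * Φ (simplex (a ∷ c ∷ [])) + Φ (simplex (b ∷ c ∷ []))) ≡ 1ℤ
      evaluate rewrite Φ-edge a b | Φ-edge a c | Φ-edge b c
        | indicator-≡ {label a} {a} refl | indicator-≢ {label a} {b} (a≢b ∘ sym)
        | indicator-≢ {label a} {c} (a≢c ∘ sym)
        | indicator-≡ {label b} {b} refl | indicator-≢ {label b} {c} (b≢c ∘ sym) = refl

    h-support : ∀ {v} → h v ≢ 0ℤ → label v ≢ label a × label v ≢ label b
    h-support {v} ≢0 with label v ≟ label a | label v ≟ label b
    ... | yes va | yes vb = contradiction (trans (sym va) vb) a≢b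
    ... | yes _  | no _   = contradiction refl ≢0
    ... | no _   | yes _  = contradiction refl ≢0
    ... | no va  | no vb  = va , vb

    ∂-split : ∀ (d : Chain n) X → ∂ d X ≡ 1ℤ * contract f d X + (1ℤ * contract g d X + contract h d X)
    ∂-split d X = trans (contract-covector (λ v → split (f v) (g v)) d X)
      (trans (contract-+ f (λ v → g v + h v) d X)
        (cong₂ _+_ (sym (ℤₚ.*-identityˡ (contract f d X)))
          (trans (contract-+ g h d X) (cong (_+ contract h d X) (sym (ℤₚ.*-identityˡ (contract g d X)))))))
      where
      split : ∀ p q → 1ℤ ≡ p + (q + (1ℤ + - (p + q)))
      split = solve-∀

    -- A nonzero value would unwind to a face `x y z` with the label of `a`, the label of `b` and a
    -- third one; but a triangle contains an edge of `E`, whose ends have equal labels.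
    rainbow : ∀ (d : Chain n) → IsChain K 3 d → Φ (contract h d) ≡ 0ℤ
    rainbow d chain-d = decidable-stable (_ ℤ.≟ 0ℤ) λ ≢0 →
      let y , _ , gy , ≢0₁ = contract-support g (contract f (contract h d)) ⊥ ≢0
          x , _ , fx , ≢0₂ = contract-support f (contract h d) (⊥ ∪ ⁅ y ⁆) ≢0₁
          z , _ , hz , ≢0₃ = contract-support h d ((⊥ ∪ ⁅ y ⁆) ∪ ⁅ x ⁆) ≢0₂
          (Z , (_ , fZ) , _ , ⊆Z) , _ = chain-d _ ≢0₃
          ly = indicator-support gy
          lx = indicator-support fx
          z≢a , z≢b = h-support hz
          x≢y : label x ≢ label y
          x≢y e = a≢b (trans (sym lx) (trans e ly))
          x≢z : label x ≢ label z
          x≢z e = z≢a (trans (sym e) lx)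
          y≢z : label y ≢ label z
          y≢z e = z≢b (trans (sym e) ly)
          y∈⊥y = q⊆p∪q ⊥ ⁅ y ⁆ (x∈⁅x⁆ y)
          y∈Z = ⊆Z (p⊆p∪q {p = (⊥ ∪ ⁅ y ⁆) ∪ ⁅ x ⁆} ⁅ z ⁆ (p⊆p∪q {p = ⊥ ∪ ⁅ y ⁆} ⁅ x ⁆ y∈⊥y))
          x∈Z = ⊆Z (p⊆p∪q {p = (⊥ ∪ ⁅ y ⁆) ∪ ⁅ x ⁆} ⁅ z ⁆ (q⊆p∪q (⊥ ∪ ⁅ y ⁆) ⁅ x ⁆ (x∈⁅x⁆ x)))
          z∈Z = ⊆Z (q⊆p∪q ((⊥ ∪ ⁅ y ⁆) ∪ ⁅ x ⁆) ⁅ z ⁆ (x∈⁅x⁆ z))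
          t : Tri x y z
          t = ((x≢y ∘ cong label) , (x≢z ∘ cong label) , (y≢z ∘ cong label)) ,
              down H _ _ (λ w∈ → x∈p∪q⁺ (inj₁ (tri-⊆ x∈Z y∈Z z∈Z w∈))) fZ
      in [ x≢y ∘ E⇒≡ , [ y≢z ∘ E⇒≡ , x≢z ∘ E⇒≡ ]′ ]′ (tri⇒edge t)

    -- The part with `f` dies because `f` occurs twice, the part with `g` for the same reason after
    -- anticommuting, and the part with `h` by `rainbow`.
    Φ-∂ : ∀ (d : Chain n) → IsChain K 3 d → Φ (∂ d) ≡ 0ℤ
    Φ-∂ d chain-d = trans (contract-cong g (contract-cong f (∂-split d)) ⊥)
      (trans (Φ-linear 1ℤ (contract f d) _) (cong₂ (λ p q → 1ℤ * p + q)
        (trans (contract-cong g (contract-square f d) ⊥) (contract-zero g ⊥))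
        (trans (Φ-linear 1ℤ (contract g d) (contract h d)) (cong₂ (λ p q → 1ℤ * p + q)
          (trans (contract-anticomm g f (contract g d) ⊥)
            (cong -_ (trans (contract-cong f (contract-square g d) ⊥) (contract-zero f ⊥))))
          (rainbow d chain-d)))))

module ComponentCount {n} (H : Complex n) (br : BooleanRepresentable H) (dim : HasDim2 H)
  {k} (π : Fin n → Fin k) (simplifies : IsSimplificationMap H π) where

  open Geometry H br dim
  open Simplification H br dim π simplifies

  flatEdge? : ∀ u v → Dec (FlatEdge (QuotientFace H π) u v)
  flatEdge? u v with a , refl ← section u with b , refl ← section v = map′ E⇒flatEdge flatEdge⇒E (E? a b)

  sequentiallyCM⇒graphOfFlats : SequentiallyCM H → GraphOfFlatsCondition (QuotientFace H π)
  sequentiallyCM⇒graphOfFlats cm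
    with v₁ , v₂ , _ , fr ← frame
    with label , sound , complete ← component-labelling flatEdge? flatEdge-sym
    with any? (λ b → any? λ b′ → flatEdge? b b′ ×-dec ¬? (label (π v₁) Fin.≟ label b))
  ... | no ¬b = inj₂ ((π v₁ , π v₂ , proj₁ v₁v₂ , v₁v₂ ◅ ε) ,
          λ v w nv nw → sound (trans (sym (nontrivial nv)) (nontrivial nw)))
    where
    v₁v₂ : FlatEdge (QuotientFace H π) (π v₁) (π v₂)
    v₁v₂ = E⇒flatEdge (Frame.edge fr)
    nontrivial : ∀ {v} → NontrivialAt (QuotientFace H π) v → label (π v₁) ≡ label v
    nontrivial (_ , v≢v , ε) = contradiction refl v≢v
    nontrivial {v} (_ , _ , e ◅ _) = decidable-stable (_ Fin.≟ _) λ ≢ → ¬b (v , _ , e , ≢)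
  ... | yes (b , b′ , bb′ , v₁≢b)
    with any? (λ c → ¬? (label (π v₁) Fin.≟ label c) ×-dec ¬? (label b Fin.≟ label c))
  ... | no ¬c = inj₁ (π v₁ , b , two)
    where
    two : ∀ v → Connected (QuotientFace H π) v (π v₁) ⊎ Connected (QuotientFace H π) v b
    two v with label (π v₁) Fin.≟ label v | label b Fin.≟ label v
    ... | yes e | _     = inj₁ (sound (sym e))
    ... | no _  | yes e = inj₂ (sound (sym e))
    ... | no ≢₁ | no ≢₂ = contradiction (v , ≢₁ , ≢₂) ¬c
  ... | yes (c , v₁≢c , b≢c) with b₀ , refl ← section b with b₁ , refl ← section b′ with c₀ , refl ← section c =
    contradiction (cm ⊥ (down H _ ⊥ ⊥⊆ (singleton H v₁)) 2 (proj₁ dim) 2 ℕₚ.≤-refl)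
      (no-rainbow-cycle edge-label v₁≢b v₁≢c b≢c
        (cross (Frame.edge fr) v₁≢b) (cross (Frame.edge fr) v₁≢c) (cross (flatEdge⇒E bb′) b≢c))
    where
    open Rainbow H br dim Fin._≟_ (label ∘ π)
    edge-label : ∀ {x y} → E x y → label (π x) ≡ label (π y)
    edge-label e = complete (E⇒flatEdge e)
    -- Only `x` is given a neighbour. Each of the three pairs contains one of the two nontrivial
    -- vertices, so the third component may be a single point.
    cross : ∀ {x y z} → E x y → label (π x) ≢ label (π z) → ∃[ w ] Tri x z w
    cross {x} {y} {z} xy x≢z = y , tri-rotate (tri-swap (tri-off xy (π≢⇒sep (x≢z ∘ cong label)) (x≢z ∘ edge-label)))

-- Construction of a shelling

subsets : ∀ n → List (Subset n)
subsets zero    = [] ∷ []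
subsets (suc n) = List.map (inside ∷_) (subsets n) List.++ List.map (outside ∷_) (subsets n)

∈-subsets : ∀ {n} (X : Subset n) → X L.∈ subsets n
∈-subsets []            = here refl
∈-subsets (inside ∷ X)  = Lₚ.∈-++⁺ˡ (Lₚ.∈-map⁺ _ (∈-subsets X))
∈-subsets (outside ∷ X) = Lₚ.∈-++⁺ʳ _ (Lₚ.∈-map⁺ _ (∈-subsets X))

module _ {A : Set} where

  private
    remove : ∀ {u : A} {ps} → u L.∈ ps →
      ∃[ ps′ ] (length ps ≡ suc (length ps′) × (∀ {q} → q L.∈ ps → q ≡ u ⊎ q L.∈ ps′))
    remove {ps = _ ∷ ps} (here refl) = ps , refl , λ { (here e) → inj₁ e ; (there q∈) → inj₂ q∈ }
    remove {ps = p ∷ ps} (there u∈) with ps′ , ∣ps∣ , split ← remove u∈ =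
      p ∷ ps′ , cong suc ∣ps∣ , λ { (here e) → inj₂ (here e) ; (there q∈) → [ inj₁ , inj₂ ∘ there ]′ (split q∈) }

  -- The list `ps` contains every element not yet in `ts` and gets shorter with each step. The same
  -- recursion serves triangles, vertices and facets.
  greedy : ∀ {universe : List A} → (∀ u → u L.∈ universe) → {I Done : List A → Set} →
    (∀ ts → I ts → Done ts ⊎ ∃[ u ] (¬ u L.∈ ts × I (u ∷ ts))) →
    ∀ ts → I ts → ∃[ ts′ ] (I ts′ × Done ts′)
  greedy {universe} complete {I} {Done} step ts Its =
    go (length universe) universe ts refl (λ u → inj₂ (complete u)) Its
    where
    go : ∀ m ps ts → length ps ≡ m → (∀ u → u L.∈ ts ⊎ u L.∈ ps) → I ts → ∃[ ts′ ] (I ts′ × Done ts′)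
    go m ps ts ∣ps∣ cover Its with step ts Its
    ... | inj₁ done = ts , Its , done
    ... | inj₂ (u , u∉ , Iu) with cover u
    ...   | inj₁ u∈ = contradiction u∈ u∉
    ...   | inj₂ u∈ with ps′ , ∣ps′∣ , split ← remove u∈ with m
    ...     | zero  = contradiction (trans (sym ∣ps′∣) ∣ps∣) λ ()
    ...     | suc m = go m ps′ (u ∷ ts) (ℕₚ.suc-injective (trans (sym ∣ps′∣) ∣ps∣)) cover′ Iu
      where
      cover′ : ∀ q → q L.∈ u ∷ ts ⊎ q L.∈ ps′
      cover′ q with cover q
      ... | inj₁ q∈ = inj₁ (there q∈)
      ... | inj₂ q∈ = [ inj₁ ∘ here , inj₂ ]′ (split q∈)

module _ {n} (H : Complex n) where

  -- The exchange form of purity, as in `shelling-step`: it names a vertex to omit instead of the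
  -- maximal faces of the intersection.
  Attaches : Subset n → List (Subset n) → Set
  Attaches T ts = ∀ {T′} → T′ L.∈ ts → ∃[ w ] (w ∈ T × w ∉ T′ ×
    ∃[ T″ ] (T″ L.∈ ts × (∀ {x} → x ∈ T → x ≢ w → x ∈ T″)))

  -- The most recently attached facet comes first.
  Shelling : List (Subset n) → Set
  Shelling []       = Unit
  Shelling (T ∷ ts) = ¬ T L.∈ ts × Facet H T × Attaches T ts × Shelling ts

  shelling⇒facet : ∀ ts → Shelling ts → ∀ {T} → T L.∈ ts → Facet H T
  shelling⇒facet (T ∷ ts) (_ , facet , _ , _) (here refl) = facet
  shelling⇒facet (T ∷ ts) (_ , _ , _ , rest)  (there T∈)  = shelling⇒facet ts rest T∈

  private
    lookup-injective : ∀ ts → Shelling ts → ∀ {i j} → List.lookup ts i ≡ List.lookup ts j → i ≡ j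
    lookup-injective (T ∷ ts) _ {zero}  {zero}  _ = refl
    lookup-injective (T ∷ ts) (T∉ , _) {zero} {suc j} refl = contradiction (Lₚ.∈-lookup j) T∉
    lookup-injective (T ∷ ts) (T∉ , _) {suc i} {zero} refl = contradiction (Lₚ.∈-lookup i) T∉
    lookup-injective (T ∷ ts) (_ , _ , _ , rest) {suc i} {suc j} e = cong suc (lookup-injective ts rest e)

    lookup-attaches : ∀ ts → Shelling ts → ∀ {a b} → a Fin.< b → ∃[ w ] (w ∈ List.lookup ts a × w ∉ List.lookup ts b ×
      ∃[ j ] (a Fin.< j × (∀ {x} → x ∈ List.lookup ts a → x ≢ w → x ∈ List.lookup ts j)))
    lookup-attaches (T ∷ ts) (_ , _ , attaches , _) {zero} {suc b} _
      with w , w∈ , w∉ , T″ , T″∈ , ⊆T″ ← attaches (Lₚ.∈-lookup b) =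
      w , w∈ , w∉ , suc (LAny.index T″∈) , s≤s z≤n , λ x∈ x≢w → subst (_ ∈_) (Anyₚ.lookup-index T″∈) (⊆T″ x∈ x≢w)
    lookup-attaches (T ∷ ts) (_ , _ , _ , rest) {suc a} {suc b} (s≤s a<b)
      with w , w∈ , w∉ , j , a<j , ⊆j ← lookup-attaches ts rest a<b =
      w , w∈ , w∉ , suc j , s≤s a<j , ⊆j

    opposite-< : ∀ {t} {i j : Fin t} → i Fin.< j → opposite j Fin.< opposite i
    opposite-< {t} {i} {j} i<j = subst₂ _<_ (sym (opposite-prop j)) (sym (opposite-prop i))
      (ℕₚ.∸-monoʳ-< (s≤s i<j) (toℕ<n j))

  -- A maximal `Y` of the intersection lies in some `B i`, hence in `B k - w`, which itself lies in
  -- an earlier facet; so the two are equal. The index is reversed because the list starts with the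
  -- last facet.
  shelling⇒shellable : ∀ ts → Shelling ts → (∀ X → Facet H X → X L.∈ ts) → Shellable H
  shelling⇒shellable ts shelling complete =
    length ts , B , injective , (λ i → shelling⇒facet ts shelling (Lₚ.∈-lookup (opposite i))) , onto , pure
    where
    B : Fin (length ts) → Subset n
    B i = List.lookup ts (opposite i)
    injective : ∀ {i j} → B i ≡ B j → i ≡ j
    injective {i} {j} e = trans (sym (opposite-involutive i))
      (trans (cong opposite (lookup-injective ts shelling e)) (opposite-involutive j))
    onto : ∀ X → Facet H X → ∃[ i ] B i ≡ X
    onto X facet with X∈ ← complete X facet = opposite (LAny.index X∈) ,
      trans (cong (List.lookup ts) (opposite-involutive (LAny.index X∈))) (sym (Anyₚ.lookup-index X∈))
    pure : ∀ k → 1 ≤ toℕ k → 2 ≤ ∣ B k ∣ → PureOfSize (λ Y → Y ⊆ B k × ∃[ i ] (i Fin.< k × Y ⊆ B i)) (∣ B k ∣ ∸ 1)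
    pure k _ _ Y (Y⊆Bk , i , i<k , Y⊆Bi) max
      with w , w∈ , w∉ , j , k<j , ⊆Bj ← lookup-attaches ts shelling (opposite-< i<k) =
      trans (cong ∣_∣ Y≡) (cong (_∸ 1) (sym (∣p∣≡1+∣p-x∣ w∈)))
      where
      Y≡ : Y ≡ B k - w
      Y≡ = max (B k - w)
        (x∈p-y⇒x∈p , opposite j , subst (opposite j Fin.<_) (opposite-involutive k) (opposite-< k<j) ,
          λ x∈ → subst (λ j → _ ∈ List.lookup ts j) (sym (opposite-involutive j)) (⊆Bj (x∈p-y⇒x∈p x∈) (x∈p-y⇒x≢y x∈)))
        λ y∈ → x∈p∧x≢y⇒x∈p-y (Y⊆Bk y∈) λ { refl → w∉ (Y⊆Bi y∈) }

facet? : ∀ {n} (H : Complex n) → (∀ X → Dec (face H X)) → ∀ X → Dec (Facet H X)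
facet? H face? X with face? X | anySubset? (λ Y → face? Y ×-dec X ⊂? Y)
... | no ¬f | _ = no (¬f ∘ proj₁)
... | yes f | yes (Y , fY , X⊆Y , y , y∈ , y∉) = no λ { (_ , max) → y∉ (subst (y ∈_) (sym (max Y fY X⊆Y)) y∈) }
... | yes f | no ¬Y = yes (f , λ Y fY X⊆Y → ⊆-antisym X⊆Y λ {y} y∈ →
  decidable-stable (y ∈? X) λ y∉ → ¬Y (Y , fY , X⊆Y , y , y∈ , y∉))

tri-rotate-≡ : ∀ {n} (a b c : Fin n) → tri a b c ≡ tri b c a
tri-rotate-≡ a b c = ⊆-antisym (tri-⊆ c∈tri a∈tri b∈tri) (tri-⊆ b∈tri c∈tri a∈tri)

module ShellingConstruction {n} (H : Complex n) (br : BooleanRepresentable H) (dim : HasDim2 H) where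

  open Geometry H br dim
  open DecMembership (Fin._≟_ {n}) using () renaming (_∈?_ to _∈ᵥ?_)
  open DecMembership (Vecₚ.≡-dec {n = n} Boolₚ._≟_) using () renaming (_∈?_ to _∈ₛ?_)

  NonIso : Fin n → Set
  NonIso v = ∃[ w ] E v w

  Complete : List (Fin n) → List (Subset n) → Set
  Complete S ts = ∀ {x y z} → x L.∈ S → y L.∈ S → z L.∈ S → Tri x y z → tri x y z L.∈ ts

  Within : List (Fin n) → List (Subset n) → Set
  Within S ts = ∀ {T} → T L.∈ ts → ∣ T ∣ ≡ 3 × (∀ {x} → x ∈ T → x L.∈ S)

  ∣Tri∣ : ∀ {a b c} → Tri a b c → ∣ tri a b c ∣ ≡ 3
  ∣Tri∣ ((a≢b , a≢c , b≢c) , _) = ∣tri∣ a≢b a≢c b≢c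

  tri-around : ∀ {T v} → face H T → ∣ T ∣ ≡ 3 → v ∈ T → ∃[ a ] ∃[ b ] (a ∈ T × b ∈ T × Tri v a b)
  tri-around {T} fT ∣T∣ v∈ with a , b , c , t , refl ← face⇒tri T fT ∣T∣ with ∈-tri⁻ v∈
  ... | inj₁ refl        = b , c , b∈tri , c∈tri , t
  ... | inj₂ (inj₁ refl) = c , a , c∈tri , a∈tri , tri-rotate t
  ... | inj₂ (inj₂ refl) = a , b , a∈tri , b∈tri , tri-rotate (tri-rotate t)

  Link : List (Fin n) → Fin n → Fin n → Fin n → Set
  Link S v p q = p L.∈ S × q L.∈ S × Tri v p q

  link-sym : ∀ {S v p q} → Link S v p q → Link S v q p
  link-sym (p∈ , q∈ , t) = q∈ , p∈ , tri-swap (tri-rotate (tri-rotate t))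

  -- `covered` lets a new triangle `v x y` meet the triangles without `v` along `x y`; `connected`
  -- lets the triangles at `v` be ordered so that each after the first shares an edge at `v` with an
  -- earlier one.
  module AddVertex (S : List (Fin n)) (v : Fin n) (v∉S : ¬ v L.∈ S)
    (covered : ∀ {x y} → x L.∈ S → y L.∈ S → Tri v x y → ∃[ z ] (z L.∈ S × Tri x y z))
    (connected : ∀ {a b x y} → Link S v a b → Link S v x y → Star (Link S v) a x) where

    Invariant : List (Subset n) → Set
    Invariant ts = Shelling H ts × Complete S ts × Within (v ∷ S) ts

    Missing : List (Subset n) → Fin n → Fin n → Set
    Missing ts x y = Link S v x y × ¬ tri v x y L.∈ ts

    Done : List (Subset n) → Set
    Done ts = ∀ {x y} → Link S v x y → tri v x y L.∈ ts

    -- The vertex to omit is `v` against triangles without `v`, `y` against those with `v` but not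
    -- `y`, and `x` against those with both, which themselves contain `v y`. By the last hypothesis
    -- `x` already shares a triangle with `v`, unless no triangle contains `v` yet.
    attach : ∀ ts → Invariant ts → ∀ x y → Missing ts x y →
      (∀ {T} → T L.∈ ts → v ∈ T → ∃[ T′ ] (T′ L.∈ ts × v ∈ T′ × x ∈ T′)) → Invariant (tri v x y ∷ ts)
    attach ts (shelling , complete , within) x y ((x∈ , y∈ , t) , missing) marked =
      (missing , tri-facet t , attaches , shelling) , (λ p q r t → there (complete p q r t)) , within′
      where
      attaches : Attaches H (tri v x y) ts
      attaches {T′} T′∈ with v ∈? T′
      ... | no v∉ = let z , z∈ , xyz = covered x∈ y∈ t in
        v , a∈tri , v∉ , tri x y z , complete x∈ y∈ z∈ xyz , rest
        where
        rest : ∀ {z u} → u ∈ tri v x y → u ≢ v → u ∈ tri x y z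
        rest u∈ u≢v with ∈-tri⁻ u∈
        ... | inj₁ refl        = contradiction refl u≢v
        ... | inj₂ (inj₁ refl) = a∈tri
        ... | inj₂ (inj₂ refl) = b∈tri
      ... | yes v∈ with y ∈? T′
      ...   | no y∉ = let T″ , T″∈ , v∈T″ , x∈T″ = marked T′∈ v∈ in
        y , c∈tri , y∉ , T″ , T″∈ , rest v∈T″ x∈T″
        where
        rest : ∀ {T″} → v ∈ T″ → x ∈ T″ → ∀ {u} → u ∈ tri v x y → u ≢ y → u ∈ T″
        rest v∈T″ x∈T″ u∈ u≢y with ∈-tri⁻ u∈
        ... | inj₁ refl        = v∈T″
        ... | inj₂ (inj₁ refl) = x∈T″
        ... | inj₂ (inj₂ refl) = contradiction refl u≢y
      ...   | yes y∈T′ = x , b∈tri , x∉ , T′ , T′∈ , rest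
        where
        x∉ : x ∉ T′
        x∉ x∈T′ = missing (subst (L._∈ ts) (sym (proj₂ (tri-facet t) T′
          (proj₁ (shelling⇒facet H ts shelling T′∈)) (tri-⊆ v∈ x∈T′ y∈T′))) T′∈)
        rest : ∀ {u} → u ∈ tri v x y → u ≢ x → u ∈ T′
        rest u∈ u≢x with ∈-tri⁻ u∈
        ... | inj₁ refl        = v∈
        ... | inj₂ (inj₁ refl) = contradiction refl u≢x
        ... | inj₂ (inj₂ refl) = y∈T′
      within′ : Within (v ∷ S) (tri v x y ∷ ts)
      within′ (there T∈) = within T∈
      within′ (here refl) = ∣Tri∣ t , ⊆vS
        where
        ⊆vS : ∀ {u} → u ∈ tri v x y → u L.∈ v ∷ S
        ⊆vS u∈ with ∈-tri⁻ u∈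
        ... | inj₁ refl        = here refl
        ... | inj₂ (inj₁ refl) = there x∈
        ... | inj₂ (inj₂ refl) = there y∈

    -- The first missing edge along a path of the link starting at a vertex already joined to v.
    missing-next-to-marked : ∀ ts {a x y} → Star (Link S v) a x → ∃[ T ] (T L.∈ ts × v ∈ T × a ∈ T) → Missing ts x y →
      ∃[ p ] ∃[ q ] (Missing ts p q × ∃[ T ] (T L.∈ ts × v ∈ T × p ∈ T))
    missing-next-to-marked ts ε marked missing = _ , _ , missing , marked
    missing-next-to-marked ts {a} (_◅_ {j = b} ab path) marked missing with tri v a b ∈ₛ? ts
    ... | yes vab∈ = missing-next-to-marked ts path (_ , vab∈ , a∈tri , c∈tri) missing
    ... | no vab∉  = a , b , (ab , vab∉) , marked

    tri? : ∀ x y z → Dec (Tri x y z)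
    tri? x y z = (¬? (x Fin.≟ y) ×-dec ¬? (x Fin.≟ z) ×-dec ¬? (y Fin.≟ z)) ×-dec face? H br (tri x y z)

    missing? : ∀ ts → Dec (∃[ x ] ∃[ y ] Missing ts x y)
    missing? ts = any? λ x → any? λ y → ((x ∈ᵥ? S) ×-dec (y ∈ᵥ? S) ×-dec tri? v x y) ×-dec ¬? (tri v x y ∈ₛ? ts)

    step : ∀ ts → Invariant ts → Done ts ⊎ ∃[ T ] (¬ T L.∈ ts × Invariant (T ∷ ts))
    step ts inv@(shelling , _ , within) with missing? ts
    ... | no ¬missing = inj₁ λ {x} {y} xy → decidable-stable (tri v x y ∈ₛ? ts) λ ∉ → ¬missing (x , y , xy , ∉)
    ... | yes (x , y , missing) with any? (λ i → v ∈? List.lookup ts i)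
    ...   | no ¬v = inj₂ (tri v x y , proj₂ missing , attach ts inv x y missing λ {T} T∈ v∈ →
              contradiction (LAny.index T∈ , subst (v ∈_) (Anyₚ.lookup-index T∈) v∈) ¬v)
    ...   | yes (i , v∈)
      with T∈ ← Lₚ.∈-lookup {xs = ts} i
      with ∣T∣ , T⊆ ← within T∈
      with a , b , a∈ , b∈ , vab ← tri-around (proj₁ (shelling⇒facet H ts shelling T∈)) ∣T∣ v∈ =
      inj₂ (tri v (proj₁ found) (proj₁ (proj₂ found)) , proj₂ (proj₁ (proj₂ (proj₂ found))) ,
        attach ts inv _ _ (proj₁ (proj₂ (proj₂ found))) λ _ _ → proj₂ (proj₂ (proj₂ found)))
      where
      in-S : ∀ {u} → v ≢ u → u ∈ List.lookup ts i → u L.∈ S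
      in-S v≢u u∈ with T⊆ u∈
      ... | here refl = contradiction refl v≢u
      ... | there u∈S = u∈S
      found : ∃[ p ] ∃[ q ] (Missing ts p q × ∃[ T ] (T L.∈ ts × v ∈ T × p ∈ T))
      found = missing-next-to-marked ts
        (connected (in-S (proj₁ (proj₁ vab)) a∈ , in-S (proj₁ (proj₂ (proj₁ vab))) b∈ , vab) (proj₁ missing))
        (_ , T∈ , v∈ , a∈) missing

    add-vertex : ∀ ts → Shelling H ts → Complete S ts → Within S ts →
      ∃[ ts′ ] (Shelling H ts′ × Complete (v ∷ S) ts′ × Within (v ∷ S) ts′)
    add-vertex ts shelling complete within
      with ts′ , (shelling′ , complete′ , within′) , done ← greedy ∈-subsets {Invariant} {Done} step ts
             (shelling , complete , λ T∈ → proj₁ (within T∈) , λ x∈ → there (proj₂ (within T∈) x∈)) =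
      ts′ , shelling′ , complete″ , within′
      where
      complete″ : Complete (v ∷ S) ts′
      complete″ (there x∈) (there y∈) (there z∈) t = complete′ x∈ y∈ z∈ t
      complete″ (here refl) (there y∈) (there z∈) t = done (y∈ , z∈ , t)
      complete″ {x} {_} {z} (there x∈) (here refl) (there z∈) t =
        subst (L._∈ ts′) (sym (tri-rotate-≡ x v z)) (done (z∈ , x∈ , tri-rotate t))
      complete″ {x} {y} (there x∈) (there y∈) (here refl) t =
        subst (L._∈ ts′) (tri-rotate-≡ v x y) (done (x∈ , y∈ , tri-rotate (tri-rotate t)))
      complete″ (here refl) (here refl) _ ((v≢v , _) , _) = contradiction refl v≢v
      complete″ (here refl) (there _) (here refl) ((_ , v≢v , _) , _) = contradiction refl v≢v
      complete″ (there _) (here refl) (here refl) ((_ , _ , v≢v) , _) = contradiction refl v≢v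

  -- The vertex `v₃` may stand for a second component of the graph. If there is an isolated vertex,
  -- `nonIso-connected` asks that one component hold all edges.
  module Growth {v₁ v₂ v₃} (fr : Frame v₁ v₂ v₃)
    (reach : ∀ {u} → NonIso u → Star E v₁ u ⊎ Star E v₃ u)
    (nonIso-connected : ∀ {v} → ¬ NonIso v → ∀ {p q} → NonIso p → NonIso q → Star E p q) where

    private module Fr = Frame fr

    AllNonIso : List (Fin n) → Set
    AllNonIso S = ∀ {u} → NonIso u → u L.∈ S

    HasNeighbour : List (Fin n) → Fin n → Set
    HasNeighbour S x = ∃[ z ] (z L.∈ S × E x z)

    record Invariant (S : List (Fin n)) : Set where
      field
        v₁∈ : v₁ L.∈ S
        v₂∈ : v₂ L.∈ S
        v₃∈ : v₃ L.∈ S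
        -- `v₃` is exempt: as the only vertex of a second component present at the start, it may
        -- lack a neighbour in `S`. The alternative takes over once isolated vertices are added.
        neighbour : ∀ {x} → x L.∈ S → x ≢ v₃ → HasNeighbour S x ⊎ AllNonIso S
        triangles : List (Subset n)
        shelling : Shelling H triangles
        complete : Complete S triangles
        within : Within S triangles

    module _ {S} (inv : Invariant S) where

      open Invariant inv

      off-plane : ∀ {Z} → ProperFlat Z → ∃[ u ] (u L.∈ S × u ∉ Z)
      off-plane proper with tri⊈proper proper Fr.triangle
      ... | inj₁ v₁∉        = v₁ , v₁∈ , v₁∉
      ... | inj₂ (inj₁ v₂∉) = v₂ , v₂∈ , v₂∉
      ... | inj₂ (inj₂ v₃∉) = v₃ , v₃∈ , v₃∉

      -- If `x y` is an edge of `E`, its flat misses a vertex of the frame. Otherwise `v` is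
      -- adjacent to `x` or `y`, so a non-isolated vertex is still outside `S`; then one of `x`, `y`
      -- differs from `v₃` and has a neighbour `z` in `S`, and the flat of that edge misses the
      -- other one.
      covered : ∀ {v} → ¬ v L.∈ S → ∀ {x y} → x L.∈ S → y L.∈ S → Tri v x y → ∃[ z ] (z L.∈ S × Tri x y z)
      covered {v} v∉ {x} {y} x∈ y∈ vxy with E? x y
      ... | yes (xy , Z , proper , x∈Z , y∈Z) with u , u∈ , u∉ ← off-plane proper =
        u , u∈ , tri-intro xy (proj₁ proper) x∈Z y∈Z u∉
      ... | no ¬xy = choose-side (x Fin.≟ v₃)
        where
        ¬all : ¬ AllNonIso S
        ¬all all with tri⇒edge vxy
        ... | inj₁ vx        = v∉ (all (x , vx))
        ... | inj₂ (inj₁ xy) = ¬xy xy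
        ... | inj₂ (inj₂ vy) = v∉ (all (y , vy))
        neighbour′ : ∀ {u} → u L.∈ S → u ≢ v₃ → HasNeighbour S u
        neighbour′ u∈ u≢v₃ = [ id , (λ all → contradiction (λ {u} → all {u}) ¬all) ]′ (neighbour u∈ u≢v₃)
        choose-side : Dec (x ≡ v₃) → ∃[ z ] (z L.∈ S × Tri x y z)
        choose-side (no x≢v₃) with z , z∈ , xz ← neighbour′ x∈ x≢v₃ =
          z , z∈ , tri-swap (tri-rotate (tri-rotate (tri-off xz (tri⇒sep (tri-rotate vxy)) ¬xy)))
        choose-side (yes refl) with z , z∈ , yz ← neighbour′ y∈ (λ { refl → proj₂ (proj₂ (proj₁ vxy)) refl }) =
          z , z∈ , tri-rotate (tri-rotate (tri-off yz (sep-sym (tri⇒sep (tri-rotate vxy))) (¬xy ∘ E-sym)))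

      -- Every vertex of the link of v is at distance at most two from the neighbour x₀ of v.
      connected-through : ∀ {v x₀} → x₀ L.∈ S → E v x₀ →
        ∀ {a b x y} → Link S v a b → Link S v x y → Star (Link S v) a x
      connected-through {v} {x₀} x₀∈ (vx₀ , Z , proper , v∈Z , x₀∈Z) (a∈ , _ , vab) (x∈ , _ , vxy) =
        to-centre a∈ (tri⇒sep vab) ◅◅ reverse link-sym (to-centre x∈ (tri⇒sep vxy))
        where
        to-centre : ∀ {p} → p L.∈ S → Sep v p → Star (Link S v) p x₀
        to-centre {p} p∈ vp with p ∈? Z
        ... | no p∉Z = link-sym (x₀∈ , p∈ , tri-intro vx₀ (proj₁ proper) v∈Z x₀∈Z p∉Z) ◅ ε
        ... | yes p∈Z with u , u∈ , u∉ ← off-plane proper =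
          (p∈ , u∈ , tri-intro vp (proj₁ proper) v∈Z p∈Z u∉) ◅
          link-sym (x₀∈ , u∈ , tri-intro vx₀ (proj₁ proper) v∈Z x₀∈Z u∉) ◅ ε

      -- The link of `v` is the graph `E`: a triangle at `v` has its edge of `E` opposite `v`, and
      -- the flat of an edge cannot contain `v`, which is separated from one of the ends and would
      -- be adjacent to it.
      connected-isolated : ∀ {v} → ¬ NonIso v → AllNonIso S →
        ∀ {a b x y} → Link S v a b → Link S v x y → Star (Link S v) a x
      connected-isolated {v} iso all (_ , _ , vab) (_ , _ , vxy) =
        gmap id E⇒link (nonIso-connected iso (_ , opposite-edge vab) (_ , opposite-edge vxy))
        where
        opposite-edge : ∀ {p q} → Tri v p q → E p q
        opposite-edge t with tri⇒edge t
        ... | inj₁ vp        = contradiction (_ , vp) iso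
        ... | inj₂ (inj₁ pq) = pq
        ... | inj₂ (inj₂ vq) = contradiction (_ , vq) iso
        E⇒link : ∀ {p q} → E p q → Link S v p q
        E⇒link {p} {q} pq@(sep , Z , proper , p∈Z , q∈Z) = all (_ , pq) , all (_ , E-sym pq) ,
          tri-rotate (tri-rotate (tri-intro sep (proj₁ proper) p∈Z q∈Z v∉Z))
          where
          v∉Z : v ∉ Z
          v∉Z v∈Z with sep-split v sep
          ... | inj₁ vp = iso (_ , vp , Z , proper , v∈Z , p∈Z)
          ... | inj₂ vq = iso (_ , vq , Z , proper , v∈Z , q∈Z)

      grow : ∀ v → ¬ v L.∈ S → HasNeighbour S v ⊎ (AllNonIso S × ¬ NonIso v) → Invariant (v ∷ S)
      grow v v∉ v-role = record
        { v₁∈ = there v₁∈ ; v₂∈ = there v₂∈ ; v₃∈ = there v₃∈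
        ; neighbour = neighbour′
        ; triangles = proj₁ extended
        ; shelling = proj₁ (proj₂ extended)
        ; complete = proj₁ (proj₂ (proj₂ extended))
        ; within = proj₂ (proj₂ (proj₂ extended))
        }
        where
        weaken : ∀ {x} → HasNeighbour S x ⊎ AllNonIso S → HasNeighbour (v ∷ S) x ⊎ AllNonIso (v ∷ S)
        weaken (inj₁ (z , z∈ , xz)) = inj₁ (z , there z∈ , xz)
        weaken (inj₂ all)           = inj₂ λ u → there (all u)
        neighbour′ : ∀ {x} → x L.∈ v ∷ S → x ≢ v₃ → HasNeighbour (v ∷ S) x ⊎ AllNonIso (v ∷ S)
        neighbour′ (there x∈) x≢v₃ = weaken (neighbour x∈ x≢v₃)
        neighbour′ (here refl) _ = weaken (Sum.map₂ proj₁ v-role)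
        connected : ∀ {a b x y} → Link S v a b → Link S v x y → Star (Link S v) a x
        connected = [ (λ { (_ , x₀∈ , vx₀) → connected-through x₀∈ vx₀ })
                    , (λ { (all , iso) → connected-isolated iso all }) ]′ v-role
        extended : ∃[ ts′ ] (Shelling H ts′ × Complete (v ∷ S) ts′ × Within (v ∷ S) ts′)
        extended = AddVertex.add-vertex S v v∉ (covered v∉) connected triangles shelling complete within

      grow-step : (∀ v → v L.∈ S) ⊎ ∃[ v ] (¬ v L.∈ S × Invariant (v ∷ S))
      grow-step with any? (λ v → ¬? (v ∈ᵥ? S) ×-dec any? λ z → (z ∈ᵥ? S) ×-dec E? v z)
      ... | yes (v , v∉ , nbr) = inj₂ (v , v∉ , grow v v∉ (inj₁ nbr))
      ... | no closed with any? (λ v → ¬? (v ∈ᵥ? S))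
      ...   | no all = inj₁ λ v → decidable-stable (v ∈ᵥ? S) λ v∉ → all (v , v∉)
      ...   | yes (v , v∉) = inj₂ (v , v∉ , grow v v∉ (inj₂ (all , v∉ ∘ all)))
        where
        -- No vertex outside `S` is adjacent to `S`, so paths cannot leave it; by `reach` it then
        -- contains all non-isolated vertices.
        walk : ∀ {p u} → Star E p u → p L.∈ S → u L.∈ S
        walk ε p∈ = p∈
        walk (_◅_ {j = q} pq path) p∈ =
          walk path (decidable-stable (q ∈ᵥ? S) λ q∉ → closed (q , q∉ , _ , p∈ , E-sym pq))
        all : AllNonIso S
        all u = [ (λ path → walk path v₁∈) , (λ path → walk path v₃∈) ]′ (reach u)

    initial : Invariant (v₁ ∷ v₂ ∷ v₃ ∷ [])
    initial = record
      { v₁∈ = here refl ; v₂∈ = there (here refl) ; v₃∈ = there (there (here refl))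
      ; neighbour = λ { (here refl) _ → inj₁ (v₂ , there (here refl) , Fr.edge)
                      ; (there (here refl)) _ → inj₁ (v₁ , here refl , E-sym Fr.edge)
                      ; (there (there (here refl))) v₃≢v₃ → contradiction refl v₃≢v₃ }
      ; triangles = tri v₁ v₂ v₃ ∷ []
      ; shelling = (λ ()) , tri-facet Fr.triangle , (λ ()) , tt
      ; complete = λ x∈ y∈ z∈ t → here (⊆∧∣∣≥⇒≡ (tri-⊆ (in-frame x∈) (in-frame y∈) (in-frame z∈))
          (ℕₚ.≤-reflexive (trans (∣Tri∣ Fr.triangle) (sym (∣Tri∣ t)))))
      ; within = λ { (here refl) → ∣Tri∣ Fr.triangle , from-frame }
      }
      where
      in-frame : ∀ {x} → x L.∈ v₁ ∷ v₂ ∷ v₃ ∷ [] → x ∈ tri v₁ v₂ v₃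
      in-frame (here refl)                 = a∈tri
      in-frame (there (here refl))         = b∈tri
      in-frame (there (there (here refl))) = c∈tri
      from-frame : ∀ {x} → x ∈ tri v₁ v₂ v₃ → x L.∈ v₁ ∷ v₂ ∷ v₃ ∷ []
      from-frame x∈ with ∈-tri⁻ x∈
      ... | inj₁ refl        = here refl
      ... | inj₂ (inj₁ refl) = there (here refl)
      ... | inj₂ (inj₂ refl) = there (there (here refl))

    HasTriangles : List (Subset n) → Set
    HasTriangles ts = ∀ {x y z} → Tri x y z → tri x y z L.∈ ts

    -- A facet outside the list has at most two vertices. Omitting `w` leaves nothing or a single
    -- vertex `u`, which lies in a listed triangle by `tri-through`.
    small-attaches : ∀ ts {X} → Shelling H ts → HasTriangles ts → Facet H X → ¬ X L.∈ ts → Attaches H X ts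
    small-attaches ts {X} shelling triangles (fX , X-max) X∉ {T′} T′∈ with any? (λ w → (w ∈? X) ×-dec ¬? (w ∈? T′))
    ... | no none = contradiction (subst (L._∈ ts) (sym (X-max T′ (proj₁ (shelling⇒facet H ts shelling T′∈))
            λ {w} w∈ → decidable-stable (w ∈? T′) λ w∉ → none (w , w∈ , w∉))) T′∈) X∉
    ... | yes (w , w∈ , w∉) with any? (λ u → (u ∈? X) ×-dec ¬? (u Fin.≟ w))
    ...   | no only = w , w∈ , w∉ , T′ , T′∈ , λ {u} u∈ u≢w → contradiction (u , u∈ , u≢w) only
    ...   | yes (u , u∈ , u≢w) with a , b , uab ← tri-through fr u =
      w , w∈ , w∉ , tri u a b , triangles uab , λ {x} x∈ x≢w →
        subst (_∈ tri u a b) (decidable-stable (u Fin.≟ x) (contradiction′ x∈ x≢w)) a∈tri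
      where
      contradiction′ : ∀ {x} → x ∈ X → x ≢ w → ¬ u ≢ x
      contradiction′ {x} x∈ x≢w u≢x = X∉ (subst (L._∈ ts) uxw≡X (triangles ((u≢x , u≢w , x≢w) ,
        subst (face H) (sym uxw≡X) fX)))
        where
        uxw≡X : tri u x w ≡ X
        uxw≡X = ⊆∧∣∣≥⇒≡ (tri-⊆ u∈ x∈ w∈) (subst (∣ X ∣ ≤_) (sym (∣tri∣ u≢x u≢w x≢w)) (proj₂ dim X fX))

    facet-step : ∀ ts → Shelling H ts × HasTriangles ts →
      (∀ X → Facet H X → X L.∈ ts) ⊎ ∃[ X ] (¬ X L.∈ ts × Shelling H (X ∷ ts) × HasTriangles (X ∷ ts))
    facet-step ts (shelling , triangles) with anySubset? (λ X → facet? H (face? H br) X ×-dec ¬? (X ∈ₛ? ts))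
    ... | no none = inj₁ λ X facet → decidable-stable (X ∈ₛ? ts) λ X∉ → none (X , facet , X∉)
    ... | yes (X , facet , X∉) = inj₂ (X , X∉ ,
      (X∉ , facet , small-attaches ts shelling triangles facet X∉ , shelling) , λ t → there (triangles t))

    shellable : Shellable H
    shellable
      with S , inv , S-full ← greedy Lₚ.∈-allFin {Invariant} {λ S → ∀ v → v L.∈ S} (λ S → grow-step) _ initial
      with ts , (shelling , _) , all ← greedy ∈-subsets
             {λ ts → Shelling H ts × HasTriangles ts} {λ ts → ∀ X → Facet H X → X L.∈ ts} facet-step
             (Invariant.triangles inv)
             (Invariant.shelling inv , Invariant.complete inv (S-full _) (S-full _) (S-full _)) =
      shelling⇒shellable H ts shelling all

-- From the graph of flats to a shelling

module _ {n} (H : Complex n) (br : BooleanRepresentable H) (dim : HasDim2 H) where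

  open Geometry H br dim
  open ShellingConstruction H br dim using (NonIso; module Growth)

  simplification-map : ∃[ k ] Σ (Fin n → Fin k) (IsSimplificationMap H)
  simplification-map with k , π , surjective , π⇔ ← quotient-map {R = λ a b → ¬ Sep a b}
    (λ a b → ¬? (sep? a b)) (record
      { refl = λ sep → proj₁ sep refl
      ; sym = λ ¬ab ba → ¬ab (sep-sym ba)
      ; trans = λ {_} {b} ¬ab ¬bc ac → [ ¬ab ∘ sep-sym , ¬bc ]′ (sep-split b ac)
      }) =
    k , π , surjective , λ a b → mk⇔
      (Equivalence.from (η⇔¬sep a b) ∘ Equivalence.to (π⇔ a b))
      (Equivalence.from (π⇔ a b) ∘ Equivalence.to (η⇔¬sep a b))

  module _ {k} (π : Fin n → Fin k) (simplifies : IsSimplificationMap H π) where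

    open Simplification H br dim π simplifies

    private
      Γ : Fin k → Fin k → Set
      Γ = Connected (QuotientFace H π)

      Γ-sym : ∀ {u v} → Γ u v → Γ v u
      Γ-sym = reverse flatEdge-sym

    -- The lifted path ends at some `q′` in the class of `q`. A neighbour `r` of `q` is adjacent to
    -- `q′` as well, and the detour over `r` reaches `q` itself.
    nonIso-path : ∀ {p q} → NonIso q → Γ (π p) (π q) → Star E p q
    nonIso-path {p} {q} (r , qr) path with q′ , πq′ , path′ ← lift-path path {p} refl =
      path′ ◅◅ E-sym (E-cong (π≡⇒¬sep (sym πq′)) (E-sym qr)) ◅ E-sym qr ◅ ε

    private
      One : Set
      One = ∀ {p q} → NonIso p → NonIso q → Γ (π p) (π q)

      one⇒shellable : One → Shellable H
      one⇒shellable one with _ , v₂ , _ , fr ← frame = Growth.shellable fr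
        (λ niso → inj₁ (nonIso-path niso (one (v₂ , Frame.edge fr) niso)))
        (λ _ np nq → nonIso-path nq (one np nq))

      isolated-endpoint : ∀ {i u} → ¬ NonIso i → Γ (π i) u → π i ≡ u
      isolated-endpoint iso ε = refl
      isolated-endpoint iso (_◅_ {j = w} e _) with _ , refl ← section w = contradiction (_ , flatEdge⇒E e) iso

      -- The component of `a` is the single class of `i`, so all vertices with an edge belong to
      -- that of `b`.
      isolated⇒one : ∀ {i a b} → ¬ NonIso i → π i ≡ a → (∀ v → Γ v a ⊎ Γ v b) → One
      isolated⇒one {i} {b = b} iso refl cover np nq = to-b np ◅◅ Γ-sym (to-b nq)
        where
        to-b : ∀ {p} → NonIso p → Γ (π p) b
        to-b {p} (r , pr) with cover (π p)
        ... | inj₂ p~b = p~b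
        ... | inj₁ p~i = contradiction
          (r , E-sym (E-cong (π≡⇒¬sep (sym (isolated-endpoint iso (Γ-sym p~i)))) (E-sym pr))) iso

      -- If the representative `b₀` of the other component lies off the plane, it takes the place of
      -- `v₃`, and the first triangle meets both components. If it lies in the plane, it is adjacent
      -- or η-equivalent to `v₁`, and there is only one component.
      two⇒shellable : (∀ v → NonIso v) → ∀ {v₁ v₂ v₃} → Frame v₁ v₂ v₃ →
        ∀ a b → Γ (π v₁) a → (∀ v → Γ v a ⊎ Γ v b) → Shellable H
      two⇒shellable nonIso {v₁} {v₂} {v₃} fr a b v₁~a cover with b₀ , refl ← section b with b₀ ∈? Frame.plane fr
      ... | no b₀∉ = Growth.shellable {v₃ = b₀}
        (record { plane = plane ; flat = flat ; sep = sep ; a∈ = a∈ ; b∈ = b∈ ; c∉ = b₀∉ })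
        (λ {u} _ → Sum.map (λ u~a → nonIso-path (nonIso u) (v₁~a ◅◅ Γ-sym u~a))
                           (λ u~b → nonIso-path (nonIso u) (Γ-sym u~b)) (cover (π u)))
        (λ iso → contradiction (nonIso _) iso)
        where open Frame fr
      ... | yes b₀∈ = Growth.shellable fr
        (λ {u} _ → inj₁ (nonIso-path (nonIso u) (v₁~a ◅◅ Γ-sym ([ id , (λ u~b → u~b ◅◅ b~a) ]′ (cover (π u))))))
        (λ iso → contradiction (nonIso _) iso)
        where
        open Frame fr
        b~a : Γ (π b₀) a
        b~a with sep? v₁ b₀
        ... | no ¬sep = subst (λ u → Γ u a) (decidable-stable (π v₁ Fin.≟ π b₀) (¬sep ∘ π≢⇒sep)) v₁~a
        ... | yes v₁b₀ = flatEdge-sym (E⇒flatEdge (v₁b₀ , plane , (flat , _ , c∉) , a∈ , b₀∈)) ◅ v₁~a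

    graphOfFlats⇒shellable : GraphOfFlatsCondition (QuotientFace H π) → Shellable H
    graphOfFlats⇒shellable (inj₂ (_ , unique)) = one⇒shellable λ np nq → unique _ _ (nontrivial np) (nontrivial nq)
      where
      nontrivial : ∀ {p} → NonIso p → NontrivialAt (QuotientFace H π) (π p)
      nontrivial (r , pr) = π r , proj₁ (E⇒flatEdge pr) , E⇒flatEdge pr ◅ ε
    graphOfFlats⇒shellable (inj₁ (a , b , cover)) with any? (λ i → ¬? (any? (E? i)))
    ... | yes (i , iso) = one⇒shellable
      ([ (λ i~a → isolated⇒one iso (isolated-endpoint iso i~a) cover)
       , (λ i~b → isolated⇒one iso (isolated-endpoint iso i~b) (Sum.swap ∘ cover)) ]′ (cover (π i)))
    ... | no none with v₁ , _ , _ , fr ← frame =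
      [ (λ v₁~a → two⇒shellable nonIso fr a b v₁~a cover)
      , (λ v₁~b → two⇒shellable nonIso fr b a v₁~b (Sum.swap ∘ cover)) ]′ (cover (π v₁))
      where
      nonIso : ∀ v → NonIso v
      nonIso v = decidable-stable (any? (E? v)) λ iso → none (v , iso)

  simplification⇒shellable : SimplificationCondition H → Shellable H
  simplification⇒shellable condition with k , π , simplifies ← simplification-map =
    graphOfFlats⇒shellable π simplifies (condition k π simplifies)

theorem5p2 : ∀ {n} (H : Complex n) → BooleanRepresentable H → HasDim2 H →
    (Shellable H ⇔ SequentiallyCM H) × (SequentiallyCM H ⇔ SimplificationCondition H)
theorem5p2 H br dim =
  mk⇔ i⇒ii (simplification⇒shellable H br dim ∘ ii⇒iii) ,
  mk⇔ ii⇒iii (i⇒ii ∘ simplification⇒shellable H br dim)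
  where
  i⇒ii : Shellable H → SequentiallyCM H
  i⇒ii = shellable⇒sequentiallyCM H (face? H br) (proj₂ dim)
  ii⇒iii : SequentiallyCM H → SimplificationCondition H
  ii⇒iii cm k π simplifies = ComponentCount.sequentiallyCM⇒graphOfFlats H br dim π simplifies cm
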